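{- Let $P$ be a $d$-polytope with $f_0(P)\ge 2d+1$ vertices and $f_{d-1}(P)=d+2$ facets. Then for all $1\le m\le d-1$, $$f_m(P)\ \ge\ \binom{d+1}{m+1}+\binom{d}{m+1}+\binom{d-1}{m+1}-\binom{\lceil d/2\rceil}{m+1}-\binom{\lceil d/2\rceil-1}{m+1}.$$ Moreover, when $f_0(P)=2d+1$ and $d\ge 4$ is even, this lower bound is sharp: it is attained for every $m\ge 1$ by $P=\big(T^{d,\frac d2-2}_2\big)^*$.
   Context: A $d$-polytope is a $d$-dimensional convex polytope; $f_m(P)$ is the number of its $m$-dimensional faces, facets are its $(d-1)$-faces, and $P^*$ denotes the dual polytope. For $1\le m\le\lfloor i/2\rfloor$, $T^i_m$ denotes the (combinatorial type of the) simplicial $i$-polytope with $i+2$ vertices that is the convex hull of an $i$-simplex together with one additional point lying beyond exactly $m$ facets of the simplex (and strictly beneath the remaining facets). For $2\le i\le d$ and $1\le m\le \lfloor i/2\rfloor$, $T^{d,d-i}_m$ denotes the $d$-polytope that is the $(d-i)$-fold pyramid over $T^i_m$. Thus $T^{d,\frac d2-2}_2$ is the $(\frac d2-2)$-fold pyramid over $T^{\frac d2+2}_2$. The convention $\binom{n}{j}=0$ for $0\le n<j$ is used. -}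

module Defs where

open import Level using (Level; _⊔_) renaming (suc to lsuc)
open import Algebra.Bundles using (CommutativeRing)
open import Data.Fin.Base using (Fin)
open import Data.Nat.Base using (ℕ; zero; suc; _∸_; ⌈_/2⌉)
  renaming (_+_ to _+ℕ_)
open import Data.Nat.Combinatorics using (_C_)
open import Data.Product using (Σ; Σ-syntax; ∃; ∃-syntax; _×_; _,_; proj₁)
open import Data.Sum using (_⊎_)
open import Data.Vec.Functional using (Vector; _∷_)
open import Function.Bundles using (Injection; Inverse)
open import Relation.Binary.Bundles using (Poset; Setoid)
open import Relation.Binary.Core using (Rel)
open import Relation.Binary.Morphism.Structures using (IsOrderIsomorphism)
open import Relation.Binary.PropositionalEquality using () renaming (setoid to ≡-setoid)
open import Relation.Binary.Structures using (IsStrictTotalOrder)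
open import Relation.Nullary using (¬_)
open import Relation.Unary using (Pred; _∈_; _∉_)
open import Relation.Unary.Relation.Binary.Subset using (⊆-poset)
import Algebra.Properties.CommutativeMonoid.Sum as Sum
import Relation.Binary.Construct.Flip.EqAndOrd as Flip
import Relation.Binary.Construct.On as On
import Relation.Binary.Construct.StrictToNonStrict as StrictToNonStrict

-- The library has no real numbers, so the geometry is developed over an
-- arbitrary ordered field with trichotomous order; classically, ℝ is one.
record OrderedField (c ℓ₁ ℓ₂ : Level) : Set (lsuc (c ⊔ ℓ₁ ⊔ ℓ₂)) where
  infix 4 _<_
  field
    commutativeRing : CommutativeRing c ℓ₁
  open CommutativeRing commutativeRing public
  field
    _<_                : Rel Carrier ℓ₂
    isStrictTotalOrder : IsStrictTotalOrder _≈_ _<_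
    0≉1                : ¬ 0# ≈ 1#
    inverse            : ∀ x → ¬ x ≈ 0# → ∃[ y ] x * y ≈ 1#
    +-monoˡ-<          : ∀ {x y} z → x < y → x + z < y + z
    *-pos              : ∀ {x y} → 0# < x → 0# < y → 0# < x * y
  open StrictToNonStrict _≈_ _<_ public using (_≤_)

module Geometry {c ℓ₁ ℓ₂ : Level} (F : OrderedField c ℓ₁ ℓ₂) where

  open OrderedField F hiding (zero)
  open Sum +-commutativeMonoid using (sum)

  Point : ℕ → Set c
  Point e = Vector Carrier e

  infix 4 _≋_
  infixl 7 _·_

  _≋_ : ∀ {e} → Rel (Point e) ℓ₁
  x ≋ y = ∀ j → x j ≈ y j

  _·_ : ∀ {e} → Point e → Point e → Carrier
  a · x = sum (λ j → a j * x j)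

  combination : ∀ {e n} → Vector Carrier n → Vector (Point e) n → Point e
  combination t V j = sum (λ i → t i * V i j)

  Region : ℕ → Set (c ⊔ lsuc (c ⊔ ℓ₁ ⊔ ℓ₂))
  Region e = Pred (Point e) (c ⊔ ℓ₁ ⊔ ℓ₂)

  Aff : ∀ {e n} → Vector (Point e) n → Pred (Point e) (c ⊔ ℓ₁)
  Aff V x = ∃[ t ] sum t ≈ 1# × combination t V ≋ x

  Conv : ∀ {e n} → Vector (Point e) n → Region e
  Conv V x = ∃[ t ] (∀ i → 0# ≤ t i) × sum t ≈ 1# × combination t V ≋ x

  AffinelyIndependent : ∀ {e n} → Vector (Point e) n → Set (c ⊔ ℓ₁)
  AffinelyIndependent V =
    ∀ t → sum t ≈ 0# → combination t V ≋ (λ _ → 0#) → ∀ i → t i ≈ 0#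

  -- The affine hull of S is k-dimensional.
  Dim : ∀ {e} → Region e → ℕ → Set (c ⊔ ℓ₁ ⊔ ℓ₂)
  Dim {e} S k = Σ[ B ∈ Vector (Point e) (suc k) ]
    (∀ i → B i ∈ S) × AffinelyIndependent B × (∀ x → x ∈ S → x ∈ Aff B)

  -- A polytope is presented by finitely many points, not necessarily all
  -- of them vertices, of which it is the convex hull.
  record Polytope (e : ℕ) : Set c where
    constructor polytope
    field
      {size} : ℕ
      points : Vector (Point e) size

    Body : Region e
    Body = Conv points

  open Polytope public

  infix 4 _is_-dimensional

  _is_-dimensional : ∀ {e} → Polytope e → ℕ → Set (c ⊔ ℓ₁ ⊔ ℓ₂)
  P is d -dimensional = Dim (Body P) d

  -- A valid inequality normal · x ≤ offset.  The zero normal is allowed, so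
  -- that the empty set and the polytope itself count as (improper) faces.
  record Face {e : ℕ} (P : Polytope e) : Set (c ⊔ ℓ₁ ⊔ ℓ₂) where
    field
      normal : Point e
      offset : Carrier
      valid  : ∀ x → x ∈ Body P → normal · x ≤ offset

    Locus : Region e
    Locus x = x ∈ Body P × normal · x ≈ offset

  open Face public

  -- Different inequalities may cut out the same face, so faces are compared
  -- as point sets: equality is _≐_ and the order is _⊆_ of the loci.
  FacePoset : ∀ {e} (P : Polytope e) → Poset _ _ _
  FacePoset {e} P = On.poset (⊆-poset (Point e) (c ⊔ ℓ₁ ⊔ ℓ₂)) (Locus {P = P})

  Faces : ∀ {e} (P : Polytope e) {ℓ : Level} → Pred (Face P) ℓ → Setoid _ _
  Faces P Q = On.setoid (Poset.Eq.setoid (FacePoset P)) (proj₁ {B = Q})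

  FacesOfDim : ∀ {e} → Polytope e → ℕ → Setoid _ _
  FacesOfDim P m = Faces P (λ G → Dim (Locus G) m)

  infix 4 #_≡_ #_≥_ f[_]_≡_ f[_]_≥_

  #_≡_ : ∀ {a ℓ} → Setoid a ℓ → ℕ → Set (a ⊔ ℓ)
  # S ≡ n = Inverse S (≡-setoid (Fin n))

  #_≥_ : ∀ {a ℓ} → Setoid a ℓ → ℕ → Set (a ⊔ ℓ)
  # S ≥ n = Injection (≡-setoid (Fin n)) S

  f[_]_≡_ : ∀ {e} → ℕ → Polytope e → ℕ → Set (c ⊔ ℓ₁ ⊔ ℓ₂)
  f[ m ] P ≡ n = # FacesOfDim P m ≡ n

  f[_]_≥_ : ∀ {e} → ℕ → Polytope e → ℕ → Set (c ⊔ ℓ₁ ⊔ ℓ₂)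
  f[ m ] P ≥ n = # FacesOfDim P m ≥ n

  -- Combinatorial duality: the face lattices are anti-isomorphic.
  IsDual : ∀ {e e′} → Polytope e → Polytope e′ → Set (c ⊔ ℓ₁ ⊔ ℓ₂)
  IsDual P Q = Σ (Face P → Face Q) (IsOrderIsomorphism P._≈_ Q*._≈_ P._≤_ Q*._≤_)
    where
    module P  = Poset (FacePoset P)
    module Q* = Poset (Flip.poset (FacePoset Q))

  adjoin : ∀ {e} → Point e → Polytope e → Polytope e
  adjoin x P = polytope (x ∷ points P)

  data IteratedPyramid {e : ℕ} (B : Polytope e) : ℕ → Polytope e → Set (c ⊔ ℓ₁) where
    base : IteratedPyramid B zero B
    cone : ∀ {r Q} → IteratedPyramid B r Q →
           (apex : Point e) → apex ∉ Aff (points Q) →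
           IteratedPyramid B (suc r) (adjoin apex Q)

  -- For a facet G and x in the affine hull of the polytope these do not
  -- depend on the inequality chosen to define G.
  Beyond Beneath : ∀ {e} {P : Polytope e} → Point e → Face P → Set ℓ₂
  Beyond  x G = offset G < normal G · x
  Beneath x G = normal G · x < offset G

  -- Q is a realisation of T^i_m.
  data IsT {e : ℕ} (i m : ℕ) : Polytope e → Set (c ⊔ ℓ₁ ⊔ ℓ₂) where
    isT : (V : Vector (Point e) (suc i)) (x : Point e) →
          AffinelyIndependent V →
          x ∈ Aff V →
          let Δ       = polytope V
              IsFacet = λ (G : Face Δ) → Dim (Locus G) (i ∸ 1)
          in
          # Faces Δ (λ G → IsFacet G × Beyond x G) ≡ m →
          (∀ G → IsFacet G → Beyond x G ⊎ Beneath x G) →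
          IsT i m (adjoin x Δ)

  -- Q is a realisation of T^{d,r}_m, the r-fold pyramid over T^{d-r}_m.
  IsPyramidT : ∀ {e} (d r m : ℕ) → Polytope e → Set (c ⊔ ℓ₁ ⊔ ℓ₂)
  IsPyramidT {e} d r m Q =
    Σ[ B ∈ Polytope e ] IsT (d ∸ r) m B × IteratedPyramid B r Q

-- For d ≥ 2 no truncation occurs: the subtracted terms are dominated by the
-- first two, and d - 1 and ⌈d/2⌉ - 1 are natural numbers.
bound : ℕ → ℕ → ℕ
bound d m =
  ((d +ℕ 1) C (m +ℕ 1) +ℕ d C (m +ℕ 1) +ℕ (d ∸ 1) C (m +ℕ 1))
    ∸ ⌈ d /2⌉ C (m +ℕ 1) ∸ (⌈ d /2⌉ ∸ 1) C (m +ℕ 1)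

{-# OPTIONS --safe #-}

-- A d-polytope with d + 2 facets is governed by the single linear relation μ between its facet
-- functionals.  Since these generate all valid inequalities, the sets of facets that avoid a face
-- (all facets not containing it) are exactly the sets meeting the positive part of μ iff they meet the
-- negative part; and the face lattice determines dimensions, because a cover raises the dimension by one.
-- With p, q and r positive, negative and zero entries in μ, counting these sets gives f₀ = p q + r and
--   f_m = C(d+2,m+2) − C(q+r,m+2) − C(p+r,m+2) + C(r+1,m+2).
-- If f₀ ≥ 2d + 1, then p, q ≥ 3, and convexity of n ↦ C(n,m+1) yields the bound.
-- The same sets describe the dual of a pyramid over T^i_2, as supports of nonnegative vectors orthogonal
-- to the affine dependency of its d + 2 vertices; there p = 3, q = d/2 + 1 and r = d/2 − 2.

module Submission where

open import Defs
open import Level using (Level; _⊔_)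
open import Data.Bool.Base using (Bool; true; false; if_then_else_; not; _∧_; _∨_; T)
open import Data.Bool.Properties using (∨-zeroʳ)
open import Data.Nat.Base as ℕ using (ℕ; zero; suc; _∸_)
import Data.Nat.Properties as ℕ
open import Data.Nat.Divisibility using (_∣_; divides)
open import Data.Nat.Induction using (<-wellFounded)
open import Data.Nat.Solver using (module +-*-Solver)
open import Data.Fin.Base using (Fin; zero; suc; toℕ; fromℕ<; inject≤; punchIn; punchOut; _↑ˡ_; _↑ʳ_; splitAt; combine; remQuot)
import Data.Fin.Properties as Fin
open import Data.Fin.Subset using (Subset; inside; outside; _∈_; _∉_; _⊆_; _⊂_; ∣_∣; ⊥; ⊤)
open import Data.Fin.Subset.Properties using
  ( p⊆q⇒∣p∣≤∣q∣; p⊂q⇒∣p∣<∣q∣; x∈p⇒∣p-x∣<∣p∣; ⊆-antisym; _∈?_; ∉⊥; ∣⊥∣≡0; ∣p∣≤n; ∈⊤; ⊆⊤; ∣⊤∣≡n )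
open import Data.Product using (Σ-syntax; ∃-syntax; ∃; _×_; _,_; proj₁; proj₂; uncurry)
open import Data.Sum using (_⊎_; inj₁; inj₂; [_,_]′)
open import Data.Vec.Base using (tabulate)
open import Data.Vec.Properties using (lookup⇒[]=; []=⇒lookup; lookup∘tabulate)
open import Function.Base using (_∘_; id; case_of_)
open import Function.Bundles using (Inverse; Injection)
open import Induction.WellFounded using (Acc; acc)
open import Relation.Binary.Bundles using (Setoid)
open import Relation.Binary.Core using (Rel)
open import Relation.Binary.Definitions using (tri<; tri≈; tri>)
open import Relation.Binary.Morphism.Structures using (IsOrderIsomorphism)
open import Relation.Binary.PropositionalEquality as ≡ using (_≡_)
open import Relation.Binary.Structures using (IsStrictTotalOrder)
open import Relation.Nullary using (¬_; Dec; yes; no; contradiction; does)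
open import Relation.Nullary.Decidable using (¬?; toSum; dec-true; dec-false; decidable-stable; _×-dec_)
open import Relation.Unary using (Pred; Decidable)
open import Relation.Unary.Properties using (U?)
import Algebra.Properties.Ring as RingProperties
import Algebra.Properties.Semiring.Mult.TCOptimised as Mult
import Algebra.Properties.Semiring.Sum as SemiringSum
import Algebra.Solver.Ring as RingSolver
import Algebra.Solver.Ring.AlmostCommutativeRing as ACR
import Relation.Binary.Reasoning.Setoid as SetoidReasoning

-- The sets arise as follows. Evaluating the d + 2 facet functionals identifies the cone over P with
-- the vectors y ≥ 0 that satisfy ∑ μⱼyⱼ = 0, and a face is determined by the support of a point in
-- its relative interior. Such a support can meet one side only if the other side compensates, and
-- all supports of this kind occur. Two obstacles shape the proof. Faces are point sets cut out by
-- arbitrary inequalities over an arbitrary ordered field, so containment is first reduced to the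
-- finitely many presenting points. And `IsDual` is purely order-theoretic, saying nothing about
-- affine hulls, so dimensions must be recovered from the order alone. Hence everything passes
-- through `Code`, which serves polytopes with d + 2 facets and duals of pyramids alike. The
-- condition p, q ≥ 3 comes from p + q + r = d + 2: it turns p q + r ≥ 2d + 1 into (p - 2)(q - 2) ≥
-- r + 1. For p = 3 the windows of binomials compared by convexity are empty, and q = 3 + r then
-- gives equality.

search : ∀ {n a b} {A : Fin n → Set a} {B : Fin n → Set b} →
         (∀ i → A i ⊎ B i) → (∀ i → A i) ⊎ ∃ B
search {zero}  _ = inj₁ λ ()
search {suc n} d with d zero | search (d ∘ suc)
... | inj₂ b | _             = inj₂ (zero , b)
... | inj₁ _ | inj₂ (i , b)  = inj₂ (suc i , b)
... | inj₁ a | inj₁ as       = inj₁ λ { zero → a ; (suc i) → as i }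

true-iff : ∀ {a b} → (a ≡ true → b ≡ true) → (b ≡ true → a ≡ true) → a ≡ b
true-iff {true}          f g = ≡.sym (f ≡.refl)
true-iff {false} {true}  f g = g ≡.refl
true-iff {false} {false} f g = ≡.refl

true-irrelevant : ∀ {b : Bool} (p q : b ≡ true) → p ≡ q
true-irrelevant ≡.refl ≡.refl = ≡.refl

true⊎false : ∀ b → b ≡ true ⊎ b ≡ false
true⊎false true  = inj₁ ≡.refl
true⊎false false = inj₂ ≡.refl

-- Gale sets and their enumeration

module Subsets where

  open import Algebra.Properties.CommutativeSemigroup ℕ.+-commutativeSemigroup using (interchange)
  open import Data.Nat.Combinatorics using (_C_; nCk+nC[k+1]≡[n+1]C[k+1])
  open import Data.Vec.Base using ([]; _∷_; _[_]≔_; here; there)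

  b2n : Bool → ℕ
  b2n true  = 1
  b2n false = 0

  -- The recursion splits on membership of the first element, so that counting subsets by size
  -- reproduces Pascal's rule.
  ∑ₛ : ∀ N → (Subset N → ℕ) → ℕ
  ∑ₛ zero    w = w []
  ∑ₛ (suc N) w = ∑ₛ N (w ∘ (inside ∷_)) ℕ.+ ∑ₛ N (w ∘ (outside ∷_))

  ∑ₛ-cong : ∀ N {v w : Subset N → ℕ} → (∀ A → v A ≡ w A) → ∑ₛ N v ≡ ∑ₛ N w
  ∑ₛ-cong zero    eq = eq []
  ∑ₛ-cong (suc N) eq = ≡.cong₂ ℕ._+_ (∑ₛ-cong N (eq ∘ (inside ∷_))) (∑ₛ-cong N (eq ∘ (outside ∷_)))

  ∑ₛ-zero : ∀ N → ∑ₛ N (λ _ → 0) ≡ 0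
  ∑ₛ-zero zero    = ≡.refl
  ∑ₛ-zero (suc N) = ≡.cong₂ ℕ._+_ (∑ₛ-zero N) (∑ₛ-zero N)

  ∑ₛ-+ : ∀ N (v w : Subset N → ℕ) → ∑ₛ N (λ A → v A ℕ.+ w A) ≡ ∑ₛ N v ℕ.+ ∑ₛ N w
  ∑ₛ-+ zero    v w = ≡.refl
  ∑ₛ-+ (suc N) v w = ≡.trans
    (≡.cong₂ ℕ._+_ (∑ₛ-+ N (v ∘ (inside ∷_)) (w ∘ (inside ∷_))) (∑ₛ-+ N (v ∘ (outside ∷_)) (w ∘ (outside ∷_))))
    (interchange (∑ₛ N (v ∘ (inside ∷_))) _ _ _)

  #ₛ : ∀ {N} → (Subset N → Bool) → ℕ
  #ₛ {N} f = ∑ₛ N (b2n ∘ f)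

  one : ∀ b → b ≡ true → Fin (b2n b)
  one true _ = zero

  holds : ∀ b → Fin (b2n b) → b ≡ true
  holds true _ = ≡.refl

  one-holds : ∀ b i → one b (holds b i) ≡ i
  one-holds true zero = ≡.refl

  -- With its inverse `member` it provides the explicit bijection with `Fin` that an exact face
  -- number demands.
  index : ∀ {N} (f : Subset N → Bool) A → f A ≡ true → Fin (#ₛ f)
  index {zero}  f []           eq = one (f []) eq
  index {suc N} f (true  ∷ A)  eq = index (f ∘ (inside ∷_)) A eq ↑ˡ #ₛ (f ∘ (outside ∷_))
  index {suc N} f (false ∷ A)  eq = #ₛ (f ∘ (inside ∷_)) ↑ʳ index (f ∘ (outside ∷_)) A eq

  member : ∀ {N} (f : Subset N → Bool) → Fin (#ₛ f) → ∃[ A ] f A ≡ true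
  member {zero}  f i = [] , holds (f []) i
  member {suc N} f i with splitAt (#ₛ (f ∘ (inside ∷_))) i
  ... | inj₁ j = let (A , eq) = member (f ∘ (inside ∷_)) j in inside ∷ A , eq
  ... | inj₂ j = let (A , eq) = member (f ∘ (outside ∷_)) j in outside ∷ A , eq

  member-index : ∀ {N} (f : Subset N → Bool) A eq → proj₁ (member f (index f A eq)) ≡ A
  member-index {zero}  f [] eq = ≡.refl
  member-index {suc N} f (true ∷ A) eq
    rewrite Fin.splitAt-↑ˡ (#ₛ (f ∘ (inside ∷_))) (index (f ∘ (inside ∷_)) A eq) (#ₛ (f ∘ (outside ∷_)))
    = ≡.cong (inside ∷_) (member-index (f ∘ (inside ∷_)) A eq)
  member-index {suc N} f (false ∷ A) eq
    rewrite Fin.splitAt-↑ʳ (#ₛ (f ∘ (inside ∷_))) (#ₛ (f ∘ (outside ∷_))) (index (f ∘ (outside ∷_)) A eq)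
    = ≡.cong (outside ∷_) (member-index (f ∘ (outside ∷_)) A eq)

  index-member : ∀ {N} (f : Subset N → Bool) i → index f (proj₁ (member f i)) (proj₂ (member f i)) ≡ i
  index-member {zero}  f i = one-holds (f []) i
  index-member {suc N} f i with splitAt (#ₛ (f ∘ (inside ∷_))) i in split
  ... | inj₁ j = ≡.trans (≡.cong (_↑ˡ _) (index-member (f ∘ (inside ∷_)) j)) (Fin.splitAt⁻¹-↑ˡ split)
  ... | inj₂ j = ≡.trans (≡.cong (_ ↑ʳ_) (index-member (f ∘ (outside ∷_)) j)) (Fin.splitAt⁻¹-↑ʳ split)

  index-cong : ∀ {N} (f : Subset N → Bool) {A B} (p : f A ≡ true) (q : f B ≡ true) → A ≡ B → index f A p ≡ index f B q
  index-cong f p q ≡.refl = ≡.cong (index f _) (true-irrelevant p q)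

  -- The sides of a Radon partition, nul marking the points outside it.
  data Side : Set where
    pos neg nul : Side

  pos? neg? nonnul? : Side → Bool
  pos? pos = true
  pos? _   = false
  neg? neg = true
  neg? _   = false
  nonnul? s = pos? s ∨ neg? s

  meets : ∀ {N} → (Fin N → Bool) → Subset N → Bool
  meets κ []      = false
  meets κ (b ∷ A) = (b ∧ κ zero) ∨ meets (κ ∘ suc) A

  meets⁺ : ∀ {N} {κ : Fin N → Bool} {A i} → i ∈ A → κ i ≡ true → meets κ A ≡ true
  meets⁺ {κ = κ} here            eq rewrite eq = ≡.refl
  meets⁺ {κ = κ} (there {y = b} i∈A) eq rewrite meets⁺ {κ = κ ∘ suc} i∈A eq = ∨-zeroʳ (b ∧ κ zero)

  meets⁻ : ∀ {N} (κ : Fin N → Bool) A → meets κ A ≡ true → ∃[ i ] i ∈ A × κ i ≡ true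
  meets⁻ κ (true ∷ A) eq with κ zero in eq₀
  ... | true  = zero , here , eq₀
  ... | false = let (i , i∈A , κi) = meets⁻ (κ ∘ suc) A eq in suc i , there i∈A , κi
  meets⁻ κ (false ∷ A) eq = let (i , i∈A , κi) = meets⁻ (κ ∘ suc) A eq in suc i , there i∈A , κi

  meets-mono : ∀ {N} (κ : Fin N → Bool) {A B} → A ⊆ B → meets κ A ≡ true → meets κ B ≡ true
  meets-mono κ {A} A⊆B eq = let (_ , i∈A , κi) = meets⁻ κ A eq in meets⁺ (A⊆B i∈A) κi

  insert : ∀ {N} → Fin N → Subset N → Subset N
  insert x A = A [ x ]≔ inside

  x∈insert : ∀ {N} (x : Fin N) A → x ∈ insert x A
  x∈insert zero    (_ ∷ A) = here
  x∈insert (suc x) (_ ∷ A) = there (x∈insert x A)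

  ⊆insert : ∀ {N} (x : Fin N) A → A ⊆ insert x A
  ⊆insert zero    (_ ∷ A) here        = here
  ⊆insert zero    (_ ∷ A) (there i∈A) = there i∈A
  ⊆insert (suc x) (_ ∷ A) here        = here
  ⊆insert (suc x) (_ ∷ A) (there i∈A) = there (⊆insert x A i∈A)

  ∈insert⁻ : ∀ {N} (x : Fin N) A {i} → i ∈ insert x A → i ≡ x ⊎ i ∈ A
  ∈insert⁻ zero    (_ ∷ A) here        = inj₁ ≡.refl
  ∈insert⁻ zero    (_ ∷ A) (there i∈A) = inj₂ (there i∈A)
  ∈insert⁻ (suc x) (_ ∷ A) here        = inj₂ here
  ∈insert⁻ (suc x) (_ ∷ A) (there i∈)  with ∈insert⁻ x A i∈
  ... | inj₁ ≡.refl = inj₁ ≡.refl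
  ... | inj₂ i∈A    = inj₂ (there i∈A)

  insert⊆ : ∀ {N} {x : Fin N} {A B} → x ∈ B → A ⊆ B → insert x A ⊆ B
  insert⊆ {x = x} {A} x∈B A⊆B i∈ with ∈insert⁻ x A i∈
  ... | inj₁ ≡.refl = x∈B
  ... | inj₂ i∈A    = A⊆B i∈A

  ∣insert∣ : ∀ {N} (x : Fin N) A → x ∉ A → ∣ insert x A ∣ ≡ suc ∣ A ∣
  ∣insert∣ zero    (true  ∷ A) x∉A = contradiction here x∉A
  ∣insert∣ zero    (false ∷ A) x∉A = ≡.refl
  ∣insert∣ (suc x) (true  ∷ A) x∉A = ≡.cong suc (∣insert∣ x A (x∉A ∘ there))
  ∣insert∣ (suc x) (false ∷ A) x∉A = ∣insert∣ x A (x∉A ∘ there)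

  meets-insert : ∀ {N} (κ : Fin N → Bool) x A → κ x ≡ false → meets κ (insert x A) ≡ true → meets κ A ≡ true
  meets-insert κ x A κx eq with meets⁻ κ (insert x A) eq
  ... | i , i∈ , κi with ∈insert⁻ x A i∈
  ...   | inj₁ ≡.refl = case ≡.trans (≡.sym κx) κi of λ ()
  ...   | inj₂ i∈A    = meets⁺ i∈A κi

  x∈p⇒0<∣p∣ : ∀ {N} {x : Fin N} {A} → x ∈ A → 0 ℕ.< ∣ A ∣
  x∈p⇒0<∣p∣ x∈A = ℕ.≤-<-trans ℕ.z≤n (x∈p⇒∣p-x∣<∣p∣ x∈A)

  module GaleSets {N} (σ : Fin N → Side) where

    meets⁰ meets¹ : Subset N → Bool
    meets⁰ = meets (pos? ∘ σ)
    meets¹ = meets (neg? ∘ σ)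

    -- By Gale duality these are the supports of the nonnegative vectors orthogonal to a vector with signs σ.
    Gale : Subset N → Set
    Gale A = meets⁰ A ≡ meets¹ A

    -- For a Gale set `A`, the dimension of the cone of nonnegative vectors supported in `A` and
    -- orthogonal to a vector with signs `σ`: ∣A∣ coordinates, less one when the orthogonality
    -- condition is not void on `A`. It will be one more than the dimension of the corresponding
    -- face.
    rank : Subset N → ℕ
    rank A = ∣ A ∣ ∸ b2n (meets⁰ A)

    gale : Subset N → Bool
    gale A = if meets⁰ A then meets¹ A else not (meets¹ A)

    gale⁺ : ∀ A → Gale A → gale A ≡ true
    gale⁺ A eq with meets⁰ A | meets¹ A
    ... | true  | true  = ≡.refl
    ... | false | false = ≡.refl

    gale⁻ : ∀ A → gale A ≡ true → Gale A
    gale⁻ A eq with meets⁰ A | meets¹ A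
    ... | true  | true  = ≡.refl
    ... | false | false = ≡.refl

    -- Only the passage from a set meeting neither side to one meeting both is delicate: the
    -- correction term costs one, but the larger set gains a positive and a negative element, hence
    -- two.
    rank-mono-< : ∀ {A B} → Gale A → Gale B → A ⊂ B → rank A ℕ.< rank B
    rank-mono-< {A} {B} gA gB A⊂B@(A⊆B , _) with meets⁰ A in mA | meets⁰ B in mB
    ... | false | false = p⊂q⇒∣p∣<∣q∣ A⊂B
    ... | true  | true  = ℕ.∸-monoˡ-< (p⊂q⇒∣p∣<∣q∣ A⊂B) (x∈p⇒0<∣p∣ (proj₁ (proj₂ (meets⁻ _ A mA))))
    ... | true  | false = case ≡.trans (≡.sym mB) (meets-mono (pos? ∘ σ) A⊆B mA) of λ ()
    ... | false | true  with meets⁻ (pos? ∘ σ) B mB | meets⁻ (neg? ∘ σ) B (≡.sym gB)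
    ...   | x , x∈B , σx | y , y∈B , σy =
      ℕ.∸-monoˡ-≤ 1 (≡.subst (ℕ._≤ ∣ B ∣) (≡.cong suc (∣insert∣ x A x∉A))
        (p⊂q⇒∣p∣<∣q∣ {p = insert x A} (insert⊆ x∈B A⊆B , y , y∈B , y∉)))
      where
      x∉A : x ∉ A
      x∉A x∈A = case ≡.trans (≡.sym mA) (meets⁺ x∈A σx) of λ ()
      y∉ : y ∉ insert x A
      y∉ y∈ with ∈insert⁻ x A y∈
      ... | inj₂ y∈A = case ≡.trans gA (meets⁺ y∈A σy) of λ ()
      ... | inj₁ ≡.refl with σ y
      ...   | pos = case σy of λ ()
      ...   | neg = case σx of λ ()
      ...   | nul = case σx of λ ()

    -- The lattice of Gale sets has no jumps in rank. Once both sides are met, any further element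
    -- may be added. Before that, a null element is added alone and a positive one only together
    -- with a negative one, and the pair raises the rank by one only.
    step : ∀ {A B} → Gale A → Gale B → A ⊂ B →
           ∃[ K ] Gale K × A ⊂ K × K ⊆ B × rank K ≡ suc (rank A)
    step {A} {B} gA gB (A⊆B , x , x∈B , x∉A) with meets⁰ A in mA
    ... | true = K , ≡.trans m⁰K (≡.sym m¹K) , (⊆insert x A , x , x∈insert x A , x∉A) , insert⊆ x∈B A⊆B , (begin
      ∣ K ∣ ∸ b2n (meets⁰ K)  ≡⟨ ≡.cong₂ (λ k b → k ∸ b2n b) (∣insert∣ x A x∉A) m⁰K ⟩
      ∣ A ∣  ≡⟨ ℕ.suc-pred ∣ A ∣ {{ℕ.>-nonZero (x∈p⇒0<∣p∣ (proj₁ (proj₂ (meets⁻ _ A mA))))}} ⟨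
      suc (∣ A ∣ ∸ 1) ∎)
      where
      open ≡.≡-Reasoning
      K = insert x A
      m⁰K : meets⁰ K ≡ true
      m⁰K = meets-mono (pos? ∘ σ) (⊆insert x A) mA
      m¹K : meets¹ K ≡ true
      m¹K = meets-mono (neg? ∘ σ) (⊆insert x A) (≡.sym gA)
    ... | false = by-side (σ x) ≡.refl
      where
      miss : ∀ κ (i : Fin N) → meets κ A ≡ false → κ i ≡ true → i ∉ A
      miss κ i m κi i∈A = case ≡.trans (≡.sym m) (meets⁺ i∈A κi) of λ ()
      pair : ∀ {p q} → p ∈ B → q ∈ B → σ p ≡ pos → σ q ≡ neg →
             ∃[ K ] Gale K × A ⊂ K × K ⊆ B × rank K ≡ suc ∣ A ∣
      pair {p} {q} p∈B q∈B σp σq =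
        K , ≡.trans m⁰K (≡.sym m¹K) , (⊆insert p _ ∘ ⊆insert q A , q , q∈K , q∉A) , insert⊆ p∈B (insert⊆ q∈B A⊆B) , (begin
        ∣ K ∣ ∸ b2n (meets⁰ K)  ≡⟨ ≡.cong₂ (λ k b → k ∸ b2n b) (∣insert∣ p _ p∉) m⁰K ⟩
        ∣ insert q A ∣  ≡⟨ ∣insert∣ q A q∉A ⟩
        suc ∣ A ∣ ∎)
        where
        open ≡.≡-Reasoning
        K = insert p (insert q A)
        q∈K = ⊆insert p _ (x∈insert q A)
        m⁰K : meets⁰ K ≡ true
        m⁰K = meets⁺ (x∈insert p (insert q A)) (≡.cong pos? σp)
        m¹K : meets¹ K ≡ true
        m¹K = meets⁺ q∈K (≡.cong neg? σq)
        q∉A : q ∉ A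
        q∉A = miss (neg? ∘ σ) q (≡.sym gA) (≡.cong neg? σq)
        p∉ : p ∉ insert q A
        p∉ p∈ with ∈insert⁻ q A p∈
        ... | inj₁ ≡.refl = case ≡.trans (≡.sym σp) σq of λ ()
        ... | inj₂ p∈A    = miss (pos? ∘ σ) p mA (≡.cong pos? σp) p∈A
      side⁻¹ : ∀ {κ : Side → Bool} {s} → (∀ t → κ t ≡ true → t ≡ s) → meets (κ ∘ σ) B ≡ true → ∃[ i ] i ∈ B × σ i ≡ s
      side⁻¹ {κ} inv m with meets⁻ (κ ∘ σ) B m
      ... | i , i∈B , eq = i , i∈B , inv (σ i) eq
      pos⁻¹ : ∀ t → pos? t ≡ true → t ≡ pos
      pos⁻¹ pos _ = ≡.refl
      neg⁻¹ : ∀ t → neg? t ≡ true → t ≡ neg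
      neg⁻¹ neg _ = ≡.refl
      by-side : ∀ s → σ x ≡ s → ∃[ K ] Gale K × A ⊂ K × K ⊆ B × rank K ≡ suc ∣ A ∣
      by-side pos σx with side⁻¹ neg⁻¹ (≡.trans (≡.sym gB) (meets⁺ x∈B (≡.cong pos? σx)))
      ... | q , q∈B , σq = pair x∈B q∈B σx σq
      by-side neg σx with side⁻¹ pos⁻¹ (≡.trans gB (meets⁺ x∈B (≡.cong neg? σx)))
      ... | p , p∈B , σp = pair p∈B x∈B σp σx
      by-side nul σx = insert x A , ≡.trans m⁰K (≡.sym m¹K) , (⊆insert x A , x , x∈insert x A , x∉A) , insert⊆ x∈B A⊆B ,
                       ≡.cong₂ (λ k b → k ∸ b2n b) (∣insert∣ x A x∉A) m⁰K
        where
        avoid : ∀ κ → κ x ≡ false → meets κ A ≡ false → meets κ (insert x A) ≡ false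
        avoid κ κx m with meets κ (insert x A) in m′
        ... | false = ≡.refl
        ... | true  = ≡.trans (≡.sym (meets-insert κ x A κx m′)) m
        m⁰K : meets⁰ (insert x A) ≡ false
        m⁰K = avoid (pos? ∘ σ) (≡.cong pos? σx) mA
        m¹K : meets¹ (insert x A) ≡ false
        m¹K = avoid (neg? ∘ σ) (≡.cong neg? σx) (≡.sym gA)

    ofRank : ℕ → Subset N → Bool
    ofRank k A = gale A ∧ (rank A ℕ.≡ᵇ k)

    ofRank⁺ : ∀ {k A} → Gale A → rank A ≡ k → ofRank k A ≡ true
    ofRank⁺ {k} {A} g ≡.refl rewrite gale⁺ A g = ≡ᵇ-refl (rank A)
      where
      ≡ᵇ-refl : ∀ n → (n ℕ.≡ᵇ n) ≡ true
      ≡ᵇ-refl zero    = ≡.refl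
      ≡ᵇ-refl (suc n) = ≡ᵇ-refl n

    ofRank⁻ : ∀ {k A} → ofRank k A ≡ true → Gale A × rank A ≡ k
    ofRank⁻ {k} {A} eq with gale A in g
    ... | true = gale⁻ A g , ℕ.≡ᵇ⇒≡ (rank A) k (≡.subst T (≡.sym eq) _)

  ∑-Fin : ∀ {N} → (Fin N → ℕ) → ℕ
  ∑-Fin {zero}  f = 0
  ∑-Fin {suc N} f = f zero ℕ.+ ∑-Fin (f ∘ suc)

  tally : ∀ {N} → (Fin N → Bool) → ℕ
  tally κ = ∑-Fin (b2n ∘ κ)

  -- A marked first element must stay outside, so only the second half of the sum survives; an
  -- unmarked one gives both terms of Pascal's rule.
  tally-avoiding : ∀ {N} (κ : Fin N → Bool) j →
               ∑ₛ N (λ A → b2n ((∣ A ∣ ℕ.≡ᵇ j) ∧ not (meets κ A))) ≡ tally (not ∘ κ) C j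
  tally-avoiding {zero}  κ zero    = ≡.refl
  tally-avoiding {zero}  κ (suc j) = ≡.refl
  tally-avoiding {suc N} κ j with κ zero
  ... | true  = ≡.cong₂ ℕ._+_ (≡.trans (∑ₛ-cong N (λ A → never (suc ∣ A ∣ ℕ.≡ᵇ j))) (∑ₛ-zero N)) (tally-avoiding (κ ∘ suc) j)
    where
    never : ∀ b → b2n (b ∧ false) ≡ 0
    never true  = ≡.refl
    never false = ≡.refl
  tally-avoiding {suc N} κ zero    | false = ≡.cong₂ ℕ._+_ (∑ₛ-zero N) (tally-avoiding (κ ∘ suc) 0)
  tally-avoiding {suc N} κ (suc j) | false = ≡.trans (≡.cong₂ ℕ._+_ (tally-avoiding (κ ∘ suc) j) (tally-avoiding (κ ∘ suc) (suc j)))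
    (nCk+nC[k+1]≡[n+1]C[k+1] (tally (not ∘ κ ∘ suc)) j)

  meets-∨ : ∀ {N} (κ κ′ : Fin N → Bool) A → meets (λ i → κ i ∨ κ′ i) A ≡ meets κ A ∨ meets κ′ A
  meets-∨ κ κ′ []          = ≡.refl
  meets-∨ κ κ′ (false ∷ A) = meets-∨ (κ ∘ suc) (κ′ ∘ suc) A
  meets-∨ κ κ′ (true ∷ A) with κ zero | κ′ zero
  ... | true  | _     = ≡.refl
  ... | false | true  = ≡.sym (∨-zeroʳ (meets (κ ∘ suc) A))
  ... | false | false = meets-∨ (κ ∘ suc) (κ′ ∘ suc) A

  meets-never : ∀ {N} (A : Subset N) → meets (λ _ → false) A ≡ false
  meets-never []          = ≡.refl
  meets-never (false ∷ A) = meets-never A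
  meets-never (true ∷ A)  = meets-never A

  tally-true : ∀ N → tally {N} (λ _ → true) ≡ N
  tally-true zero    = ≡.refl
  tally-true (suc N) = ≡.cong suc (tally-true N)

  module _ {N} (σ : Fin N → Side) where

    open GaleSets σ

    -- Inclusion–exclusion over the sets avoiding one side, moved so that no subtraction occurs.
    #-ofRank : ∀ m → #ₛ (ofRank (suc m)) ℕ.+ (tally (not ∘ pos? ∘ σ) C (2 ℕ.+ m) ℕ.+ tally (not ∘ neg? ∘ σ) C (2 ℕ.+ m))
                     ≡ N C (2 ℕ.+ m) ℕ.+ (tally (not ∘ nonnul? ∘ σ) C (2 ℕ.+ m) ℕ.+ tally (not ∘ nonnul? ∘ σ) C (1 ℕ.+ m))
    #-ofRank m = begin
      #ₛ (ofRank (suc m)) ℕ.+ (tally (not ∘ pos? ∘ σ) C j ℕ.+ tally (not ∘ neg? ∘ σ) C j)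
        ≡⟨ ≡.cong (#ₛ (ofRank (suc m)) ℕ.+_) (≡.cong₂ ℕ._+_ (≡.sym (tally-avoiding (pos? ∘ σ) j)) (≡.sym (tally-avoiding (neg? ∘ σ) j))) ⟩
      #ₛ (ofRank (suc m)) ℕ.+ (∑ₛ N w₁ ℕ.+ ∑ₛ N w₂)
        ≡⟨ ≡.cong (#ₛ (ofRank (suc m)) ℕ.+_) (∑ₛ-+ N w₁ w₂) ⟨
      #ₛ (ofRank (suc m)) ℕ.+ ∑ₛ N (λ A → w₁ A ℕ.+ w₂ A)
        ≡⟨ ∑ₛ-+ N (b2n ∘ ofRank (suc m)) (λ A → w₁ A ℕ.+ w₂ A) ⟨
      ∑ₛ N (λ A → b2n (ofRank (suc m) A) ℕ.+ (w₁ A ℕ.+ w₂ A))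
        ≡⟨ ∑ₛ-cong N pointwise ⟩
      ∑ₛ N (λ A → w₃ A ℕ.+ (w₄ j A ℕ.+ w₄ (suc m) A))
        ≡⟨ ∑ₛ-+ N w₃ (λ A → w₄ j A ℕ.+ w₄ (suc m) A) ⟩
      ∑ₛ N w₃ ℕ.+ ∑ₛ N (λ A → w₄ j A ℕ.+ w₄ (suc m) A)
        ≡⟨ ≡.cong (∑ₛ N w₃ ℕ.+_) (∑ₛ-+ N (w₄ j) (w₄ (suc m))) ⟩
      ∑ₛ N w₃ ℕ.+ (∑ₛ N (w₄ j) ℕ.+ ∑ₛ N (w₄ (suc m)))
        ≡⟨ ≡.cong₂ ℕ._+_ (≡.trans (tally-avoiding {N} (λ _ → false) j) (≡.cong (_C j) (tally-true N)))
                          (≡.cong₂ ℕ._+_ (tally-avoiding (nonnul? ∘ σ) j) (tally-avoiding (nonnul? ∘ σ) (suc m))) ⟩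
      N C j ℕ.+ (tally (not ∘ nonnul? ∘ σ) C j ℕ.+ tally (not ∘ nonnul? ∘ σ) C (suc m)) ∎
      where
      open ≡.≡-Reasoning
      j = 2 ℕ.+ m
      w₁ w₂ w₃ : Subset N → ℕ
      w₁ A = b2n ((∣ A ∣ ℕ.≡ᵇ j) ∧ not (meets⁰ A))
      w₂ A = b2n ((∣ A ∣ ℕ.≡ᵇ j) ∧ not (meets¹ A))
      w₃ A = b2n ((∣ A ∣ ℕ.≡ᵇ j) ∧ not (meets (λ _ → false) A))
      w₄ : ℕ → Subset N → ℕ
      w₄ k A = b2n ((∣ A ∣ ℕ.≡ᵇ k) ∧ not (meets (nonnul? ∘ σ) A))
      -- A Gale set has rank m + 1 either with m + 2 elements, meeting both sides, or with m + 1
      -- elements, meeting neither. The last summand on the right supplies the second kind; the rest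
      -- is inclusion-exclusion among the sets of size m + 2.
      pointwise : ∀ A → b2n (ofRank (suc m) A) ℕ.+ (w₁ A ℕ.+ w₂ A) ≡ w₃ A ℕ.+ (w₄ j A ℕ.+ w₄ (suc m) A)
      pointwise A rewrite meets-never A | meets-∨ (pos? ∘ σ) (neg? ∘ σ) A
        with meets⁰ A | meets¹ A | ∣ A ∣
      ... | true  | true  | zero   = ≡.refl
      ... | false | true  | zero   = ≡.refl
      ... | true  | false | zero   = ≡.refl
      ... | false | false | zero   = ≡.refl
      ... | true  | true  | suc n  with n ℕ.≡ᵇ suc m | n ℕ.≡ᵇ m
      ...   | true  | true  = ≡.refl
      ...   | true  | false = ≡.refl
      ...   | false | true  = ≡.refl
      ...   | false | false = ≡.refl
      pointwise A | true  | false | suc n with n ℕ.≡ᵇ suc m | n ℕ.≡ᵇ m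
      ...   | true  | true  = ≡.refl
      ...   | true  | false = ≡.refl
      ...   | false | true  = ≡.refl
      ...   | false | false = ≡.refl
      pointwise A | false | true  | suc n with n ℕ.≡ᵇ suc m | n ℕ.≡ᵇ m
      ...   | true  | true  = ≡.refl
      ...   | true  | false = ≡.refl
      ...   | false | true  = ≡.refl
      ...   | false | false = ≡.refl
      pointwise A | false | false | suc n with n ℕ.≡ᵇ suc m | n ℕ.≡ᵇ m
      ...   | true  | true  = ≡.refl
      ...   | true  | false = ≡.refl
      ...   | false | true  = ≡.refl
      ...   | false | false = ≡.refl

  meets-cong : ∀ {N} {κ κ′ : Fin N → Bool} → (∀ j → κ j ≡ κ′ j) → ∀ A → meets κ A ≡ meets κ′ A
  meets-cong eq []          = ≡.refl
  meets-cong eq (true ∷ A)  rewrite eq zero = ≡.cong (_ ∨_) (meets-cong (eq ∘ suc) A)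
  meets-cong eq (false ∷ A) = meets-cong (eq ∘ suc) A

  ⊆-or-gap : ∀ {N} (A B : Subset N) j → (j ∈ A → j ∈ B) ⊎ (j ∈ A × j ∉ B)
  ⊆-or-gap A B j with j ∈? A | j ∈? B
  ... | no j∉  | _      = inj₁ λ j∈ → contradiction j∈ j∉
  ... | yes _  | yes j∈ = inj₁ λ _ → j∈
  ... | yes j∈ | no j∉  = inj₂ (j∈ , j∉)

  meets-⊥ : ∀ {N} (κ : Fin N → Bool) → meets κ ⊥ ≡ false
  meets-⊥ {zero}  κ = ≡.refl
  meets-⊥ {suc N} κ = meets-⊥ (κ ∘ suc)

  gale-⊥ : ∀ {N} (σ : Fin N → Side) → GaleSets.Gale σ ⊥
  gale-⊥ σ = ≡.trans (meets-⊥ (pos? ∘ σ)) (≡.sym (meets-⊥ (neg? ∘ σ)))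

  -- The analogue of `index` for elements of `Fin N`; it later enumerates the facets of a simplex
  -- that a point lies beyond.
  position : ∀ {N} (κ : Fin N → Bool) j → κ j ≡ true → Fin (tally κ)
  position κ zero    eq = one (κ zero) eq ↑ˡ _
  position κ (suc j) eq = b2n (κ zero) ↑ʳ position (κ ∘ suc) j eq

  nth : ∀ {N} (κ : Fin N → Bool) → Fin (tally κ) → ∃[ j ] κ j ≡ true
  nth {suc N} κ i with splitAt (b2n (κ zero)) i
  ... | inj₁ k = zero , holds (κ zero) k
  ... | inj₂ k = let (j , eq) = nth (κ ∘ suc) k in suc j , eq

  nth-position : ∀ {N} (κ : Fin N → Bool) j eq → proj₁ (nth κ (position κ j eq)) ≡ j
  nth-position κ zero    eq rewrite Fin.splitAt-↑ˡ _ (one (κ zero) eq) (tally (κ ∘ suc)) = ≡.refl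
  nth-position κ (suc j) eq rewrite Fin.splitAt-↑ʳ (b2n (κ zero)) _ (position (κ ∘ suc) j eq) =
    ≡.cong suc (nth-position (κ ∘ suc) j eq)

  position-nth : ∀ {N} (κ : Fin N → Bool) i → position κ (proj₁ (nth κ i)) (proj₂ (nth κ i)) ≡ i
  position-nth {suc N} κ i with splitAt (b2n (κ zero)) i in split
  ... | inj₁ k = ≡.trans (≡.cong (_↑ˡ _) (one-holds (κ zero) k)) (Fin.splitAt⁻¹-↑ˡ split)
  ... | inj₂ k = ≡.trans (≡.cong (_ ↑ʳ_) (position-nth (κ ∘ suc) k)) (Fin.splitAt⁻¹-↑ʳ split)

  position-cong : ∀ {N} (κ : Fin N → Bool) {i j} p q → i ≡ j → position κ i p ≡ position κ j q
  position-cong κ p q ≡.refl = ≡.cong (position κ _) (true-irrelevant p q)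

  tally-none : ∀ {N} (κ : Fin N → Bool) → (∀ j → κ j ≡ false) → tally κ ≡ 0
  tally-none {zero}  κ _  = ≡.refl
  tally-none {suc N} κ κ≡false rewrite κ≡false zero = tally-none (κ ∘ suc) (κ≡false ∘ suc)

open Subsets

-- Binomial estimates

module Binomials where

  open import Data.Nat.Base using (_+_; _*_; _≤_; _<_; z≤n; s≤s; ⌈_/2⌉; ⌊_/2⌋)
  open import Data.Nat.Combinatorics using (_C_; nCk+nC[k+1]≡[n+1]C[k+1]; nC1≡n; nCk≡nC[n∸k])
  open import Data.Nat.Combinatorics.Specification using (k>n⇒nCk≡0)
  open import Data.Nat.Properties
  open import Relation.Binary.PropositionalEquality
  open +-*-Solver

  module _ {N} (σ : Fin N → Side) where

    #₊ #₋ #₀ : ℕ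
    #₊ = tally (pos? ∘ σ)
    #₋ = tally (neg? ∘ σ)
    #₀ = tally (not ∘ nonnul? ∘ σ)

  #-sides : ∀ {N} (σ : Fin N → Side) → #₊ σ + #₋ σ + #₀ σ ≡ N
  #-sides {zero}  σ = refl
  #-sides {suc N} σ with σ zero | #-sides (σ ∘ suc)
  ... | pos | ih = cong suc ih
  ... | neg | ih = trans (cong (_+ #₀ (σ ∘ suc)) (+-suc (#₊ (σ ∘ suc)) _)) (cong suc ih)
  ... | nul | ih = trans (+-suc (#₊ (σ ∘ suc) + #₋ (σ ∘ suc)) _) (cong suc ih)

  #-not-pos : ∀ {N} (σ : Fin N → Side) → tally (not ∘ pos? ∘ σ) ≡ #₋ σ + #₀ σ
  #-not-pos {zero}  σ = refl
  #-not-pos {suc N} σ with σ zero | #-not-pos (σ ∘ suc)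
  ... | pos | ih = ih
  ... | neg | ih = cong suc ih
  ... | nul | ih = trans (cong suc ih) (sym (+-suc _ _))

  #-not-neg : ∀ {N} (σ : Fin N → Side) → tally (not ∘ neg? ∘ σ) ≡ #₊ σ + #₀ σ
  #-not-neg {zero}  σ = refl
  #-not-neg {suc N} σ with σ zero | #-not-neg (σ ∘ suc)
  ... | pos | ih = cong suc ih
  ... | neg | ih = ih
  ... | nul | ih = trans (cong suc ih) (sym (+-suc _ _))

  pascal : ∀ n k → suc n C suc k ≡ n C k + n C suc k
  pascal n k = sym (nCk+nC[k+1]≡[n+1]C[k+1] n k)

  C-monoˡ-≤ : ∀ {m n} k → m ≤ n → m C suc k ≤ n C suc k
  C-monoˡ-≤ {m} {n} k m≤n with m≤n⇒∃[o]m+o≡n m≤n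
  ... | o , refl = go o
    where
    go : ∀ o → m C suc k ≤ (m + o) C suc k
    go zero    rewrite +-identityʳ m = ≤-refl
    go (suc o) rewrite +-suc m o | pascal (m + o) k = ≤-trans (go o) (m≤n+m _ _)

  ∑< : ℕ → (ℕ → ℕ) → ℕ → ℕ
  ∑< zero    c n = 0
  ∑< (suc x) c n = c n + ∑< x c (suc n)

  -- Iterated Pascal's rule. It trades a difference of two binomials for a window of `x` consecutive
  -- values in the preceding column; windows of equal length can then be compared term by term.
  C-telescope : ∀ x n k → (x + n) C suc k ≡ ∑< x (_C k) n + n C suc k
  C-telescope zero    n k = refl
  C-telescope (suc x) n k = begin
    suc (x + n) C suc k  ≡⟨ cong (_C suc k) (+-suc x n) ⟨
    (x + suc n) C suc k  ≡⟨ C-telescope x (suc n) k ⟩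
    ∑< x (_C k) (suc n) + suc n C suc k  ≡⟨ cong (∑< x (_C k) (suc n) +_) (pascal n k) ⟩
    ∑< x (_C k) (suc n) + (n C k + n C suc k)  ≡⟨ solve 3 (λ s a b → s :+ (a :+ b) := (a :+ s) :+ b) refl (∑< x (_C k) (suc n)) (n C k) (n C suc k) ⟩
    n C k + ∑< x (_C k) (suc n) + n C suc k ∎
    where open ≡-Reasoning

  -- Convexity of n ↦ n C k, compared with the slope β at n₀.
  module Convex (k n₀ : ℕ) where

    c : ℕ → ℕ
    c n = n C (2 + k)

    β : ℕ
    β = n₀ C suc k

    -- From `n₀` on each increment of `c` is at least `β`; `below` is the counterpart for the
    -- increments before `n₀`, which are at most `β`.
    above : ∀ j {n} → n₀ ≤ n → c n + j * β ≤ c (j + n)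
    above zero    {n} n₀≤n = ≤-reflexive (+-identityʳ (c n))
    above (suc j) {n} n₀≤n = begin
      c n + (β + j * β)  ≡⟨ solve 3 (λ a b c → a :+ (b :+ c) := b :+ (a :+ c)) refl (c n) β (j * β) ⟩
      β + (c n + j * β)  ≤⟨ +-mono-≤ (C-monoˡ-≤ k (≤-trans n₀≤n (m≤n+m n j))) (above j n₀≤n) ⟩
      (j + n) C suc k + c (j + n)  ≡⟨ pascal (j + n) (suc k) ⟨
      c (suc j + n) ∎
      where open ≤-Reasoning

    below : ∀ j {n} → j + n ≤ n₀ → c (j + n) ≤ c n + j * β
    below zero    {n} _ = ≤-reflexive (sym (+-identityʳ (c n)))
    below (suc j) {n} j+n<n₀ = begin
      c (suc j + n)  ≡⟨ pascal (j + n) (suc k) ⟩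
      (j + n) C suc k + c (j + n)  ≤⟨ +-mono-≤ (C-monoˡ-≤ k (<⇒≤ j+n<n₀)) (below j (<⇒≤ j+n<n₀)) ⟩
      β + (c n + j * β)  ≡⟨ solve 3 (λ a b c → a :+ (b :+ c) := b :+ (a :+ c)) refl (c n) β (j * β) ⟨
      c n + (β + j * β) ∎
      where open ≤-Reasoning

    -- Moving a window of `x` values up by `y` gains at least y β in each term.
    above-∑ : ∀ x y {n} → n₀ ≤ n → ∑< x c n + x * (y * β) ≤ ∑< x c (y + n)
    above-∑ zero    y n₀≤n = z≤n
    above-∑ (suc x) y {n} n₀≤n = begin
      c n + ∑< x c (suc n) + (y * β + x * (y * β))  ≡⟨ solve 4 (λ a b c d → a :+ b :+ (c :+ d) := (a :+ c) :+ (b :+ d)) refl (c n) (∑< x c (suc n)) (y * β) (x * (y * β)) ⟩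
      (c n + y * β) + (∑< x c (suc n) + x * (y * β))  ≤⟨ +-mono-≤ (above y n₀≤n) (above-∑ x y (m≤n⇒m≤1+n n₀≤n)) ⟩
      c (y + n) + ∑< x c (y + suc n)  ≡⟨ cong (λ z → c (y + n) + ∑< x c z) (+-suc y n) ⟩
      c (y + n) + ∑< x c (suc (y + n)) ∎
      where open ≤-Reasoning

  module _ (k x y r h′ : ℕ) where

    open Convex k (3 + r)

    private
      h = suc h′

    -- If h ≥ r + 2 the comparison is termwise; otherwise the deficit 2 (r + 2 − h) of the two
    -- lower terms is at most x y, and convexity makes the gain of the x upper terms outweigh it.
    shifted-sum : 4 + x + y + r ≤ h + h → r ≤ x + y + x * y →
                  c (1 + r) + c (2 + r) + ∑< x c (3 + r) ≤ ∑< x c (y + (3 + r)) + (c h + c h′)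
    shifted-sum d≤2h r≤ with 2 + r ≤? h
    ... | yes r+2≤h = begin
      c (1 + r) + c (2 + r) + ∑< x c (3 + r)  ≤⟨ +-mono-≤ (+-mono-≤ (C-monoˡ-≤ (suc k) (≤-pred r+2≤h)) (C-monoˡ-≤ (suc k) r+2≤h)) (m+n≤o⇒m≤o (∑< x c (3 + r)) (above-∑ x y ≤-refl)) ⟩
      c h′ + c h + ∑< x c (y + (3 + r))  ≡⟨ solve 3 (λ a b s → a :+ b :+ s := s :+ (b :+ a)) refl (c h′) (c h) (∑< x c (y + (3 + r))) ⟩
      ∑< x c (y + (3 + r)) + (c h + c h′) ∎
      where open ≤-Reasoning
    ... | no r+2≰h with m≤n⇒∃[o]m+o≡n (<⇒≤ (≰⇒> r+2≰h))
    ...   | s , h+s≡r+2 = begin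
      c (1 + r) + c (2 + r) + ∑< x c (3 + r)  ≤⟨ +-monoˡ-≤ (∑< x c (3 + r)) (+-mono-≤ c[1+r] c[2+r]) ⟩
      (c h′ + s * β) + (c h + s * β) + ∑< x c (3 + r)  ≡⟨ solve 5 (λ a b s β t → (a :+ s :* β) :+ (b :+ s :* β) :+ t := (t :+ (s :+ s) :* β) :+ (b :+ a)) refl (c h′) (c h) s β (∑< x c (3 + r)) ⟩
      (∑< x c (3 + r) + (s + s) * β) + (c h + c h′)  ≤⟨ +-monoˡ-≤ (c h + c h′) (+-monoʳ-≤ (∑< x c (3 + r)) (*-monoˡ-≤ β 2s≤xy)) ⟩
      (∑< x c (3 + r) + (x * y) * β) + (c h + c h′)  ≡⟨ cong (λ z → ∑< x c (3 + r) + z + (c h + c h′)) (*-assoc x y β) ⟩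
      (∑< x c (3 + r) + x * (y * β)) + (c h + c h′)  ≤⟨ +-monoˡ-≤ (c h + c h′) (above-∑ x y ≤-refl) ⟩
      ∑< x c (y + (3 + r)) + (c h + c h′) ∎
      where
      open ≤-Reasoning
      s+h≡ : s + h ≡ 2 + r
      s+h≡ = trans (+-comm s h) h+s≡r+2
      s+h′≡ : s + h′ ≡ 1 + r
      s+h′≡ = suc-injective (trans (sym (+-suc s h′)) s+h≡)
      c[2+r] : c (2 + r) ≤ c h + s * β
      c[2+r] = subst (λ z → c z ≤ c h + s * β) s+h≡ (below s (≤-trans (≤-reflexive s+h≡) (n≤1+n _)))
      c[1+r] : c (1 + r) ≤ c h′ + s * β
      c[1+r] = subst (λ z → c z ≤ c h′ + s * β) s+h′≡ (below s (≤-trans (≤-reflexive s+h′≡) (m≤n+m _ 2)))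
      -- The two lower terms lose 2s = 2(r + 2) - 2h in total. Since 2h ≥ 4 + x + y + r, this is at
      -- most r - x - y, and the hypothesis on `r` bounds that by x y.
      2s≤xy : s + s ≤ x * y
      2s≤xy = +-cancelˡ-≤ (4 + x + y + r) _ _ (begin
        4 + x + y + r + (s + s)  ≤⟨ +-monoˡ-≤ (s + s) d≤2h ⟩
        h + h + (s + s)  ≡⟨ solve 2 (λ h s → h :+ h :+ (s :+ s) := (h :+ s) :+ (h :+ s)) refl h s ⟩
        (h + s) + (h + s)  ≡⟨ cong₂ _+_ h+s≡r+2 h+s≡r+2 ⟩
        (2 + r) + (2 + r)  ≡⟨ solve 1 (λ r → (con 2 :+ r) :+ (con 2 :+ r) := con 4 :+ r :+ r) refl r ⟩
        4 + r + r  ≤⟨ +-monoʳ-≤ (4 + r) r≤ ⟩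
        4 + r + (x + y + x * y)  ≡⟨ solve 4 (λ r x y z → con 4 :+ r :+ (x :+ y :+ z) := con 4 :+ x :+ y :+ r :+ z) refl r x y (x * y) ⟩
        4 + x + y + r + x * y ∎)

  -- A count of pairs: the pairs among the q + r elements that are not positive and those among the
  -- p + r that are not negative overlap in the pairs of null elements, and together miss only the p
  -- q mixed pairs. The extra r counts the null singletons.
  vertex-count : ∀ p q r → (p + q + r) C 2 + (r C 2 + r C 1) ≡ (p * q + r) + ((q + r) C 2 + (p + r) C 2)
  vertex-count zero q r = begin
    (q + r) C 2 + (r C 2 + r C 1)  ≡⟨ cong (λ z → (q + r) C 2 + (r C 2 + z)) (nC1≡n r) ⟩
    (q + r) C 2 + (r C 2 + r)  ≡⟨ solve 3 (λ a b r → a :+ (b :+ r) := r :+ (a :+ b)) refl ((q + r) C 2) (r C 2) r ⟩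
    r + ((q + r) C 2 + r C 2) ∎
    where open ≡-Reasoning
  vertex-count (suc p) q r = begin
    suc (p + q + r) C 2 + e  ≡⟨ cong (_+ e) (trans (pascal (p + q + r) 1) (cong (_+ (p + q + r) C 2) (nC1≡n (p + q + r)))) ⟩
    (p + q + r) + (p + q + r) C 2 + e  ≡⟨ +-assoc (p + q + r) _ e ⟩
    (p + q + r) + ((p + q + r) C 2 + e)  ≡⟨ cong (p + q + r +_) (vertex-count p q r) ⟩
    (p + q + r) + ((p * q + r) + ((q + r) C 2 + (p + r) C 2))  ≡⟨ solve 6 (λ p q r z a b → (p :+ q :+ r) :+ ((z :+ r) :+ (a :+ b)) := (q :+ z :+ r) :+ (a :+ ((p :+ r) :+ b))) refl p q r (p * q) ((q + r) C 2) ((p + r) C 2) ⟩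
    (q + p * q + r) + ((q + r) C 2 + ((p + r) + (p + r) C 2))  ≡⟨ cong (λ z → (q + p * q + r) + ((q + r) C 2 + z)) (trans (pascal (p + r) 1) (cong (_+ (p + r) C 2) (nC1≡n (p + r)))) ⟨
    (q + p * q + r) + ((q + r) C 2 + suc (p + r) C 2) ∎
    where
    open ≡-Reasoning
    e = r C 2 + r C 1

  -- Since d = p + q + r - 2, the hypothesis says (p - 2)(q - 2) ≥ r + 1. The assumption d ≥ 2
  -- excludes p ≤ 1 and q ≤ 1, and the value 2 makes the product vanish. For p = 3 + x and q = 3 + y
  -- it becomes (1 + x)(1 + y) ≥ r + 1.
  many-vertices : ∀ p q r {d} → p + q + r ≡ 2 + d → 2 ≤ d → 2 * d + 1 ≤ p * q + r →
                  ∃[ x ] ∃[ y ] p ≡ 3 + x × q ≡ 3 + y × r ≤ x + y + x * y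
  many-vertices p q r {d} sum≡ 2≤d le = cases p q sum≡ le
    where
    zero-case : ¬ 2 * d + 1 ≤ 2 + d
    zero-case le = <-irrefl refl (begin-strict
      d + d  <⟨ +-cancelʳ-≤ 1 (suc (d + d)) (d + 2) (≤-trans (≤-reflexive (solve 1 (λ d → (con 1 :+ (d :+ d)) :+ con 1 := con 1 :+ (con 2 :* d :+ con 1)) refl d)) (≤-trans (s≤s le) (≤-reflexive (solve 1 (λ d → con 3 :+ d := (d :+ con 2) :+ con 1) refl d)))) ⟩
      d + 2  ≤⟨ +-monoʳ-≤ d 2≤d ⟩
      d + d ∎)
      where open ≤-Reasoning
    two-case : ∀ s → s + r ≡ d → ¬ 2 * d + 1 ≤ s + s + r
    two-case s refl le = <-irrefl refl (begin-strict
      s + s + r  ≤⟨ m≤m+n (s + s + r) r ⟩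
      s + s + r + r  ≡⟨ solve 2 (λ s r → s :+ s :+ r :+ r := con 2 :* (s :+ r)) refl s r ⟩
      2 * (s + r)  <⟨ ≤-reflexive (+-comm 1 (2 * (s + r))) ⟩
      2 * (s + r) + 1  ≤⟨ le ⟩
      s + s + r ∎)
      where open ≤-Reasoning
    cases : ∀ p q → p + q + r ≡ 2 + d → 2 * d + 1 ≤ p * q + r →
            ∃[ x ] ∃[ y ] p ≡ 3 + x × q ≡ 3 + y × r ≤ x + y + x * y
    cases 0 q sum≡ le = contradiction (≤-trans le (≤-trans (m≤n+m r q) (≤-reflexive sum≡))) zero-case
    cases 1 q sum≡ le = contradiction (≤-trans le (≤-trans (≤-reflexive (cong (_+ r) (+-identityʳ q))) (≤-trans (n≤1+n _) (≤-reflexive sum≡)))) zero-case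
    cases 2 q sum≡ le = contradiction (subst (λ z → 2 * d + 1 ≤ q + z + r) (+-identityʳ q) le) (two-case q (suc-injective (suc-injective sum≡)))
    cases p@(suc (suc (suc _))) 0 sum≡ le = contradiction (≤-trans (subst (λ z → 2 * d + 1 ≤ z + r) (*-zeroʳ p) le) (≤-trans (m≤n+m r (p + 0)) (≤-reflexive sum≡))) zero-case
    cases p@(suc (suc (suc _))) 1 sum≡ le = contradiction (≤-trans (subst (λ z → 2 * d + 1 ≤ z + r) (*-identityʳ p) le)
      (≤-trans (+-monoˡ-≤ r (m≤m+n p 1)) (≤-reflexive sum≡))) zero-case
    cases p@(suc (suc (suc _))) 2 sum≡ le = contradiction (subst (λ z → 2 * d + 1 ≤ z + r) (solve 1 (λ p → p :* con 2 := p :+ p) refl p) le)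
      (two-case p (+-cancelˡ-≡ 2 _ _ (trans (solve 2 (λ p r → con 2 :+ (p :+ r) := p :+ con 2 :+ r) refl p r) sum≡)))
    cases (suc (suc (suc x))) (suc (suc (suc y))) sum≡ le = x , y , refl , refl , +-cancelˡ-≤ (9 + x + x + y + y + r) _ _ (begin
        9 + x + x + y + y + r + r  ≡⟨ solve 3 (λ x y r → con 9 :+ x :+ x :+ y :+ y :+ r :+ r := con 2 :* (con 4 :+ x :+ y :+ r) :+ con 1) refl x y r ⟩
        2 * (4 + x + y + r) + 1  ≡⟨ cong (λ d → 2 * d + 1) d≡ ⟩
        2 * d + 1  ≤⟨ le ⟩
        (3 + x) * (3 + y) + r  ≡⟨ solve 3 (λ x y r → (con 3 :+ x) :* (con 3 :+ y) :+ r := con 9 :+ x :+ x :+ y :+ y :+ r :+ (x :+ y :+ x :* y)) refl x y r ⟩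
        9 + x + x + y + y + r + (x + y + x * y)  ∎)
      where
      open ≤-Reasoning
      d≡ : 4 + x + y + r ≡ d
      d≡ = +-cancelˡ-≡ 2 _ _ (trans (solve 3 (λ x y r → con 2 :+ (con 4 :+ x :+ y :+ r) := (con 3 :+ x) :+ (con 3 :+ y) :+ r) refl x y r) sum≡)

  d≤2⌈d/2⌉ : ∀ d → d ≤ ⌈ d /2⌉ + ⌈ d /2⌉
  d≤2⌈d/2⌉ d = ≤-trans (≤-reflexive (sym (⌊n/2⌋+⌈n/2⌉≡n d))) (+-monoˡ-≤ ⌈ d /2⌉ (⌊n/2⌋≤⌈n/2⌉ d))

  top-rows : ∀ d′ k → suc (suc (suc d′)) C suc k ≡ suc (suc d′) C k + suc d′ C k + d′ C k + d′ C suc k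
  top-rows d′ k = begin
    (3 + d′) C suc k  ≡⟨ pascal (2 + d′) k ⟩
    a + (2 + d′) C suc k  ≡⟨ cong (a +_) (pascal (1 + d′) k) ⟩
    a + (b + (1 + d′) C suc k)  ≡⟨ cong (λ z → a + (b + z)) (pascal d′ k) ⟩
    a + (b + (d′ C k + d′ C suc k))  ≡⟨ solve 4 (λ a b c e → a :+ (b :+ (c :+ e)) := a :+ b :+ c :+ e) refl a b (d′ C k) (d′ C suc k) ⟩
    a + b + d′ C k + d′ C suc k ∎
    where
    open ≡-Reasoning
    a = (2 + d′) C k
    b = (1 + d′) C k

  bound-rows : ∀ d′ m {X} → (2 + d′) C (1 + m) + (1 + d′) C (1 + m) + d′ C (1 + m) ≡ X →
               bound (suc d′) m ≡ X ∸ ⌈ suc d′ /2⌉ C (1 + m) ∸ (⌈ suc d′ /2⌉ ∸ 1) C (1 + m)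
  bound-rows d′ m refl rewrite +-comm d′ 1 | +-comm m 1 = refl

  -- By Pascal's rule f is a sum of values c n = n C (2 + m); the three largest n give the positive terms X of the bound.
  module _ (x y r m : ℕ) where

    private
      c : ℕ → ℕ
      c n = n C (2 + m)
      d = 4 + x + y + r
      X = c (5 + x + y + r) + c (4 + x + y + r) + c (3 + x + y + r)
      Σ₁ = ∑< x c (3 + r)
      Σ₂ = ∑< x c (y + (3 + r))

    module _ {f} (eq : f + ((3 + y + r) C (3 + m) + (3 + x + r) C (3 + m)) ≡ (6 + x + y + r) C (3 + m) + (r C (3 + m) + r C (2 + m))) where

      -- The face equation lives mostly in column m + 3. Telescoping its binomials down to the
      -- common remainders `Q` and `e`, which cancel, leaves an equation in column m + 2, that of
      -- the bound.
      row-balance : f + (c (1 + r) + c (2 + r) + Σ₁) ≡ X + Σ₂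
      row-balance = +-cancelʳ-≡ (Q + e) _ _ (begin
        f + (c (1 + r) + c (2 + r) + Σ₁) + (Q + e)  ≡⟨ solve 6 (λ f a b s q e → f :+ (a :+ b :+ s) :+ (q :+ e) := f :+ (q :+ (s :+ (b :+ (a :+ e))))) refl f (c (1 + r)) (c (2 + r)) Σ₁ Q e ⟩
        f + (Q + (Σ₁ + (c (2 + r) + (c (1 + r) + e))))  ≡⟨ cong (λ z → f + (Q + z)) lower ⟨
        f + (Q + (3 + x + r) C (3 + m))  ≡⟨ eq ⟩
        (6 + x + y + r) C (3 + m) + e  ≡⟨ cong (_+ e) (top-rows (3 + x + y + r) (2 + m)) ⟩
        X + (3 + x + y + r) C (3 + m) + e  ≡⟨ cong (λ z → X + z + e) upper ⟩
        X + (Σ₂ + Q) + e  ≡⟨ solve 4 (λ x s q e → x :+ (s :+ q) :+ e := x :+ s :+ (q :+ e)) refl X Σ₂ Q e ⟩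
        X + Σ₂ + (Q + e) ∎)
        where
        open ≡-Reasoning
        Q = (3 + y + r) C (3 + m)
        e = r C (3 + m) + r C (2 + m)
        upper : (3 + x + y + r) C (3 + m) ≡ Σ₂ + Q
        upper = trans (cong (_C (3 + m)) (solve 3 (λ x y r → con 3 :+ x :+ y :+ r := x :+ (con 3 :+ y :+ r)) refl x y r))
                (trans (C-telescope x (3 + y + r) (2 + m))
                       (cong (λ n → ∑< x c n + Q) (solve 2 (λ y r → con 3 :+ y :+ r := y :+ (con 3 :+ r)) refl y r)))
        lower : (3 + x + r) C (3 + m) ≡ Σ₁ + (c (2 + r) + (c (1 + r) + e))
        lower = trans (cong (_C (3 + m)) (solve 2 (λ x r → con 3 :+ x :+ r := x :+ (con 3 :+ r)) refl x r))
                (trans (C-telescope x (3 + r) (2 + m)) (cong (Σ₁ +_)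
                (trans (pascal (2 + r) (2 + m)) (cong (c (2 + r) +_)
                (trans (pascal (1 + r) (2 + m)) (cong (c (1 + r) +_)
                (trans (pascal r (2 + m)) (+-comm (r C (2 + m)) _))))))))

      bound-≤-core : r ≤ x + y + x * y → bound d (suc m) ≤ f
      bound-≤-core r≤ = begin
        bound d (suc m)  ≡⟨ bound-rows (3 + x + y + r) (suc m) refl ⟩
        X ∸ c h ∸ c h′  ≤⟨ m≤n+o⇒m∸n≤o (X ∸ c h) (c h′) (m≤n+o⇒m∸n≤o X (c h) X≤) ⟩
        f ∎
        where
        open ≤-Reasoning
        -- By computation `suc h′` is ⌈d/2⌉, because d = 2 + (2 + x + y + r).
        h′ = ⌈ 2 + x + y + r /2⌉
        h = suc h′
        X≤ : X ≤ c h + (c h′ + f)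
        X≤ = +-cancelʳ-≤ Σ₂ _ _ (begin
          X + Σ₂  ≡⟨ row-balance ⟨
          f + (c (1 + r) + c (2 + r) + Σ₁)  ≤⟨ +-monoʳ-≤ f (shifted-sum m x y r h′ (d≤2⌈d/2⌉ d) r≤) ⟩
          f + (Σ₂ + (c h + c h′))  ≡⟨ solve 4 (λ f s a b → f :+ (s :+ (a :+ b)) := a :+ (b :+ f) :+ s) refl f Σ₂ (c h) (c h′) ⟩
          c h + (c h′ + f) + Σ₂ ∎)

  -- The case m = 0 of the face equation identifies f₀ as p q + r, so the hypothesis on vertices
  -- becomes one on p, q and r. After that only the equation at `m` matters.
  bound-≤ : ∀ p q r {d f₀ f} m → 1 ≤ m → p + q + r ≡ 2 + d → 2 ≤ d →
            f₀ + ((q + r) C 2 + (p + r) C 2) ≡ (2 + d) C 2 + (r C 2 + r C 1) → 2 * d + 1 ≤ f₀ →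
            f + ((q + r) C (2 + m) + (p + r) C (2 + m)) ≡ (2 + d) C (2 + m) + (r C (2 + m) + r C (1 + m)) →
            bound d m ≤ f
  bound-≤ p q r {d} {f₀} {f} (suc m) _ sum≡ 2≤d eq₀ 2d+1≤f₀ eq =
    finish (many-vertices p q r sum≡ 2≤d (subst (2 * d + 1 ≤_) f₀≡ 2d+1≤f₀))
    where
    f₀≡ : f₀ ≡ p * q + r
    f₀≡ = +-cancelʳ-≡ _ f₀ (p * q + r) (trans eq₀ (trans (cong (λ z → z C 2 + (r C 2 + r C 1)) (sym sum≡)) (vertex-count p q r)))
    finish : ∃[ x ] ∃[ y ] p ≡ 3 + x × q ≡ 3 + y × r ≤ x + y + x * y → bound d (suc m) ≤ f
    finish (x , y , refl , refl , r≤) = subst (λ d → bound d (suc m) ≤ f) (sym d≡)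
      (bound-≤-core x y r m (trans eq (cong (λ d → (2 + d) C (3 + m) + (r C (3 + m) + r C (2 + m))) d≡)) r≤)
      where
      d≡ : d ≡ 4 + x + y + r
      d≡ = sym (+-cancelˡ-≡ 2 _ _ (trans (solve 3 (λ x y r → con 2 :+ (con 4 :+ x :+ y :+ r) := (con 3 :+ x) :+ (con 3 :+ y) :+ r) refl x y r) sum≡))

  module Sharp (u : ℕ) where

    d = 4 + u + u

    FaceEquation : ℕ → ℕ → Set
    FaceEquation m f = f + ((3 + u + u) C (2 + m) + (3 + u) C (2 + m)) ≡ (6 + u + u) C (2 + m) + (u C (2 + m) + u C (1 + m))

    -- Here x = 0 and y = r = u. Both windows are empty, so `row-balance` is the formula itself, and
    -- 2 + u is ⌈d/2⌉.
    sharp-bound : ∀ m {f} → 1 ≤ m → FaceEquation m f → f ≡ bound d m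
    sharp-bound (suc m) {f} _ eq = begin
      f  ≡⟨ m+n∸n≡m f (c (1 + u)) ⟨
      f + c (1 + u) ∸ c (1 + u)  ≡⟨ cong (_∸ c (1 + u)) (m+n∸n≡m (f + c (1 + u)) (c (2 + u))) ⟨
      f + c (1 + u) + c (2 + u) ∸ c (2 + u) ∸ c (1 + u)  ≡⟨ cong (λ z → z ∸ c (2 + u) ∸ c (1 + u)) X≡ ⟩
      X ∸ c (2 + u) ∸ c (1 + u)  ≡⟨ cong (λ h → X ∸ c (2 + h) ∸ c (1 + h)) (n≡⌈n+n/2⌉ u) ⟩
      X ∸ c (2 + ⌈ u + u /2⌉) ∸ c (1 + ⌈ u + u /2⌉)  ≡⟨ bound-rows (3 + u + u) (suc m) refl ⟨
      bound d (suc m) ∎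
      where
      open ≡-Reasoning
      c : ℕ → ℕ
      c n = n C (2 + m)
      X = c (5 + u + u) + c (4 + u + u) + c (3 + u + u)
      X≡ : f + c (1 + u) + c (2 + u) ≡ X
      X≡ = trans (solve 3 (λ f a b → f :+ a :+ b := f :+ (a :+ b :+ con 0)) refl f (c (1 + u)) (c (2 + u)))
             (trans (row-balance 0 u u m {f} eq) (+-identityʳ X))

    sharp-vertices : ∀ {f} → FaceEquation 0 f → f ≡ 2 * d + 1
    sharp-vertices {f} eq = begin
      f  ≡⟨ +-cancelʳ-≡ _ f (3 * (3 + u) + u) (trans eq (vertex-count 3 (3 + u) u)) ⟩
      3 * (3 + u) + u  ≡⟨ solve 1 (λ u → con 3 :* (con 3 :+ u) :+ u := con 2 :* (con 4 :+ u :+ u) :+ con 1) refl u ⟩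
      2 * d + 1 ∎
      where open ≡-Reasoning

    -- At m = d - 1 the lower indices d + 1 and d exceed the upper indices they are paired with,
    -- except in C(d + 2, d + 1), which remains.
    sharp-facets : ∀ {f} → FaceEquation (d ∸ 1) f → f ≡ d + 2
    sharp-facets {f} eq = begin
      f  ≡⟨ +-identityʳ f ⟨
      f + 0  ≡⟨ cong (f +_) (cong₂ _+_ (k>n⇒nCk≡0 {3 + u + u} {5 + u + u} (n≤1+n (4 + u + u))) (k>n⇒nCk≡0 {3 + u} {5 + u + u} (+-monoʳ-≤ 4 (m≤n⇒m≤1+n (m≤m+n u u))))) ⟨
      f + ((3 + u + u) C (2 + (3 + u + u)) + (3 + u) C (2 + (3 + u + u)))  ≡⟨ eq ⟩
      (6 + u + u) C (5 + u + u) + (u C (5 + u + u) + u C (4 + u + u))  ≡⟨ cong ((6 + u + u) C (5 + u + u) +_) (cong₂ _+_ (k>n⇒nCk≡0 {u} {5 + u + u} (s≤s (≤-trans (m≤m+n u u) (m≤n+m (u + u) 4)))) (k>n⇒nCk≡0 {u} {4 + u + u} (s≤s (≤-trans (m≤m+n u u) (m≤n+m (u + u) 3))))) ⟩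
      (6 + u + u) C (5 + u + u) + 0  ≡⟨ +-identityʳ _ ⟩
      (6 + u + u) C (5 + u + u)  ≡⟨ nCk≡nC[n∸k] (n≤1+n (5 + u + u)) ⟩
      (6 + u + u) C (6 + u + u ∸ (5 + u + u))  ≡⟨ cong ((6 + u + u) C_) (m+n∸n≡m 1 (5 + u + u)) ⟩
      (6 + u + u) C 1  ≡⟨ nC1≡n (6 + u + u) ⟩
      6 + u + u  ≡⟨ +-comm 2 d ⟩
      d + 2 ∎
      where open ≡-Reasoning

open Binomials

-- Ordered fields and affine geometry

open import Data.Vec.Functional using (Vector; _∷_; [])

module OrderedFieldProperties {c ℓ₁ ℓ₂ : Level} (F : OrderedField c ℓ₁ ℓ₂) where

  open import Data.Integer.Base as ℤ using (ℤ; +_; -[1+_])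
  import Data.Integer.Properties as ℤ
  open import Data.Maybe.Base using (Maybe; just; nothing)
  open import Data.Sign.Base as Sign using (Sign)
  open OrderedField F hiding (zero)
  open RingProperties ring public
    using (-‿distribˡ-*; -‿distribʳ-*; -‿involutive; -‿+-comm)
    renaming (-0#≈0# to -0≈0)
  open IsStrictTotalOrder isStrictTotalOrder public
    using (compare; _≟_; _<?_; irrefl; <-respʳ-≈; <-respˡ-≈)
    renaming (trans to <-trans)
  open SemiringSum semiring public
    using (sum; sum-cong-≋; ∑-distrib-+; ∑-comm; sum-replicate-zero; *-distribˡ-sum; *-distribʳ-sum; sum-remove)
  open SetoidReasoning setoid

  private
    open Mult semiring using (1+×; ×-homo-+; ×1-homo-*) renaming (_×_ to _×ₙ_)

    -- Integers serve as coefficients of the ring solver: their equality test computes, so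
    -- cancellations such as 1 - 1 = 0 happen during normalisation, where the decision `_≟_` of an
    -- abstract field would be stuck.
    ⟦_⟧ : ℤ → Carrier
    ⟦ + n ⟧      = n ×ₙ 1#
    ⟦ -[1+ n ] ⟧ = - (suc n ×ₙ 1#)

    ⊖-homo : ∀ m n → ⟦ m ℤ.⊖ n ⟧ ≈ m ×ₙ 1# - n ×ₙ 1#
    ⊖-homo zero    zero    = sym (-‿inverseʳ 0#)
    ⊖-homo zero    (suc n) = sym (+-identityˡ _)
    ⊖-homo (suc m) zero    = sym (trans (+-congˡ -0≈0) (+-identityʳ _))
    ⊖-homo (suc m) (suc n) = begin
      ⟦ suc m ℤ.⊖ suc n ⟧  ≡⟨ ≡.cong ⟦_⟧ (ℤ.[1+m]⊖[1+n]≡m⊖n m n) ⟩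
      ⟦ m ℤ.⊖ n ⟧  ≈⟨ ⊖-homo m n ⟩
      a - b  ≈⟨ +-identityˡ _ ⟨
      0# + (a - b)  ≈⟨ +-congʳ (-‿inverseʳ 1#) ⟨
      (1# - 1#) + (a - b)  ≈⟨ +-assoc _ _ _ ⟩
      1# + (- 1# + (a - b))  ≈⟨ +-congˡ (+-assoc _ _ _) ⟨
      1# + ((- 1# + a) - b)  ≈⟨ +-congˡ (+-congʳ (+-comm _ _)) ⟩
      1# + ((a - 1#) - b)  ≈⟨ +-congˡ (+-assoc _ _ _) ⟩
      1# + (a + (- 1# - b))  ≈⟨ +-assoc _ _ _ ⟨
      (1# + a) + (- 1# - b)  ≈⟨ +-congˡ (-‿+-comm 1# b) ⟩
      (1# + a) - (1# + b)  ≈⟨ +-cong (1+× m 1#) (-‿cong (1+× n 1#)) ⟨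
      suc m ×ₙ 1# - suc n ×ₙ 1# ∎
      where
      a = m ×ₙ 1#
      b = n ×ₙ 1#

    ◃-homo : ∀ n → ⟦ Sign.- ℤ.◃ n ⟧ ≈ - (n ×ₙ 1#)
    ◃-homo zero    = sym -0≈0
    ◃-homo (suc n) = refl

    +-homo : ∀ i j → ⟦ i ℤ.+ j ⟧ ≈ ⟦ i ⟧ + ⟦ j ⟧
    +-homo (+ m)    (+ n)    = ×-homo-+ 1# m n
    +-homo (+ m)    -[1+ n ] = ⊖-homo m (suc n)
    +-homo -[1+ m ] (+ n)    = trans (⊖-homo n (suc m)) (+-comm _ _)
    +-homo -[1+ m ] -[1+ n ] = begin
      - (suc (suc (m ℕ.+ n)) ×ₙ 1#)  ≡⟨ ≡.cong (λ k → - (k ×ₙ 1#)) (≡.sym (ℕP.+-suc (suc m) n)) ⟩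
      - ((suc m ℕ.+ suc n) ×ₙ 1#)  ≈⟨ -‿cong (×-homo-+ 1# (suc m) (suc n)) ⟩
      - (suc m ×ₙ 1# + suc n ×ₙ 1#)  ≈⟨ -‿+-comm _ _ ⟨
      - (suc m ×ₙ 1#) - (suc n ×ₙ 1#) ∎
      where import Data.Nat.Properties as ℕP

    *-homo : ∀ i j → ⟦ i ℤ.* j ⟧ ≈ ⟦ i ⟧ * ⟦ j ⟧
    *-homo (+ m)    (+ n)    =
      trans (reflexive (≡.cong ⟦_⟧ (ℤ.+◃n≡+n (m ℕ.* n)))) (×1-homo-* m n)
    *-homo (+ m)    -[1+ n ] = begin
      ⟦ Sign.- ℤ.◃ m ℕ.* suc n ⟧  ≈⟨ ◃-homo (m ℕ.* suc n) ⟩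
      - ((m ℕ.* suc n) ×ₙ 1#)  ≈⟨ -‿cong (×1-homo-* m (suc n)) ⟩
      - (m ×ₙ 1# * suc n ×ₙ 1#)  ≈⟨ -‿distribʳ-* _ _ ⟩
      m ×ₙ 1# * - (suc n ×ₙ 1#) ∎
    *-homo -[1+ m ] (+ n)    = begin
      ⟦ Sign.- ℤ.◃ suc m ℕ.* n ⟧  ≈⟨ ◃-homo (suc m ℕ.* n) ⟩
      - ((suc m ℕ.* n) ×ₙ 1#)  ≈⟨ -‿cong (×1-homo-* (suc m) n) ⟩
      - (suc m ×ₙ 1# * n ×ₙ 1#)  ≈⟨ -‿distribˡ-* _ _ ⟩
      - (suc m ×ₙ 1#) * n ×ₙ 1# ∎
    *-homo -[1+ m ] -[1+ n ] = begin
      (suc m ℕ.* suc n) ×ₙ 1#  ≈⟨ ×1-homo-* (suc m) (suc n) ⟩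
      a * b  ≈⟨ -‿involutive _ ⟨
      - - (a * b)  ≈⟨ -‿cong (-‿distribʳ-* a b) ⟩
      - (a * - b)  ≈⟨ -‿distribˡ-* a (- b) ⟩
      - a * - b ∎
      where
      a = suc m ×ₙ 1#
      b = suc n ×ₙ 1#

    neg-homo : ∀ i → ⟦ ℤ.- i ⟧ ≈ - ⟦ i ⟧
    neg-homo (+ zero)   = sym -0≈0
    neg-homo (+ suc n)  = refl
    neg-homo -[1+ n ]   = sym (-‿involutive _)

    acr : ACR.AlmostCommutativeRing c ℓ₁
    acr = ACR.fromCommutativeRing commutativeRing

    morphism : ℤ.+-*-rawRing ACR.-Raw-AlmostCommutative⟶ acr
    morphism = record
      { ⟦_⟧    = ⟦_⟧
      ; +-homo = +-homo
      ; *-homo = *-homo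
      ; -‿homo = neg-homo
      ; 0-homo = refl
      ; 1-homo = refl
      }

    coeff≟ : ∀ i j → Maybe (⟦ i ⟧ ≈ ⟦ j ⟧)
    coeff≟ i j with i ℤ.≟ j
    ... | yes i≡j = just (reflexive (≡.cong ⟦_⟧ i≡j))
    ... | no  _   = nothing

  open RingSolver ℤ.+-*-rawRing acr morphism coeff≟ public
    using (solve; con; Polynomial; _:=_; _:+_; _:*_; :-_; _:-_)

  0′ 1′ : ∀ {n} → Polynomial n
  0′ = con (+ 0)
  1′ = con (+ 1)

  ≤-respʳ : ∀ {x y z} → y ≈ z → x ≤ y → x ≤ z
  ≤-respʳ y≈z (inj₁ x<y) = inj₁ (<-respʳ-≈ y≈z x<y)
  ≤-respʳ y≈z (inj₂ x≈y) = inj₂ (trans x≈y y≈z)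

  ≤-respˡ : ∀ {x y z} → x ≈ y → x ≤ z → y ≤ z
  ≤-respˡ x≈y (inj₁ x<z) = inj₁ (<-respˡ-≈ x≈y x<z)
  ≤-respˡ x≈y (inj₂ x≈z) = inj₂ (trans (sym x≈y) x≈z)

  ≤-refl : ∀ {x} → x ≤ x
  ≤-refl = inj₂ refl

  ≤-trans : ∀ {x y z} → x ≤ y → y ≤ z → x ≤ z
  ≤-trans (inj₁ x<y) (inj₁ y<z) = inj₁ (<-trans x<y y<z)
  ≤-trans (inj₁ x<y) (inj₂ y≈z) = inj₁ (<-respʳ-≈ y≈z x<y)
  ≤-trans (inj₂ x≈y) y≤z        = ≤-respˡ (sym x≈y) y≤z

  ≤-<-trans : ∀ {x y z} → x ≤ y → y < z → x < z
  ≤-<-trans (inj₁ x<y) y<z = <-trans x<y y<z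
  ≤-<-trans (inj₂ x≈y) y<z = <-respˡ-≈ (sym x≈y) y<z

  ≤-total : ∀ x y → x ≤ y ⊎ y ≤ x
  ≤-total x y with compare x y
  ... | tri< x<y _ _ = inj₁ (inj₁ x<y)
  ... | tri≈ _ x≈y _ = inj₁ (inj₂ x≈y)
  ... | tri> _ _ y<x = inj₂ (inj₁ y<x)

  <⇒≉ : ∀ {x y} → x < y → ¬ x ≈ y
  <⇒≉ x<y x≈y = irrefl x≈y x<y

  <⇒≱ : ∀ {x y} → x < y → ¬ y ≤ x
  <⇒≱ x<y y≤x = irrefl refl (≤-<-trans y≤x x<y)

  ≮⇒≥ : ∀ {x y} → ¬ x < y → y ≤ x
  ≮⇒≥ {x} {y} x≮y with compare x y
  ... | tri< x<y _ _ = contradiction x<y x≮y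
  ... | tri≈ _ x≈y _ = inj₂ (sym x≈y)
  ... | tri> _ _ y<x = inj₁ y<x

  ≤∧≉⇒< : ∀ {x y} → x ≤ y → ¬ x ≈ y → x < y
  ≤∧≉⇒< (inj₁ x<y) _   = x<y
  ≤∧≉⇒< (inj₂ x≈y) x≉y = contradiction x≈y x≉y

  nonneg-split : ∀ {x} → 0# ≤ x → ¬ x ≈ 0# → 0# < x
  nonneg-split 0≤x x≉0 = ≤∧≉⇒< 0≤x (x≉0 ∘ sym)

  x<y⇒0<y-x : ∀ {x y} → x < y → 0# < y - x
  x<y⇒0<y-x {x} x<y = <-respˡ-≈ (-‿inverseʳ x) (+-monoˡ-< (- x) x<y)

  0<y-x⇒x<y : ∀ {x y} → 0# < y - x → x < y
  0<y-x⇒x<y {x} {y} 0<y-x =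
    <-respˡ-≈ (+-identityˡ x)
      (<-respʳ-≈ (solve 2 (λ x y → (y :- x) :+ x := y) refl x y) (+-monoˡ-< x 0<y-x))

  x≤y⇒0≤y-x : ∀ {x y} → x ≤ y → 0# ≤ y - x
  x≤y⇒0≤y-x         (inj₁ x<y) = inj₁ (x<y⇒0<y-x x<y)
  x≤y⇒0≤y-x {x} {y} (inj₂ x≈y) = inj₂ (sym (trans (+-congˡ (-‿cong x≈y)) (-‿inverseʳ y)))

  x-y≈0⇒x≈y : ∀ {x y} → x - y ≈ 0# → x ≈ y
  x-y≈0⇒x≈y {x} {y} eq = begin
    x  ≈⟨ solve 2 (λ x y → x := (x :- y) :+ y) refl x y ⟩
    (x - y) + y  ≈⟨ +-congʳ eq ⟩
    0# + y  ≈⟨ +-identityˡ y ⟩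
    y ∎

  0≤y-x⇒x≤y : ∀ {x y} → 0# ≤ y - x → x ≤ y
  0≤y-x⇒x≤y (inj₁ 0<y-x) = inj₁ (0<y-x⇒x<y 0<y-x)
  0≤y-x⇒x≤y (inj₂ 0≈y-x) = inj₂ (sym (x-y≈0⇒x≈y (sym 0≈y-x)))

  neg-pos : ∀ {x} → x < 0# → 0# < - x
  neg-pos x<0 = <-respʳ-≈ (+-identityˡ _) (x<y⇒0<y-x x<0)

  pos-neg : ∀ {x} → 0# < x → - x < 0#
  pos-neg {x} 0<x = 0<y-x⇒x<y (<-respʳ-≈ (solve 1 (λ x → x := 0′ :- (:- x)) refl x) 0<x)

  neg-nonneg : ∀ {x} → x ≤ 0# → 0# ≤ - x
  neg-nonneg x≤0 = ≤-respʳ (+-identityˡ _) (x≤y⇒0≤y-x x≤0)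

  +-pos-nonneg : ∀ {x y} → 0# < x → 0# ≤ y → 0# < x + y
  +-pos-nonneg {x} {y} 0<x 0≤y =
    ≤-<-trans 0≤y (<-respˡ-≈ (+-identityˡ y) (+-monoˡ-< y 0<x))

  +-nonneg-pos : ∀ {x y} → 0# ≤ x → 0# < y → 0# < x + y
  +-nonneg-pos 0≤x 0<y = <-respʳ-≈ (+-comm _ _) (+-pos-nonneg 0<y 0≤x)

  +-nonneg : ∀ {x y} → 0# ≤ x → 0# ≤ y → 0# ≤ x + y
  +-nonneg (inj₁ 0<x) 0≤y = inj₁ (+-pos-nonneg 0<x 0≤y)
  +-nonneg (inj₂ 0≈x) 0≤y = ≤-respʳ (trans (sym (+-identityˡ _)) (+-congʳ 0≈x)) 0≤y

  *-nonneg : ∀ {x y} → 0# ≤ x → 0# ≤ y → 0# ≤ x * y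
  *-nonneg         (inj₁ 0<x) (inj₁ 0<y) = inj₁ (*-pos 0<x 0<y)
  *-nonneg {x}     (inj₁ _)   (inj₂ 0≈y) = inj₂ (trans (sym (zeroʳ x)) (*-congˡ 0≈y))
  *-nonneg {y = y} (inj₂ 0≈x) _          = inj₂ (trans (sym (zeroˡ y)) (*-congʳ 0≈x))

  neg*neg-pos : ∀ {x y} → x < 0# → y < 0# → 0# < x * y
  neg*neg-pos {x} {y} x<0 y<0 =
    <-respʳ-≈ (solve 2 (λ x y → (:- x) :* (:- y) := x :* y) refl x y)
      (*-pos (neg-pos x<0) (neg-pos y<0))

  pos*neg-neg : ∀ {x y} → 0# < x → y < 0# → x * y < 0#
  pos*neg-neg {x} {y} 0<x y<0 =
    <-respˡ-≈ (solve 2 (λ x y → :- (x :* (:- y)) := x :* y) refl x y)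
      (pos-neg (*-pos 0<x (neg-pos y<0)))

  0<1 : 0# < 1#
  0<1 with compare 0# 1#
  ... | tri< 0<1 _ _ = 0<1
  ... | tri≈ _ 0≈1 _ = contradiction 0≈1 0≉1
  ... | tri> _ _ 1<0 = <-respʳ-≈ (*-identityˡ 1#) (neg*neg-pos 1<0 1<0)

  x*y≈0⇒y≈0 : ∀ {x y} → ¬ x ≈ 0# → x * y ≈ 0# → y ≈ 0#
  x*y≈0⇒y≈0 {x} {y} x≉0 xy≈0 with inverse x x≉0
  ... | z , xz≈1 = begin
    y  ≈⟨ *-identityˡ y ⟨
    1# * y  ≈⟨ *-congʳ xz≈1 ⟨
    (x * z) * y  ≈⟨ solve 3 (λ x y z → (x :* z) :* y := z :* (x :* y)) refl x y z ⟩
    z * (x * y)  ≈⟨ *-congˡ xy≈0 ⟩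
    z * 0#  ≈⟨ zeroʳ z ⟩
    0# ∎

  x≈0⇒x*y≈0 : ∀ {x y} → x ≈ 0# → x * y ≈ 0#
  x≈0⇒x*y≈0 x≈0 = trans (*-congʳ x≈0) (zeroˡ _)

  y≈0⇒x*y≈0 : ∀ {x y} → y ≈ 0# → x * y ≈ 0#
  y≈0⇒x*y≈0 y≈0 = trans (*-congˡ y≈0) (zeroʳ _)

  +-zero : ∀ {x y} → x ≈ 0# → y ≈ 0# → x + y ≈ 0#
  +-zero x≈0 y≈0 = trans (+-cong x≈0 y≈0) (+-identityˡ 0#)

  neg-zero : ∀ {x} → x ≈ 0# → - x ≈ 0#
  neg-zero x≈0 = trans (-‿cong x≈0) -0≈0

  -- inv 0 = 0
  inv : Carrier → Carrier
  inv x with x ≟ 0#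
  ... | yes _  = 0#
  ... | no x≉0 = proj₁ (inverse x x≉0)

  inv-inverse : ∀ {x} → ¬ x ≈ 0# → x * inv x ≈ 1#
  inv-inverse {x} x≉0 with x ≟ 0#
  ... | yes x≈0 = contradiction x≈0 x≉0
  ... | no x≉0′ = proj₂ (inverse x x≉0′)

  inv-pos : ∀ {x} → 0# < x → 0# < inv x
  inv-pos {x} 0<x with compare 0# (inv x)
  ... | tri< 0<y _ _ = 0<y
  ... | tri≈ _ 0≈y _ = contradiction (begin
    0#  ≈⟨ zeroʳ x ⟨
    x * 0#  ≈⟨ *-congˡ 0≈y ⟩
    x * inv x  ≈⟨ inv-inverse (<⇒≉ 0<x ∘ sym) ⟩
    1# ∎) 0≉1
  ... | tri> _ _ y<0 = contradiction
    (<-trans (<-respˡ-≈ (inv-inverse (<⇒≉ 0<x ∘ sym)) (pos*neg-neg 0<x y<0)) 0<1) (irrefl refl)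

  ∑-zero : ∀ {n} {t : Vector Carrier n} → (∀ i → t i ≈ 0#) → sum t ≈ 0#
  ∑-zero {n} t≈0 = trans (sum-cong-≋ t≈0) (sum-replicate-zero n)

  ∑-nonneg : ∀ {n} {t : Vector Carrier n} → (∀ i → 0# ≤ t i) → 0# ≤ sum t
  ∑-nonneg {zero}  _   = ≤-refl
  ∑-nonneg {suc n} 0≤t = +-nonneg (0≤t zero) (∑-nonneg (0≤t ∘ suc))

  ∑-pos : ∀ {n} {t : Vector Carrier n} → (∀ i → 0# ≤ t i) → ∀ i → 0# < t i → 0# < sum t
  ∑-pos {suc n} 0≤t zero    0<tᵢ = +-pos-nonneg 0<tᵢ (∑-nonneg (0≤t ∘ suc))
  ∑-pos {suc n} 0≤t (suc i) 0<tᵢ = +-nonneg-pos (0≤t zero) (∑-pos (0≤t ∘ suc) i 0<tᵢ)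

  ∑-nonneg-zero : ∀ {n} {t : Vector Carrier n} → (∀ i → 0# ≤ t i) → sum t ≈ 0# → ∀ i → t i ≈ 0#
  ∑-nonneg-zero {t = t} 0≤t ∑≈0 i with t i ≟ 0#
  ... | yes tᵢ≈0 = tᵢ≈0
  ... | no  tᵢ≉0 = contradiction (sym ∑≈0) (<⇒≉ (∑-pos 0≤t i (nonneg-split (0≤t i) tᵢ≉0)))

  ∑-neg : ∀ {n} (t : Vector Carrier n) → sum (λ i → - t i) ≈ - sum t
  ∑-neg {zero}  t = sym -0≈0
  ∑-neg {suc n} t = trans (+-congˡ (∑-neg (t ∘ suc))) (-‿+-comm _ _)

  ∑-balance : ∀ {n} {t : Vector Carrier n} → sum t ≈ 0# → ∀ i → 0# < t i → ∃[ j ] t j < 0#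
  ∑-balance {t = t} ∑≈0 i 0<tᵢ with Fin.any? (λ j → t j <? 0#)
  ... | yes tⱼ<0 = tⱼ<0
  ... | no  ∄<0  = contradiction (sym ∑≈0) (<⇒≉ (∑-pos (λ j → ≮⇒≥ (λ tⱼ<0 → ∄<0 (j , tⱼ<0))) i 0<tᵢ))

  ∑-single : ∀ {n} (t : Vector Carrier n) i → (∀ j → ¬ j ≡ i → t j ≈ 0#) → sum t ≈ t i
  ∑-single {suc n} t zero    t≈0 = trans (+-congˡ (∑-zero (λ j → t≈0 (suc j) (λ ())))) (+-identityʳ _)
  ∑-single {suc n} t (suc i) t≈0 =
    trans (+-cong (t≈0 zero (λ ())) (∑-single (t ∘ suc) i (λ j j≢i → t≈0 (suc j) (j≢i ∘ Fin.suc-injective))))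
      (+-identityˡ _)

  argmin : ∀ {n p} {P : Pred (Fin n) p} → Decidable P → (f : Fin n → Carrier) → ∃ P →
           ∃[ i ] P i × (∀ j → P j → f i ≤ f j)
  argmin {suc n} {P = P} P? f ∃P with Fin.any? (P? ∘ suc)
  ... | no ∄P = zero , P0 ∃P , λ { zero _ → ≤-refl ; (suc j) Pj → contradiction (j , Pj) ∄P }
    where
    P0 : ∃ P → P zero
    P0 (zero  , Pz) = Pz
    P0 (suc j , Pj) = contradiction (j , Pj) ∄P
  ... | yes ∃P′ with argmin (P? ∘ suc) (f ∘ suc) ∃P′ | P? zero
  ...   | i , Pi , min | no ¬P0 = suc i , Pi , λ { zero P0 → contradiction P0 ¬P0 ; (suc j) → min j }
  ...   | i , Pi , min | yes P0 with ≤-total (f zero) (f (suc i))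
  ...     | inj₁ f0≤fi = zero , P0 , λ { zero _ → ≤-refl ; (suc j) Pj → ≤-trans f0≤fi (min j Pj) }
  ...     | inj₂ fi≤f0 = suc i , Pi , λ { zero _ → fi≤f0 ; (suc j) → min j }

  strict-upper-bound : ∀ {n} (f : Fin n → Carrier) → ∃[ b ] 0# < b × (∀ i → f i < b)
  strict-upper-bound {zero}  f = 1# , 0<1 , λ ()
  strict-upper-bound {suc n} f with strict-upper-bound (f ∘ suc)
  ... | b , 0<b , f<b with f zero <? b
  ...   | yes f0<b = b , 0<b , λ { zero → f0<b ; (suc i) → f<b i }
  ...   | no  f0≮b = f zero + 1# , <-trans 0<b b<f0+1 , λ { zero → f0<f0+1 ; (suc i) → <-trans (f<b i) b<f0+1 }
    where
    f0<f0+1 : f zero < f zero + 1#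
    f0<f0+1 = 0<y-x⇒x<y (<-respʳ-≈ (solve 1 (λ x → 1′ := (x :+ 1′) :- x) refl (f zero)) 0<1)
    b<f0+1 : b < f zero + 1#
    b<f0+1 = ≤-<-trans (≮⇒≥ f0≮b) f0<f0+1

  -- Any `b` above all quotients -hᵢ/uᵢ works. With `u` the slack of a face, this makes an arbitrary
  -- functional `h` positive at the points off the face without altering it on the face.
  dominate : ∀ {n} (u h : Vector Carrier n) → ∃[ b ] 0# < b × (∀ i → 0# < u i → 0# < b * u i + h i)
  dominate u h with strict-upper-bound (λ i → - h i * inv (u i))
  ... | b , 0<b , bound = b , 0<b , λ i 0<uᵢ →
    <-respʳ-≈ (begin
      (b - - h i * inv (u i)) * u i  ≈⟨ solve 4 (λ b h v u → (b :- (:- h) :* v) :* u := b :* u :+ h :* (u :* v)) refl b (h i) (inv (u i)) (u i) ⟩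
      b * u i + h i * (u i * inv (u i))  ≈⟨ +-congˡ (*-congˡ (inv-inverse (<⇒≉ 0<uᵢ ∘ sym))) ⟩
      b * u i + h i * 1#  ≈⟨ +-congˡ (*-identityʳ _) ⟩
      b * u i + h i ∎)
      (*-pos (x<y⇒0<y-x (bound i)) 0<uᵢ)

  cross-multiply : ∀ {a b u v} → 0# < u → 0# < v → a * inv u ≤ b * inv v → 0# ≤ u * b - a * v
  cross-multiply {a} {b} {u} {v} 0<u 0<v le =
    ≤-respʳ (begin
      (b * inv v - a * inv u) * (u * v)  ≈⟨ solve 6 (λ a b u v u′ v′ → (b :* v′ :- a :* u′) :* (u :* v) := u :* b :* (v :* v′) :- a :* v :* (u :* u′)) refl a b u v (inv u) (inv v) ⟩
      u * b * (v * inv v) - a * v * (u * inv u)  ≈⟨ +-cong (*-congˡ (inv-inverse (<⇒≉ 0<v ∘ sym))) (-‿cong (*-congˡ (inv-inverse (<⇒≉ 0<u ∘ sym)))) ⟩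
      u * b * 1# - a * v * 1#  ≈⟨ +-cong (*-identityʳ _) (-‿cong (*-identityʳ _)) ⟩
      u * b - a * v ∎)
      (*-nonneg (x≤y⇒0≤y-x le) (inj₁ (*-pos 0<u 0<v)))

  -- The ratio test of the simplex method. The least quotient sᵢ/fᵢ over positive fᵢ is the largest
  -- multiple of `f` that can be subtracted from `s` with a nonnegative result on `P`; the
  -- denominator `f i` has been cleared, and the difference vanishes at `i`.
  ratio-test : ∀ {n p} {P : Pred (Fin n) p} → Decidable P → (s f : Vector Carrier n) → (∀ i → 0# ≤ s i) →
               ∃[ i ] P i × 0# < f i → ∃[ i ] P i × 0# < f i × (∀ k → P k → 0# ≤ f i * s k - s i * f k)
  ratio-test {P = P} P? s f 0≤s (i₀ , Pi₀ , 0<fi₀)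
    with argmin (λ i → P? i ×-dec (0# <? f i)) (λ i → s i * inv (f i)) (i₀ , Pi₀ , 0<fi₀)
  ... | i , (Pi , 0<fi) , min = i , Pi , 0<fi , nonneg
    where
    nonneg : ∀ k → P k → 0# ≤ f i * s k - s i * f k
    nonneg k Pk with 0# <? f k
    ... | yes 0<fk = cross-multiply 0<fi 0<fk (min k (Pk , 0<fk))
    ... | no  0≮fk = ≤-respʳ (+-congˡ (sym (-‿distribʳ-* _ _)))
      (+-nonneg (*-nonneg (inj₁ 0<fi) (0≤s k)) (*-nonneg (0≤s i) (neg-nonneg (≮⇒≥ 0≮fk))))

-- Linear algebra in homogeneous coordinates

module LinearAlgebra {c ℓ₁ ℓ₂ : Level} (F : OrderedField c ℓ₁ ℓ₂) where

  open OrderedField F hiding (zero)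
  open OrderedFieldProperties F
  open Geometry F
  open SetoidReasoning setoid

  δ : ∀ {n} → Fin n → Fin n → Carrier
  δ i j with i Fin.≟ j
  ... | yes _ = 1#
  ... | no  _ = 0#

  δ-refl : ∀ {n} (i : Fin n) → δ i i ≈ 1#
  δ-refl i with i Fin.≟ i
  ... | yes _   = refl
  ... | no  i≢i = contradiction ≡.refl i≢i

  δ-≢ : ∀ {n} {i j : Fin n} → ¬ i ≡ j → δ i j ≈ 0#
  δ-≢ {i = i} {j} i≢j with i Fin.≟ j
  ... | yes i≡j = contradiction i≡j i≢j
  ... | no  _   = refl

  δ-nonneg : ∀ {n} (i j : Fin n) → 0# ≤ δ i j
  δ-nonneg i j with i Fin.≟ j
  ... | yes _ = inj₁ 0<1
  ... | no  _ = ≤-refl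

  ∑-δ : ∀ {n} (i : Fin n) (f : Fin n → Carrier) → sum (λ j → δ i j * f j) ≈ f i
  ∑-δ i f = trans (∑-single _ i (λ j j≢i → x≈0⇒x*y≈0 (δ-≢ (j≢i ∘ ≡.sym))))
                  (trans (*-congʳ (δ-refl i)) (*-identityˡ _))

  ·-cong : ∀ {e} {φ ψ x y : Point e} → φ ≋ ψ → x ≋ y → φ · x ≈ ψ · y
  ·-cong φ≋ψ x≋y = sum-cong-≋ λ j → *-cong (φ≋ψ j) (x≋y j)

  ·-congˡ : ∀ {e} {φ x y : Point e} → x ≋ y → φ · x ≈ φ · y
  ·-congˡ = ·-cong (λ _ → refl)

  ·-zero : ∀ {e} {φ x : Point e} → x ≋ (λ _ → 0#) → φ · x ≈ 0#
  ·-zero x≋0 = ∑-zero λ j → y≈0⇒x*y≈0 (x≋0 j)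

  zero-· : ∀ {e} (x : Point e) → (λ _ → 0#) · x ≈ 0#
  zero-· x = ∑-zero λ j → zeroˡ (x j)

  ·-comm : ∀ {e} (x y : Point e) → x · y ≈ y · x
  ·-comm x y = sum-cong-≋ λ j → *-comm (x j) (y j)

  infix 8 _∙_⊕_∙_

  _∙_⊕_∙_ : ∀ {e} → Carrier → Point e → Carrier → Point e → Point e
  (a ∙ φ ⊕ b ∙ ψ) j = a * φ j + b * ψ j

  ⊕-· : ∀ {e} a (φ : Point e) b ψ x → (a ∙ φ ⊕ b ∙ ψ) · x ≈ a * (φ · x) + b * (ψ · x)
  ⊕-· a φ b ψ x = begin
    sum (λ j → (a * φ j + b * ψ j) * x j)  ≈⟨ sum-cong-≋ (λ j → solve 5 (λ a p b q x → (a :* p :+ b :* q) :* x := a :* (p :* x) :+ b :* (q :* x)) refl a (φ j) b (ψ j) (x j)) ⟩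
    sum (λ j → a * (φ j * x j) + b * (ψ j * x j))  ≈⟨ ∑-distrib-+ (λ j → a * (φ j * x j)) (λ j → b * (ψ j * x j)) ⟩
    sum (λ j → a * (φ j * x j)) + sum (λ j → b * (ψ j * x j))  ≈⟨ +-cong (*-distribˡ-sum a (λ j → φ j * x j)) (*-distribˡ-sum b (λ j → ψ j * x j)) ⟨
    a * (φ · x) + b * (ψ · x) ∎

  combination-· : ∀ {e n} (t : Vector Carrier n) (V : Vector (Point e) n) x →
                  combination t V · x ≈ sum (λ i → t i * (V i · x))
  combination-· t V x = begin
    sum (λ j → sum (λ i → t i * V i j) * x j)  ≈⟨ sum-cong-≋ (λ j → *-distribʳ-sum (x j) (λ i → t i * V i j)) ⟩
    sum (λ j → sum (λ i → t i * V i j * x j))  ≈⟨ ∑-comm (λ j i → t i * V i j * x j) ⟩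
    sum (λ i → sum (λ j → t i * V i j * x j))  ≈⟨ sum-cong-≋ (λ i → sum-cong-≋ λ j → *-assoc (t i) (V i j) (x j)) ⟩
    sum (λ i → sum (λ j → t i * (V i j * x j)))  ≈⟨ sum-cong-≋ (λ i → *-distribˡ-sum (t i) (λ j → V i j * x j)) ⟨
    sum (λ i → t i * (V i · x)) ∎

  ·-combination : ∀ {e n} (φ : Point e) (t : Vector Carrier n) (V : Vector (Point e) n) →
                  φ · combination t V ≈ sum (λ i → t i * (φ · V i))
  ·-combination φ t V = begin
    φ · combination t V  ≈⟨ ·-comm φ (combination t V) ⟩
    combination t V · φ  ≈⟨ combination-· t V φ ⟩
    sum (λ i → t i * (V i · φ))  ≈⟨ sum-cong-≋ (λ i → *-congˡ (·-comm (V i) φ)) ⟩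
    sum (λ i → t i * (φ · V i))  ∎

  combination-assoc : ∀ {e m n} (t : Vector Carrier m) (C : Vector (Vector Carrier n) m) (V : Vector (Point e) n) →
                      combination t (λ i → combination (C i) V) ≋ combination (combination t C) V
  combination-assoc t C V j = sym (combination-· t C (λ k → V k j))

  Span : ∀ {e n} → Vector (Point e) n → Point e → Set (c ⊔ ℓ₁)
  Span u w = ∃[ t ] combination t u ≋ w

  Independent : ∀ {e n} → Vector (Point e) n → Set (c ⊔ ℓ₁)
  Independent u = ∀ t → combination t u ≋ (λ _ → 0#) → ∀ i → t i ≈ 0#

  vanishes-on-span : ∀ {e n} {φ : Point e} {u : Vector (Point e) n} {w} →
                     (∀ i → φ · u i ≈ 0#) → Span u w → φ · w ≈ 0#
  vanishes-on-span {φ = φ} {u} {w} φu≈0 (t , eq) = begin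
    φ · w  ≈⟨ ·-congˡ {φ = φ} eq ⟨
    φ · combination t u  ≈⟨ ·-combination φ t u ⟩
    sum (λ i → t i * (φ · u i))  ≈⟨ ∑-zero (λ i → y≈0⇒x*y≈0 (φu≈0 i)) ⟩
    0# ∎

  -- A vector of weight zero need not lie in the span: in a convex combination representing a point
  -- of a face, the presenting points off the face have weight zero.
  combination-∈-span : ∀ {e m n} {u : Vector (Point e) n} (t : Vector Carrier m) (V : Vector (Point e) m) →
                       (∀ i → t i ≈ 0# ⊎ Span u (V i)) → Span u (combination t V)
  combination-∈-span {n = n} {u = u} t V d = combination t C , λ j → begin
    combination (combination t C) u j  ≈⟨ combination-assoc t C u j ⟨
    combination t (λ i → combination (C i) u) j  ≈⟨ sum-cong-≋ (λ i → eq i j) ⟩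
    combination t V j ∎
    where
    coefficients : ∀ {i} → t i ≈ 0# ⊎ Span u (V i) → Vector Carrier n
    coefficients (inj₁ _)       = λ _ → 0#
    coefficients (inj₂ (s , _)) = s
    C : ∀ i → Vector Carrier n
    C i = coefficients (d i)
    eq : ∀ i j → t i * combination (C i) u j ≈ t i * V i j
    eq i j with d i
    ... | inj₁ tᵢ≈0     = trans (x≈0⇒x*y≈0 tᵢ≈0) (sym (x≈0⇒x*y≈0 tᵢ≈0))
    ... | inj₂ (s , eq) = *-congˡ (eq j)

  fredholm : ∀ {e n} (u : Vector (Point e) n) (w : Point e) →
             Span u w ⊎ ∃[ φ ] (∀ i → φ · u i ≈ 0#) × φ · w ≈ 1#
  fredholm {n = zero} u w with search (λ j → toSum (w j ≟ 0#))
  ... | inj₁ w≈0        = inj₁ ((λ ()) , λ j → sym (w≈0 j))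
  ... | inj₂ (j , wⱼ≉0) = inj₂ ((λ k → δ j k * inv (w j)) , (λ ()) , (begin
    sum (λ k → δ j k * inv (w j) * w k)  ≈⟨ sum-cong-≋ (λ k → *-assoc (δ j k) _ _) ⟩
    sum (λ k → δ j k * (inv (w j) * w k))  ≈⟨ ∑-δ j (λ k → inv (w j) * w k) ⟩
    inv (w j) * w j  ≈⟨ *-comm _ _ ⟩
    w j * inv (w j)  ≈⟨ inv-inverse wⱼ≉0 ⟩
    1# ∎))
  fredholm {n = suc n} u w with fredholm (u ∘ suc) (u zero)
  ... | inj₁ (t , eq) with fredholm (u ∘ suc) w
  ...   | inj₁ (s , eq′)      = inj₁ (0# ∷ s , λ j → trans (+-congʳ (zeroˡ _)) (trans (+-identityˡ _) (eq′ j)))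
  ...   | inj₂ (φ , φu , φw)  = inj₂ (φ , (λ { zero → vanishes-on-span {φ = φ} φu (t , eq) ; (suc i) → φu i }) , φw)
  fredholm {n = suc n} u w | inj₂ (φ₀ , φ₀u , φ₀u₀)
      with fredholm (u ∘ suc) (1# ∙ w ⊕ (- (φ₀ · w)) ∙ u zero)
  ... | inj₁ (t , eq) = inj₁ ((φ₀ · w) ∷ t , λ j → begin
    (φ₀ · w) * u zero j + combination t (u ∘ suc) j  ≈⟨ +-congˡ (eq j) ⟩
    (φ₀ · w) * u zero j + (1# * w j + - (φ₀ · w) * u zero j)  ≈⟨ solve 3 (λ a u w → a :* u :+ (1′ :* w :+ (:- a) :* u) := w) refl (φ₀ · w) (u zero j) (w j) ⟩
    w j ∎)
  ... | inj₂ (φ , φu , φw′) = inj₂ (ψ , ψu , (begin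
    ψ · w  ≈⟨ ⊕-· 1# φ (- (φ · u zero)) φ₀ w ⟩
    1# * (φ · w) + - (φ · u zero) * (φ₀ · w)  ≈⟨ solve 3 (λ a b c → 1′ :* a :+ (:- b) :* c := 1′ :* a :+ (:- c) :* b) refl (φ · w) (φ · u zero) (φ₀ · w) ⟩
    1# * (φ · w) + - (φ₀ · w) * (φ · u zero)  ≈⟨ +-cong (*-congˡ (·-comm φ w)) (*-congˡ (·-comm φ (u zero))) ⟩
    1# * (w · φ) + - (φ₀ · w) * (u zero · φ)  ≈⟨ ⊕-· 1# w (- (φ₀ · w)) (u zero) φ ⟨
    (1# ∙ w ⊕ (- (φ₀ · w)) ∙ u zero) · φ  ≈⟨ ·-comm (1# ∙ w ⊕ (- (φ₀ · w)) ∙ u zero) φ ⟩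
    φ · (1# ∙ w ⊕ (- (φ₀ · w)) ∙ u zero)  ≈⟨ φw′ ⟩
    1# ∎))
    where
    -- The multiple of `φ₀` is chosen so that `ψ` vanishes at `u zero`; its value at `w` is then
    -- that of `φ` at the reduced vector.
    ψ = 1# ∙ φ ⊕ (- (φ · u zero)) ∙ φ₀
    ψu : ∀ i → ψ · u i ≈ 0#
    ψu zero = begin
      ψ · u zero  ≈⟨ ⊕-· 1# φ (- (φ · u zero)) φ₀ (u zero) ⟩
      1# * (φ · u zero) + - (φ · u zero) * (φ₀ · u zero)  ≈⟨ +-congˡ (*-congˡ φ₀u₀) ⟩
      1# * (φ · u zero) + - (φ · u zero) * 1#  ≈⟨ solve 1 (λ a → 1′ :* a :+ (:- a) :* 1′ := 0′) refl (φ · u zero) ⟩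
      0# ∎
    ψu (suc i) = trans (⊕-· 1# φ (- (φ · u zero)) φ₀ (u (suc i)))
      (+-zero (y≈0⇒x*y≈0 (φu i)) (y≈0⇒x*y≈0 (φ₀u i)))

  Nonzero : ∀ {n} → Vector Carrier n → Set ℓ₁
  Nonzero x = ∃[ j ] ¬ x j ≈ 0#

  -- Gaussian elimination of the first unknown.
  kernel : ∀ {m n} → m ℕ.< n → (M : Vector (Point n) m) → ∃[ x ] Nonzero x × (∀ i → M i · x ≈ 0#)
  kernel {n = suc n} m<n M with Fin.any? (λ i → ¬? (M i zero ≟ 0#))
  kernel {n = suc n} m<n M | no ∄ = δ zero , (zero , λ eq → 0≉1 (trans (sym eq) (δ-refl {suc n} zero))) , λ i → begin
    M i · δ zero  ≈⟨ ·-comm (M i) (δ zero) ⟩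
    sum (λ j → δ zero j * M i j)  ≈⟨ ∑-δ zero (M i) ⟩
    M i zero  ≈⟨ column i ⟩
    0# ∎
    where
    column : ∀ i → M i zero ≈ 0#
    column i with M i zero ≟ 0#
    ... | yes eq = eq
    ... | no neq = contradiction (i , neq) ∄
  kernel {suc m} {suc n} (ℕ.s≤s m<n) M | yes (i₀ , a≉0)
      with kernel {m} {n} m<n (λ i → 1# ∙ (M (punchIn i₀ i) ∘ suc) ⊕ (- (M (punchIn i₀ i) zero * inv (M i₀ zero))) ∙ (M i₀ ∘ suc))
  ... | x , (j , xⱼ≉0) , Mx = (- (inv a * r)) ∷ x , (suc j , xⱼ≉0) , row
    where
    a = M i₀ zero
    r = (M i₀ ∘ suc) · x
    pivot : M i₀ · ((- (inv a * r)) ∷ x) ≈ 0#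
    pivot = begin
      a * - (inv a * r) + r  ≈⟨ solve 3 (λ a b r → a :* (:- (b :* r)) :+ r := r :- (a :* b) :* r) refl a (inv a) r ⟩
      r - (a * inv a) * r  ≈⟨ +-congˡ (-‿cong (*-congʳ (inv-inverse a≉0))) ⟩
      r - 1# * r  ≈⟨ solve 1 (λ r → r :- 1′ :* r := 0′) refl r ⟩
      0# ∎
    other : ∀ k → M (punchIn i₀ k) · ((- (inv a * r)) ∷ x) ≈ 0#
    other k = begin
      b * - (inv a * r) + s  ≈⟨ solve 4 (λ b v r s → b :* (:- (v :* r)) :+ s := 1′ :* s :+ (:- (b :* v)) :* r) refl b (inv a) r s ⟩
      1# * s + - (b * inv a) * r  ≈⟨ ⊕-· 1# (M (punchIn i₀ k) ∘ suc) (- (b * inv a)) (M i₀ ∘ suc) x ⟨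
      (1# ∙ (M (punchIn i₀ k) ∘ suc) ⊕ (- (b * inv a)) ∙ (M i₀ ∘ suc)) · x  ≈⟨ Mx k ⟩
      0# ∎
      where
      b = M (punchIn i₀ k) zero
      s = (M (punchIn i₀ k) ∘ suc) · x
    row : ∀ i → M i · ((- (inv a * r)) ∷ x) ≈ 0#
    row i with i₀ Fin.≟ i
    ... | yes ≡.refl = pivot
    ... | no  i₀≢i   = ≡.subst (λ k → M k · ((- (inv a * r)) ∷ x) ≈ 0#) (Fin.punchIn-punchOut i₀≢i) (other (punchOut i₀≢i))

  -- If m > n, the coefficients give n equations in m unknowns; a nonzero solution is a dependency
  -- among the `u i`.
  independent-≤ : ∀ {e m n} {u : Vector (Point e) m} {v : Vector (Point e) n} →
                  Independent u → (∀ i → Span v (u i)) → m ℕ.≤ n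
  independent-≤ {m = m} {n} {u} {v} ind sp with m ℕ.≤? n
  ... | yes m≤n = m≤n
  ... | no  m≰n with kernel (ℕ.≰⇒> m≰n) (λ k i → proj₁ (sp i) k)
  ...   | x , (j , xⱼ≉0) , Mx = contradiction (ind x vanish j) xⱼ≉0
    where
    C : ∀ i → Vector Carrier n
    C i = proj₁ (sp i)
    vanish : combination x u ≋ (λ _ → 0#)
    vanish j = begin
      combination x u j  ≈⟨ sum-cong-≋ (λ i → *-congˡ (proj₂ (sp i) j)) ⟨
      combination x (λ i → combination (C i) v) j  ≈⟨ combination-assoc x C v j ⟩
      combination (combination x C) v j  ≈⟨ ∑-zero (λ k → x≈0⇒x*y≈0 (trans (sum-cong-≋ (λ i → *-comm (x i) (C i k))) (Mx k))) ⟩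
      0# ∎

  -- Homogeneous coordinates turn affine notions into linear ones.
  hat : ∀ {e} → Point e → Point (suc e)
  hat x = 1# ∷ x

  hat-combination : ∀ {e n} (t : Vector Carrier n) (V : Vector (Point e) n) →
                    sum t ≈ combination t (hat ∘ V) zero
  hat-combination t V = sum-cong-≋ λ i → sym (*-identityʳ (t i))

  aff⇒span : ∀ {e n} {V : Vector (Point e) n} {x} → Aff V x → Span (hat ∘ V) (hat x)
  aff⇒span {V = V} (t , ∑t≈1 , eq) =
    t , λ { zero → trans (sym (hat-combination t V)) ∑t≈1 ; (suc j) → eq j }

  span⇒aff : ∀ {e n} {V : Vector (Point e) n} {x} → Span (hat ∘ V) (hat x) → Aff V x
  span⇒aff {V = V} (t , eq) = t , trans (hat-combination t V) (eq zero) , eq ∘ suc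

  affInd⇒ind : ∀ {e n} {V : Vector (Point e) n} → AffinelyIndependent V → Independent (hat ∘ V)
  affInd⇒ind {V = V} ind t eq = ind t (trans (hat-combination t V) (eq zero)) (eq ∘ suc)

  ind⇒affInd : ∀ {e n} {V : Vector (Point e) n} → Independent (hat ∘ V) → AffinelyIndependent V
  ind⇒affInd {V = V} ind t ∑t≈0 eq =
    ind t λ { zero → trans (sym (hat-combination t V)) ∑t≈0 ; (suc j) → eq j }

  -- Rank S (suc k) is Dim S k, and Rank S 0 says that S is empty.
  Rank : ∀ {e} → Region e → ℕ → Set (c ⊔ ℓ₁ ⊔ ℓ₂)
  Rank {e} S k = Σ[ B ∈ Vector (Point e) k ]
    (∀ i → S (B i)) × AffinelyIndependent B × (∀ x → S x → Aff B x)

  rank-mono : ∀ {e} {S S′ : Region e} {k l} → (∀ x → S x → S′ x) → Rank S k → Rank S′ l → k ℕ.≤ l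
  rank-mono S⊆S′ (B , B∈S , ind , _) (B′ , _ , _ , spans) =
    independent-≤ (affInd⇒ind ind) (λ i → aff⇒span (spans (B i) (S⊆S′ (B i) (B∈S i))))

  rank-unique : ∀ {e} {S : Region e} {k l} → Rank S k → Rank S l → k ≡ l
  rank-unique r r′ = ℕ.≤-antisym (rank-mono (λ _ → id) r r′) (rank-mono (λ _ → id) r′ r)

  rank-resp : ∀ {e} {S S′ : Region e} {k} → (∀ x → S x → S′ x) → (∀ x → S′ x → S x) → Rank S k → Rank S′ k
  rank-resp S⊆S′ S′⊆S (B , B∈S , ind , spans) =
    B , (λ i → S⊆S′ (B i) (B∈S i)) , ind , (λ x x∈S′ → spans x (S′⊆S x x∈S′))

  rank-empty : ∀ {e} {S : Region e} → (∀ x → ¬ S x) → Rank S 0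
  rank-empty empty = [] , (λ ()) , (λ _ _ _ ()) , λ x x∈S → contradiction x∈S (empty x)

  rank0⇒empty : ∀ {e} {S : Region e} → Rank S 0 → ∀ x → ¬ S x
  rank0⇒empty (_ , _ , _ , spans) x x∈S with spans x x∈S
  ... | _ , 0≈1 , _ = 0≉1 0≈1

  infix 8 _⟨_⟩

  _⟨_⟩ : ∀ {e} → Point (suc e) → Point e → Carrier
  φ ⟨ x ⟩ = φ · hat x

  aff-value : ∀ {e n} (φ : Point (suc e)) (t : Vector Carrier n) (V : Vector (Point e) n) {x} →
              sum t ≈ 1# → combination t V ≋ x → φ ⟨ x ⟩ ≈ sum (λ i → t i * φ ⟨ V i ⟩)
  aff-value φ t V {x} ∑t≈1 eq = begin
    φ · hat x  ≈⟨ ·-congˡ {φ = φ} {x = combination t (hat ∘ V)} {y = hat x} (λ { zero → trans (sym (hat-combination t V)) ∑t≈1 ; (suc j) → eq j }) ⟨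
    φ · combination t (hat ∘ V)  ≈⟨ ·-combination φ t (hat ∘ V) ⟩
    sum (λ i → t i * φ ⟨ V i ⟩) ∎

  -- A dual basis suffices: a member of an independent family is outside the span of the others, so
  -- `fredholm` yields a functional that separates it from them.
  interpolate : ∀ {e n} {u : Vector (Point e) n} → Independent u → (s : Vector Carrier n) → ∃[ φ ] (∀ i → φ · u i ≈ s i)
  interpolate {e} {n} {u} ind s = combination s Φ , λ i → begin
    combination s Φ · u i  ≈⟨ combination-· s Φ (u i) ⟩
    sum (λ k → s k * (Φ k · u i))  ≈⟨ sum-cong-≋ (λ k → *-comm (s k) (Φ k · u i)) ⟩
    sum (λ k → (Φ k · u i) * s k)  ≈⟨ sum-cong-≋ (λ k → *-congʳ (Φu k i)) ⟩
    sum (λ k → δ i k * s k)  ≈⟨ ∑-δ i s ⟩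
    s i ∎
    where
    others : Fin n → Vector (Point e) n
    others k i j = (1# - δ k i) * u i j
    dual : ∀ k → ∃[ φ ] (∀ i → φ · u i ≈ δ i k)
    dual k with fredholm (others k) (u k)
    ... | inj₁ (t , eq) = contradiction (ind t′ vanish k) λ t′ₖ≈0 → 0≉1 (begin
        0#  ≈⟨ neg-zero t′ₖ≈0 ⟨
        - (t k * (1# - δ k k) - δ k k)  ≈⟨ -‿cong (+-cong (*-congˡ (+-congˡ (-‿cong (δ-refl k)))) (-‿cong (δ-refl k))) ⟩
        - (t k * (1# - 1#) - 1#)  ≈⟨ solve 1 (λ t → :- (t :* (1′ :- 1′) :- 1′) := 1′) refl (t k) ⟩
        1# ∎)
      where
      t′ : Vector Carrier n
      t′ i = t i * (1# - δ k i) - δ k i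
      vanish : combination t′ u ≋ (λ _ → 0#)
      vanish j = begin
        sum (λ i → (t i * (1# - δ k i) - δ k i) * u i j)  ≈⟨ sum-cong-≋ (λ i → solve 3 (λ t d u → (t :* (1′ :- d) :- d) :* u := t :* ((1′ :- d) :* u) :+ (:- (d :* u))) refl (t i) (δ k i) (u i j)) ⟩
        sum (λ i → t i * others k i j + - (δ k i * u i j))  ≈⟨ ∑-distrib-+ (λ i → t i * others k i j) (λ i → - (δ k i * u i j)) ⟩
        combination t (others k) j + sum (λ i → - (δ k i * u i j))  ≈⟨ +-cong (eq j) (trans (∑-neg (λ i → δ k i * u i j)) (-‿cong (∑-δ k (λ i → u i j)))) ⟩
        u k j - u k j  ≈⟨ -‿inverseʳ (u k j) ⟩
        0# ∎
    ... | inj₂ (φ , φo , φu) = φ , value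
      where
      value : ∀ i → φ · u i ≈ δ i k
      value i with i Fin.≟ k
      ... | yes ≡.refl = φu
      ... | no  i≢k    = begin
        φ · u i  ≈⟨ ·-congˡ {φ = φ} (λ j → trans (*-congʳ (trans (+-congˡ (neg-zero (δ-≢ (i≢k ∘ ≡.sym)))) (+-identityʳ 1#))) (*-identityˡ (u i j))) ⟨
        φ · others k i  ≈⟨ φo i ⟩
        0# ∎
    Φ : Vector (Point e) n
    Φ k = proj₁ (dual k)
    Φu : ∀ k i → Φ k · u i ≈ δ i k
    Φu k = proj₂ (dual k)

-- Faces, covers and dimensions

module FaceStructure {c ℓ₁ ℓ₂ : Level} (F : OrderedField c ℓ₁ ℓ₂) where

  open OrderedField F hiding (zero)
  open OrderedFieldProperties F
  open Geometry F
  open LinearAlgebra F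
  open SetoidReasoning setoid

  module _ {e} {P : Polytope e} where

    -- The inequality in homogeneous coordinates, oriented so that its value, the slack, is
    -- nonnegative on `P` and, among the points of `P`, zero exactly on the face.
    functional : Face P → Point (suc e)
    functional G = offset G ∷ λ j → - normal G j

    slack : Face P → Fin (size P) → Carrier
    slack G i = functional G ⟨ points P i ⟩

    functional-value : ∀ G x → functional G ⟨ x ⟩ ≈ offset G - normal G · x
    functional-value G x = begin
      offset G * 1# + sum (λ j → - normal G j * x j)  ≈⟨ +-cong (*-identityʳ _) (sum-cong-≋ (λ j → sym (-‿distribˡ-* (normal G j) (x j)))) ⟩
      offset G + sum (λ j → - (normal G j * x j))  ≈⟨ +-congˡ (∑-neg (λ j → normal G j * x j)) ⟩
      offset G - normal G · x ∎

    vertex∈body : ∀ i → Body P (points P i)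
    vertex∈body i = δ i , δ-nonneg i , trans (sum-cong-≋ (λ j → sym (*-identityʳ (δ i j)))) (∑-δ i (λ _ → 1#)) ,
                    λ j → ∑-δ i (λ k → points P k j)

    functional-nonneg : ∀ G {x} → Body P x → 0# ≤ functional G ⟨ x ⟩
    functional-nonneg G {x} x∈P = ≤-respʳ (sym (functional-value G x)) (x≤y⇒0≤y-x (valid G x x∈P))

    slack-nonneg : ∀ G i → 0# ≤ slack G i
    slack-nonneg G i = functional-nonneg G (vertex∈body i)

    locus⇒≈0 : ∀ G {x} → Locus G x → functional G ⟨ x ⟩ ≈ 0#
    locus⇒≈0 G {x} (_ , eq) = trans (functional-value G x) (trans (+-congʳ (sym eq)) (-‿inverseʳ _))

    ≈0⇒locus : ∀ G {x} → Body P x → functional G ⟨ x ⟩ ≈ 0# → Locus G x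
    ≈0⇒locus G {x} x∈P eq = x∈P , sym (x-y≈0⇒x≈y (trans (sym (functional-value G x)) eq))

    vertex∈locus : ∀ G i → slack G i ≈ 0# → Locus G (points P i)
    vertex∈locus G i = ≈0⇒locus G (vertex∈body i)

    -- Complementary slackness: the slack at `x` is the weighted sum of the slacks at the presenting
    -- points, and a vanishing sum of nonnegative terms vanishes termwise.
    locus-support : ∀ G {t x} → (∀ i → 0# ≤ t i) → sum t ≈ 1# → combination t (points P) ≋ x →
                    functional G ⟨ x ⟩ ≈ 0# → ∀ i → t i ≈ 0# ⊎ slack G i ≈ 0#
    locus-support G {t} {x} 0≤t ∑t≈1 eq val i with t i ≟ 0#
    ... | yes tᵢ≈0 = inj₁ tᵢ≈0
    ... | no  tᵢ≉0 = inj₂ (x*y≈0⇒y≈0 tᵢ≉0 (∑-nonneg-zero (λ k → *-nonneg (0≤t k) (slack-nonneg G k))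
                       (trans (sym (aff-value (functional G) t (points P) ∑t≈1 eq)) val) i))

    face : ∀ φ → (∀ i → 0# ≤ φ ⟨ points P i ⟩) → Face P
    face φ 0≤φ = record
      { normal = λ j → - φ (suc j)
      ; offset = φ zero
      ; valid  = λ { x (t , 0≤t , ∑t≈1 , eq) → 0≤y-x⇒x≤y (≤-respʳ (trans (sym (aff-value φ t (points P) ∑t≈1 eq)) (value x))
                       (∑-nonneg λ i → *-nonneg (0≤t i) (0≤φ i))) }
      }
      where
      value : ∀ x → φ ⟨ x ⟩ ≈ φ zero - sum (λ j → - φ (suc j) * x j)
      value x = begin
        φ zero * 1# + sum (λ j → φ (suc j) * x j)  ≈⟨ +-cong (*-identityʳ _) (sum-cong-≋ λ j → solve 2 (λ a x → a :* x := :- ((:- a) :* x)) refl (φ (suc j)) (x j)) ⟩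
        φ zero + sum (λ j → - (- φ (suc j) * x j))  ≈⟨ +-congˡ (∑-neg (λ j → - φ (suc j) * x j)) ⟩
        φ zero - sum (λ j → - φ (suc j) * x j) ∎

    face-value : ∀ φ 0≤φ x → functional (face φ 0≤φ) ⟨ x ⟩ ≈ φ ⟨ x ⟩
    face-value φ 0≤φ x = ·-cong {φ = functional (face φ 0≤φ)} {ψ = φ} {x = hat x} {y = hat x} (λ { zero → refl ; (suc j) → -‿involutive (φ (suc j)) }) (λ _ → refl)

    private
      ∅-nonneg : ∀ i → 0# ≤ δ zero ⟨ points P i ⟩
      ∅-nonneg i = ≤-respʳ (sym (∑-δ zero (hat (points P i)))) (inj₁ 0<1)

      ⊤-nonneg : ∀ i → 0# ≤ (λ _ → 0#) ⟨ points P i ⟩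
      ⊤-nonneg i = inj₂ (sym (zero-· (hat (points P i))))

    -- In homogeneous coordinates `δ zero` is the constant functional 1, so its face is empty; the
    -- zero functional gives the whole polytope.
    ∅-face ⊤-face : Face P
    ∅-face = face (δ zero) ∅-nonneg
    ⊤-face = face (λ _ → 0#) ⊤-nonneg

    ∅-face-value : ∀ x → functional ∅-face ⟨ x ⟩ ≈ 1#
    ∅-face-value x = trans (face-value (δ zero) ∅-nonneg x) (∑-δ zero (hat x))

    ⊤-face-value : ∀ x → functional ⊤-face ⟨ x ⟩ ≈ 0#
    ⊤-face-value x = trans (face-value (λ _ → 0#) ⊤-nonneg x) (zero-· (hat x))

    infix 4 _⊑_ _⊏_

    -- Comparing faces only at the presenting points makes containment decidable by a finite search.
    -- It is equivalent to inclusion of the loci, by `locus-⊆⇒⊑` and `⊑⇒locus-⊆`.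
    _⊑_ _⊏_ : Rel (Face P) ℓ₁
    G ⊑ H = ∀ i → slack G i ≈ 0# → slack H i ≈ 0#
    G ⊏ H = G ⊑ H × ∃[ i ] slack H i ≈ 0# × ¬ slack G i ≈ 0#

    ⊑-trans : ∀ {G H K} → G ⊑ H → H ⊑ K → G ⊑ K
    ⊑-trans G⊑H H⊑K i = H⊑K i ∘ G⊑H i

    locus-⊆⇒⊑ : ∀ {G H} → (∀ x → Locus G x → Locus H x) → G ⊑ H
    locus-⊆⇒⊑ {G} {H} G⊆H i eq = locus⇒≈0 H (G⊆H _ (vertex∈locus G i eq))

    ⊑⇒locus-⊆ : ∀ {G H} → G ⊑ H → ∀ x → Locus G x → Locus H x
    ⊑⇒locus-⊆ {G} {H} G⊑H x x∈G@(x∈P@(t , 0≤t , ∑t≈1 , eq) , _) =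
      ≈0⇒locus H x∈P (trans (aff-value (functional H) t (points P) ∑t≈1 eq)
        (∑-zero λ i → vanish i (locus-support G 0≤t ∑t≈1 eq (locus⇒≈0 G x∈G) i)))

      where
      vanish : ∀ i → t i ≈ 0# ⊎ slack G i ≈ 0# → t i * slack H i ≈ 0#
      vanish i (inj₁ eq) = x≈0⇒x*y≈0 eq
      vanish i (inj₂ eq) = y≈0⇒x*y≈0 (G⊑H i eq)

    gap? : ∀ G H i → (slack H i ≈ 0# → slack G i ≈ 0#) ⊎ (slack H i ≈ 0# × ¬ slack G i ≈ 0#)
    gap? G H i with slack H i ≟ 0# | slack G i ≟ 0#
    ... | no  neq | _       = inj₁ (λ eq → contradiction eq neq)
    ... | yes _   | yes eq  = inj₁ (λ _ → eq)
    ... | yes eq  | no  neq = inj₂ (eq , neq)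

    ⊑⇒⊏⊎⊒ : ∀ {G H} → G ⊑ H → G ⊏ H ⊎ H ⊑ G
    ⊑⇒⊏⊎⊒ {G} {H} G⊑H with search (gap? G H)
    ... | inj₁ H⊑G = inj₂ H⊑G
    ... | inj₂ i   = inj₁ (G⊑H , i)

    locus-in-span : ∀ {n} {u : Vector (Point (suc e)) n} G → (∀ i → slack G i ≈ 0# → Span u (hat (points P i))) →
                    ∀ x → Locus G x → Span u (hat x)
    locus-in-span {u = u} G sp x x∈G@((t , 0≤t , ∑t≈1 , eq) , _)
      with combination-∈-span {u = u} t (hat ∘ points P)
             (λ i → [ inj₁ , inj₂ ∘ sp i ]′ (locus-support G 0≤t ∑t≈1 eq (locus⇒≈0 G x∈G) i))
    ... | s , eq′ = s , λ { zero    → trans (eq′ zero) (trans (sym (hat-combination t (points P))) ∑t≈1)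
                          ; (suc j) → trans (eq′ (suc j)) (eq j) }

    spanned? : ∀ {n} (u : Vector (Point (suc e)) n) H i →
               (slack H i ≈ 0# → Span u (hat (points P i))) ⊎
               (slack H i ≈ 0# × ∃[ φ ] (∀ j → φ · u j ≈ 0#) × φ ⟨ points P i ⟩ ≈ 1#)
    spanned? u H i with slack H i ≟ 0# | fredholm u (hat (points P i))
    ... | no  neq | _       = inj₁ (λ eq → contradiction eq neq)
    ... | yes _   | inj₁ sp = inj₁ (λ _ → sp)
    ... | yes eq  | inj₂ φ  = inj₂ (eq , φ)

    -- If an affine functional vanishing on F and at i₀ does not vanish on G, tilting F along it
    -- until it meets a further vertex of G produces the intermediate face.
    cover-or-between : ∀ {G H k} → G ⊏ H → Rank (Locus G) k →
                       Rank (Locus H) (suc k) ⊎ ∃[ K ] G ⊏ K × K ⊏ H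
    cover-or-between {G} {H} {k} (G⊑H , i₀ , Hi₀≈0 , Gi₀≉0) (B , B∈G , ind , spans)
      with search (spanned? (hat ∘ (points P i₀ ∷ B)) H)
    ... | inj₁ sp = inj₁ (points P i₀ ∷ B , B′∈H , ind⇒affInd {V = points P i₀ ∷ B} ind′ , λ x x∈H → span⇒aff {V = points P i₀ ∷ B} (locus-in-span {u = hat ∘ (points P i₀ ∷ B)} H sp x x∈H))
      where
      B′∈H : ∀ i → Locus H ((points P i₀ ∷ B) i)
      B′∈H zero    = vertex∈locus H i₀ Hi₀≈0
      B′∈H (suc i) = ⊑⇒locus-⊆ {G} {H} G⊑H (B i) (B∈G i)
      ind′ : Independent (hat ∘ (points P i₀ ∷ B))
      ind′ t eq = λ { zero → t₀≈0 ; (suc i) → affInd⇒ind {V = B} ind (t ∘ suc) tail≈0 i }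
        where
        g = functional G
        t₀≈0 : t zero ≈ 0#
        t₀≈0 = x*y≈0⇒y≈0 Gi₀≉0 (begin
          slack G i₀ * t zero  ≈⟨ *-comm _ _ ⟩
          t zero * slack G i₀  ≈⟨ +-identityʳ _ ⟨
          t zero * slack G i₀ + 0#  ≈⟨ +-congˡ (∑-zero (λ i → y≈0⇒x*y≈0 (locus⇒≈0 G (B∈G i)))) ⟨
          t zero * slack G i₀ + sum (λ i → t (suc i) * g ⟨ B i ⟩)  ≈⟨ ·-combination g t (hat ∘ (points P i₀ ∷ B)) ⟨
          g · combination t (hat ∘ (points P i₀ ∷ B))  ≈⟨ ·-zero {φ = g} eq ⟩
          0# ∎)
        tail≈0 : combination (t ∘ suc) (hat ∘ B) ≋ (λ _ → 0#)
        tail≈0 j = begin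
          combination (t ∘ suc) (hat ∘ B) j  ≈⟨ +-identityˡ _ ⟨
          0# + combination (t ∘ suc) (hat ∘ B) j  ≈⟨ +-congʳ (x≈0⇒x*y≈0 t₀≈0) ⟨
          combination t (hat ∘ (points P i₀ ∷ B)) j  ≈⟨ eq j ⟩
          0# ∎
    -- The functional `φ` vanishes on `G` and at `points P i₀`, but is 1 at `points P i₁`, a point
    -- of `H`. Its vanishing at `i₀` keeps that point off `K`, so that `K` is not all of `H`.
    ... | inj₂ (i₁ , Hi₁≈0 , φ , φu≈0 , φi₁≈1) = inj₂ (K , (G⊑K , i₂ , Ki₂≈0 , Gi₂≉0) , (K⊑H , i₀ , Hi₀≈0 , Ki₀≉0))
      where
      f : Fin (size P) → Carrier
      f i = φ ⟨ points P i ⟩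
      φ-vanishes : ∀ i → slack G i ≈ 0# → f i ≈ 0#
      φ-vanishes i eq = vanishes-on-span {φ = φ} (φu≈0 ∘ suc) (aff⇒span (spans _ (vertex∈locus G i eq)))
      tilt = ratio-test (λ i → slack H i ≟ 0#) (slack G) f (slack-nonneg G) (i₁ , Hi₁≈0 , <-respʳ-≈ (sym φi₁≈1) 0<1)
      i₂ = proj₁ tilt
      Hi₂≈0 = proj₁ (proj₂ tilt)
      0<fi₂ = proj₁ (proj₂ (proj₂ tilt))
      Gi₂≉0 : ¬ slack G i₂ ≈ 0#
      Gi₂≉0 eq = <⇒≉ 0<fi₂ (sym (φ-vanishes i₂ eq))
      ψ : Point (suc e)
      ψ = f i₂ ∙ functional G ⊕ (- slack G i₂) ∙ φ
      h : Fin (size P) → Carrier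
      h i = ψ ⟨ points P i ⟩
      h-value : ∀ i → h i ≈ f i₂ * slack G i - slack G i₂ * f i
      h-value i = trans (⊕-· (f i₂) (functional G) (- slack G i₂) φ (hat (points P i)))
        (+-congˡ (sym (-‿distribˡ-* _ _)))
      h-nonneg : ∀ i → slack H i ≈ 0# → 0# ≤ h i
      h-nonneg i Hi≈0 = ≤-respʳ (sym (h-value i)) (proj₂ (proj₂ (proj₂ tilt)) i Hi≈0)
      lift : ∃[ b ] 0# < b × (∀ i → 0# < slack H i → 0# < b * slack H i + h i)
      lift = dominate (slack H) h
      b = proj₁ lift
      -- The tilted functional is controlled only at the points of `H`; a large multiple of the
      -- inequality of `H` repairs it elsewhere and is invisible on `H`.
      χ : Point (suc e)
      χ = b ∙ functional H ⊕ 1# ∙ ψ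
      χ-value : ∀ i → χ ⟨ points P i ⟩ ≈ b * slack H i + h i
      χ-value i = trans (⊕-· b (functional H) 1# ψ (hat (points P i))) (+-congˡ (*-identityˡ _))
      χ-on-H : ∀ i → slack H i ≈ 0# → χ ⟨ points P i ⟩ ≈ h i
      χ-on-H i eq = trans (χ-value i) (trans (+-congʳ (y≈0⇒x*y≈0 eq)) (+-identityˡ _))
      χ-off-H : ∀ i → ¬ slack H i ≈ 0# → 0# < χ ⟨ points P i ⟩
      χ-off-H i neq = <-respʳ-≈ (sym (χ-value i)) (proj₂ (proj₂ lift) i (nonneg-split (slack-nonneg H i) neq))
      χ-nonneg : ∀ i → 0# ≤ χ ⟨ points P i ⟩
      χ-nonneg i with slack H i ≟ 0#
      ... | yes eq  = ≤-respʳ (sym (χ-on-H i eq)) (h-nonneg i eq)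
      ... | no  neq = inj₁ (χ-off-H i neq)
      K : Face P
      K = face χ χ-nonneg
      K-on-H : ∀ i → slack H i ≈ 0# → slack K i ≈ f i₂ * slack G i - slack G i₂ * f i
      K-on-H i eq = trans (face-value χ χ-nonneg _) (trans (χ-on-H i eq) (h-value i))
      G⊑K : G ⊑ K
      G⊑K i eq = trans (K-on-H i (G⊑H i eq)) (+-zero (y≈0⇒x*y≈0 eq) (neg-zero (y≈0⇒x*y≈0 (φ-vanishes i eq))))
      K⊑H : K ⊑ H
      K⊑H i eq with slack H i ≟ 0#
      ... | yes eq′ = eq′
      ... | no  neq = contradiction (trans (sym eq) (face-value χ χ-nonneg _)) (<⇒≉ (χ-off-H i neq))
      Ki₂≈0 : slack K i₂ ≈ 0#
      Ki₂≈0 = trans (K-on-H i₂ Hi₂≈0) (trans (+-congˡ (-‿cong (*-comm _ _))) (-‿inverseʳ _))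
      Ki₀≉0 : ¬ slack K i₀ ≈ 0#
      Ki₀≉0 eq = <⇒≉ (*-pos 0<fi₂ (nonneg-split (slack-nonneg G i₀) Gi₀≉0)) (begin
        0#  ≈⟨ eq ⟨
        slack K i₀  ≈⟨ K-on-H i₀ Hi₀≈0 ⟩
        f i₂ * slack G i₀ - slack G i₂ * f i₀  ≈⟨ +-congˡ (neg-zero (y≈0⇒x*y≈0 (φu≈0 zero))) ⟩
        f i₂ * slack G i₀ + 0#  ≈⟨ +-identityʳ _ ⟩
        f i₂ * slack G i₀ ∎)

    zeros : Face P → Subset (size P)
    zeros G = tabulate λ i → does (slack G i ≟ 0#)

    ∈-zeros⁺ : ∀ G i → slack G i ≈ 0# → i ∈ zeros G
    ∈-zeros⁺ G i eq = lookup⇒[]= i _ (≡.trans (lookup∘tabulate _ i) (dec-true (slack G i ≟ 0#) eq))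

    ∈-zeros⁻ : ∀ G i → i ∈ zeros G → slack G i ≈ 0#
    ∈-zeros⁻ G i i∈ with slack G i ≟ 0# | ≡.trans (≡.sym (lookup∘tabulate (λ i → does (slack G i ≟ 0#)) i)) ([]=⇒lookup i∈)
    ... | yes eq | _  = eq
    ... | no  _  | ()

    ⊏⇒∣zeros∣< : ∀ {G H} → G ⊏ H → ∣ zeros G ∣ ℕ.< ∣ zeros H ∣
    ⊏⇒∣zeros∣< {G} {H} (G⊑H , i , Hi≈0 , Gi≉0) = p⊂q⇒∣p∣<∣q∣
      ( (λ {j} j∈ → ∈-zeros⁺ H j (G⊑H j (∈-zeros⁻ G j j∈)))
      , i , ∈-zeros⁺ H i Hi≈0 , Gi≉0 ∘ ∈-zeros⁻ G i)

    -- A strict pair is refined until its last step is a cover. The lower part is treated first,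
    -- merely to learn the rank of the intermediate face `K`, from which the upper part can start.
    -- The number of presenting points gained from one face to the other decreases.
    cover-below : ∀ {G H k} → G ⊏ H → Rank (Locus G) k →
                  ∃[ H′ ] ∃[ l ] G ⊑ H′ × H′ ⊏ H × Rank (Locus H′) l × Rank (Locus H) (suc l)
    cover-below {G₀} {H₀} {k₀} = go {G₀} {H₀} {k₀} (<-wellFounded _)
      where
      gap : Face P → Face P → ℕ
      gap G H = ∣ zeros H ∣ ∸ ∣ zeros G ∣
      go : ∀ {G H k} → Acc ℕ._<_ (gap G H) → G ⊏ H → Rank (Locus G) k →
           ∃[ H′ ] ∃[ l ] G ⊑ H′ × H′ ⊏ H × Rank (Locus H′) l × Rank (Locus H) (suc l)
      go {G} {H} {k} (acc rs) G⊏H rG with cover-or-between {G} {H} G⊏H rG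
      ... | inj₁ rH = G , k , (λ _ eq → eq) , G⊏H , rG , rH
      ... | inj₂ (K , G⊏K , K⊏H)
          with go {G} {K} (rs (ℕ.∸-monoˡ-< (⊏⇒∣zeros∣< {K} {H} K⊏H) (ℕ.<⇒≤ (⊏⇒∣zeros∣< {G} {K} G⊏K)))) G⊏K rG
      ...   | _ , _ , _ , _ , _ , rK
          with go {K} {H} (rs (ℕ.∸-monoʳ-< (⊏⇒∣zeros∣< {G} {K} G⊏K) (ℕ.<⇒≤ (⊏⇒∣zeros∣< {K} {H} K⊏H)))) K⊏H rK
      ...   | H′ , l , K⊑H′ , rest = H′ , l , ⊑-trans {G} {K} {H′} (proj₁ G⊏K) K⊑H′ , rest

    rank-∅ : Rank (Locus ∅-face) 0
    rank-∅ = rank-empty λ x x∈∅ → 0≉1 (trans (sym (locus⇒≈0 ∅-face x∈∅)) (∅-face-value x))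

    -- Either `G` lies strictly above the empty face, and climbing from there ends with a rank for
    -- `G`, or `G` is empty itself.
    has-rank : ∀ G → ∃[ k ] Rank (Locus G) k
    has-rank G with ⊑⇒⊏⊎⊒ {∅-face} {G} (λ i eq → contradiction (trans (sym eq) (∅-face-value _)) 0≉1)
    ... | inj₁ ∅⊏G with cover-below {∅-face} {G} ∅⊏G rank-∅
    ...   | _ , l , _ , _ , _ , rG = suc l , rG
    has-rank G | inj₂ G⊑∅ = 0 , rank-empty λ x x∈G → rank0⇒empty rank-∅ x (⊑⇒locus-⊆ {G} {∅-face} G⊑∅ x x∈G)

-- Face lattices encoded by Gale sets

module Codes {c ℓ₁ ℓ₂ : Level} (F : OrderedField c ℓ₁ ℓ₂) where

  open OrderedField F using (Carrier)
  open Geometry F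
  open LinearAlgebra F
  open FaceStructure F
  open GaleSets

  -- The face lattice of P is that of the Gale sets of σ, ordered by inclusion.
  record Code {e} (P : Polytope e) {N} (σ : Fin N → Side) : Set (c ⊔ ℓ₁ ⊔ ℓ₂) where
    field
      supp        : Face P → Subset N
      supp-gale   : ∀ G → Gale σ (supp G)
      supp-mono   : ∀ {G H} → G ⊑ H → supp G ⊆ supp H
      supp-cancel : ∀ {G H} → supp G ⊆ supp H → G ⊑ H
      supp-onto   : ∀ A → Gale σ A → ∃[ G ] supp G ≡ A

    supp-cong : ∀ {G H} → G ⊑ H → H ⊑ G → supp G ≡ supp H
    supp-cong {G} {H} G⊑H H⊑G = ⊆-antisym (supp-mono {G} {H} G⊑H) (supp-mono {H} {G} H⊑G)

    supp-⊂ : ∀ {G H} → G ⊏ H → supp G ⊂ supp H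
    supp-⊂ {G} {H} (G⊑H , i , Hi≈0 , Gi≉0) with search (⊆-or-gap (supp H) (supp G))
    ... | inj₁ H⊆G = contradiction (supp-cancel {H} {G} (H⊆G _) i Hi≈0) Gi≉0
    ... | inj₂ j   = supp-mono {G} {H} G⊑H , j

    ⊂⇒⊏ : ∀ {G H} → supp G ⊂ supp H → G ⊏ H
    ⊂⇒⊏ {G} {H} (G⊆H , j , j∈H , j∉G) with ⊑⇒⊏⊎⊒ {G = G} {H} (supp-cancel {G} {H} G⊆H)
    ... | inj₁ G⊏H = G⊏H
    ... | inj₂ H⊑G = contradiction (supp-mono {H} {G} H⊑G j∈H) j∉G

    -- `step` offers a face `K` whose Gale rank is one above that of `G`. A face strictly between
    -- would force the rank up by two, so `K` covers `G` and its dimension is larger by one. Both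
    -- ranks thus rise together up to `H`.
    rank-climb : ∀ {G H} → Acc ℕ._<_ (∣ supp H ∣ ∸ ∣ supp G ∣) → G ⊑ H →
                 Rank (Locus G) (rank σ (supp G)) → Rank (Locus H) (rank σ (supp H))
    rank-climb {G} {H} (acc rs) G⊑H rG with ⊑⇒⊏⊎⊒ {G = G} {H} G⊑H
    ... | inj₂ H⊑G = ≡.subst (Rank (Locus H)) (≡.cong (rank σ) (supp-cong {G} {H} G⊑H H⊑G))
                       (rank-resp (⊑⇒locus-⊆ {G = G} {H} G⊑H) (⊑⇒locus-⊆ {G = H} {G} H⊑G) rG)
    ... | inj₁ G⊏H with step σ (supp-gale G) (supp-gale H) (supp-⊂ {G} {H} G⊏H)
    ...   | A , gA , G⊂A , A⊆H , rA with supp-onto A gA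
    ...     | K , ≡.refl with cover-or-between {G = G} {K} (⊂⇒⊏ {G} {K} G⊂A) rG
    ...       | inj₁ rK = rank-climb {K} {H}
                            (rs (ℕ.∸-monoʳ-< (p⊂q⇒∣p∣<∣q∣ G⊂A) (p⊆q⇒∣p∣≤∣q∣ A⊆H)))
                            (supp-cancel {K} {H} A⊆H) (≡.subst (Rank (Locus K)) (≡.sym rA) rK)
    ...       | inj₂ (L , G⊏L , L⊏K) = contradiction
                  (ℕ.≤-trans (ℕ.s≤s (rank-mono-< σ (supp-gale G) (supp-gale L) (supp-⊂ {G} {L} G⊏L)))
                             (rank-mono-< σ (supp-gale L) (supp-gale K) (supp-⊂ {L} {K} L⊏K)))
                  (ℕ.<-irrefl (≡.sym rA))

    -- The climb starts at the face coded by the empty set. It lies below every face, in particular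
    -- below `∅-face`, so it is empty and both ranks are 0.
    face-rank : ∀ G → Rank (Locus G) (rank σ (supp G))
    face-rank G with supp-onto ⊥ (gale-⊥ σ)
    ... | B , B≡⊥ = rank-climb {B} {G} (<-wellFounded _) (supp-cancel {B} {G} (B⊆ G)) rB
      where
      B⊆ : ∀ H → supp B ⊆ supp H
      B⊆ H i∈B = contradiction (≡.subst (_ ∈_) B≡⊥ i∈B) ∉⊥
      r≡0 : 0 ≡ rank σ (supp B)
      r≡0 = ≡.sym (ℕ.n≤0⇒n≡0 (ℕ.≤-trans (ℕ.m∸n≤m ∣ supp B ∣ (b2n (meets (pos? ∘ σ) (supp B)))) (ℕ.≤-reflexive (≡.trans (≡.cong ∣_∣ B≡⊥) (∣⊥∣≡0 N)))))
      rB : Rank (Locus B) (rank σ (supp B))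
      rB = ≡.subst (Rank (Locus B)) r≡0
             (rank-empty (λ x x∈B → rank0⇒empty rank-∅ x (⊑⇒locus-⊆ {G = B} {∅-face} (supp-cancel {B} {∅-face} (B⊆ ∅-face)) x x∈B)))

    face-count : ∀ m → f[ m ] P ≡ #ₛ (ofRank σ (suc m))
    face-count m = record
      { to        = λ (G , dG) → index (ofRank σ (suc m)) (supp G) (in-rank G dG)
      ; from      = λ i → from (member (ofRank σ (suc m)) i)
      ; to-cong   = λ { {G , dG} {H , dH} (G⊆H , H⊆G) → index-cong _ (in-rank G dG) (in-rank H dH) (≐⇒≡ {G} {H} (λ _ → G⊆H) (λ _ → H⊆G)) }
      ; from-cong = λ { ≡.refl → id , id }
      ; inverse   = (λ { {i} {G , dG} (G⊆ , ⊆G) → ≡.trans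
                          (index-cong _ (in-rank G dG) (proj₂ (member (ofRank σ (suc m)) i))
                            (≡.trans (≐⇒≡ {G} {proj₁ (onto i)} (λ _ → G⊆) (λ _ → ⊆G)) (proj₂ (onto i))))
                          (index-member (ofRank σ (suc m)) i) })
                  , (λ { {G , dG} ≡.refl → let i = index (ofRank σ (suc m)) (supp G) (in-rank G dG)
                                               eq = ≡.trans (proj₂ (onto i)) (member-index (ofRank σ (suc m)) (supp G) (in-rank G dG))
                                           in (λ {x} → ⊑⇒locus-⊆ {G = proj₁ (onto i)} {G} (supp-cancel {proj₁ (onto i)} {G} (λ x∈ → ≡.subst (_ ∈_) eq x∈)) x)
                                            , (λ {x} → ⊑⇒locus-⊆ {G = G} {proj₁ (onto i)} (supp-cancel {G} {proj₁ (onto i)} (λ x∈ → ≡.subst (_ ∈_) (≡.sym eq) x∈)) x) })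
      }
      where
      in-rank : ∀ G → Dim (Locus G) m → ofRank σ (suc m) (supp G) ≡ true
      in-rank G dG = ofRank⁺ σ {suc m} {supp G} (supp-gale G) (rank-unique (face-rank G) dG)
      onto : ∀ i → ∃[ G ] supp G ≡ proj₁ (member (ofRank σ (suc m)) i)
      onto i = supp-onto _ (proj₁ (ofRank⁻ σ {suc m} {proj₁ (member (ofRank σ (suc m)) i)} (proj₂ (member (ofRank σ (suc m)) i))))
      from : ∃[ A ] ofRank σ (suc m) A ≡ true → Σ[ G ∈ Face P ] Dim (Locus G) m
      from (A , eq) = let (gA , rA) = ofRank⁻ σ {suc m} {A} eq ; (G , G≡A) = supp-onto A gA in
        G , ≡.subst (Rank (Locus G)) (≡.trans (≡.cong (rank σ) G≡A) rA) (face-rank G)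
      ≐⇒≡ : ∀ {G H} → (∀ x → Locus G x → Locus H x) → (∀ x → Locus H x → Locus G x) → supp G ≡ supp H
      ≐⇒≡ {G} {H} G⊆H H⊆G = supp-cong {G} {H} (locus-⊆⇒⊑ {G = G} {H} G⊆H) (locus-⊆⇒⊑ {G = H} {G} H⊆G)

-- From a single relation among walls to a code

module Frames {c ℓ₁ ℓ₂ : Level} (F : OrderedField c ℓ₁ ℓ₂) where

  open OrderedField F hiding (zero)
  open OrderedFieldProperties F
  open Geometry F
  open LinearAlgebra F
  open FaceStructure F
  open Codes F
  open GaleSets
  open SetoidReasoning setoid

  side : Carrier → Side
  side x with compare x 0#
  ... | tri< _ _ _ = neg
  ... | tri≈ _ _ _ = nul
  ... | tri> _ _ _ = pos

  pos⁺ : ∀ {x} → 0# < x → pos? (side x) ≡ true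
  pos⁺ {x} 0<x with compare x 0#
  ... | tri< x<0 _ _ = contradiction (<-trans 0<x x<0) (irrefl refl)
  ... | tri≈ _ x≈0 _ = contradiction (sym x≈0) (<⇒≉ 0<x)
  ... | tri> _ _ _   = ≡.refl

  neg⁺ : ∀ {x} → x < 0# → neg? (side x) ≡ true
  neg⁺ {x} x<0 with compare x 0#
  ... | tri< _ _ _   = ≡.refl
  ... | tri≈ _ x≈0 _ = contradiction x≈0 (<⇒≉ x<0)
  ... | tri> _ _ 0<x = contradiction (<-trans 0<x x<0) (irrefl refl)

  pos⁻ : ∀ {x} → pos? (side x) ≡ true → 0# < x
  pos⁻ {x} eq with compare x 0#
  ... | tri> _ _ 0<x = 0<x

  neg⁻ : ∀ {x} → neg? (side x) ≡ true → x < 0#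
  neg⁻ {x} eq with compare x 0#
  ... | tri< x<0 _ _ = x<0

  support : ∀ {N} → Vector Carrier N → Subset N
  support y = tabulate λ j → not (does (y j ≟ 0#))

  ∈-support⁺ : ∀ {N} (y : Vector Carrier N) {j} → ¬ y j ≈ 0# → j ∈ support y
  ∈-support⁺ y {j} yⱼ≉0 = lookup⇒[]= j _ (≡.trans (lookup∘tabulate _ j) (≡.cong not (dec-false (y j ≟ 0#) yⱼ≉0)))

  ∈-support⁻ : ∀ {N} (y : Vector Carrier N) {j} → j ∈ support y → ¬ y j ≈ 0#
  ∈-support⁻ y {j} j∈ with y j ≟ 0# | ≡.trans (≡.sym (lookup∘tabulate (λ j → not (does (y j ≟ 0#))) j)) ([]=⇒lookup j∈)
  ... | no neq | _ = neq

  ∉-support⁻ : ∀ {N} (y : Vector Carrier N) {j} → j ∉ support y → y j ≈ 0#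
  ∉-support⁻ y {j} j∉ = decidable-stable (y j ≟ 0#) (j∉ ∘ ∈-support⁺ y)

  -- In a vanishing sum a positive term is balanced by a negative one, and with `y` nonnegative the
  -- sign of a nonzero term is that of its coefficient μⱼ.
  support-gale : ∀ {N} (μ y : Vector Carrier N) → (∀ j → 0# ≤ y j) → sum (λ j → μ j * y j) ≈ 0# →
                 Gale (side ∘ μ) (support y)
  support-gale μ y 0≤y ∑≈0 = true-iff there back
    where
    0<y : ∀ {j} → j ∈ support y → 0# < y j
    0<y {j} j∈ = nonneg-split (0≤y j) (∈-support⁻ y j∈)
    y≉0 : ∀ {j} → ¬ μ j * y j ≈ 0# → j ∈ support y
    y≉0 {j} neq = ∈-support⁺ y (neq ∘ y≈0⇒x*y≈0)
    there : meets⁰ (side ∘ μ) (support y) ≡ true → meets¹ (side ∘ μ) (support y) ≡ true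
    there m with meets⁻ _ (support y) m
    ... | i , i∈ , μᵢ with ∑-balance ∑≈0 i (*-pos (pos⁻ μᵢ) (0<y i∈))
    ...   | j , μⱼyⱼ<0 = meets⁺ (y≉0 (<⇒≉ μⱼyⱼ<0)) (neg⁺ (≰-neg μⱼyⱼ<0))
      where
      ≰-neg : μ j * y j < 0# → μ j < 0#
      ≰-neg lt with compare (μ j) 0#
      ... | tri< μⱼ<0 _ _ = μⱼ<0
      ... | tri≈ _ eq _   = contradiction (x≈0⇒x*y≈0 eq) (<⇒≉ lt)
      ... | tri> _ _ 0<μⱼ = contradiction (*-nonneg (inj₁ 0<μⱼ) (0≤y j)) (<⇒≱ lt)
    back : meets¹ (side ∘ μ) (support y) ≡ true → meets⁰ (side ∘ μ) (support y) ≡ true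
    back m with meets⁻ _ (support y) m
    ... | i , i∈ , μᵢ with ∑-balance (trans (∑-neg (λ j → μ j * y j)) (neg-zero ∑≈0)) i (neg-pos (<-respˡ-≈ (*-comm _ _) (pos*neg-neg (0<y i∈) (neg⁻ μᵢ))))
    ...   | j , -μⱼyⱼ<0 = meets⁺ (y≉0 (<⇒≉ -μⱼyⱼ<0 ∘ neg-zero)) (pos⁺ ≰-pos)
      where
      ≰-pos : 0# < μ j
      ≰-pos with compare (μ j) 0#
      ... | tri> _ _ 0<μⱼ = 0<μⱼ
      ... | tri≈ _ eq _   = contradiction (neg-zero (x≈0⇒x*y≈0 eq)) (<⇒≉ -μⱼyⱼ<0)
      ... | tri< μⱼ<0 _ _ = contradiction (≤-respʳ (sym (-‿distribˡ-* _ _)) (*-nonneg (inj₁ (neg-pos μⱼ<0)) (0≤y j))) (<⇒≱ -μⱼyⱼ<0)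

  -- Every valid inequality is a nonnegative combination of the given ones, and
  -- these satisfy a single linear relation on P.
  record Frame {e} (P : Polytope e) (N : ℕ) : Set (c ⊔ ℓ₁ ⊔ ℓ₂) where
    field
      walls     : Fin N → Face P
      μ         : Vector Carrier N
      relation  : ∀ i → sum (λ j → μ j * slack (walls j) i) ≈ 0#
      unique    : ∀ (ν : Vector Carrier N) → (∀ i → sum (λ j → ν j * slack (walls j) i) ≈ 0#) → ∃[ κ ] (∀ j → ν j ≈ κ * μ j)
      generates : ∀ (G : Face P) → Σ[ t ∈ Vector Carrier N ] (∀ j → 0# ≤ t j) × (∀ i → slack G i ≈ sum (λ j → t j * slack (walls j) i))

  module _ {e} {P : Polytope e} {N} (frame : Frame P N) where

    open Frame frame

    private
      χ : Face P → Fin (size P) → Carrier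
      χ G i with slack G i ≟ 0#
      ... | yes _ = 1#
      ... | no  _ = 0#

      χ-nonneg : ∀ G i → 0# ≤ χ G i
      χ-nonneg G i with slack G i ≟ 0#
      ... | yes _ = inj₁ 0<1
      ... | no  _ = ≤-refl

      χ-on : ∀ G i → slack G i ≈ 0# → ¬ χ G i ≈ 0#
      χ-on G i eq with slack G i ≟ 0#
      ... | yes _  = 0≉1 ∘ sym
      ... | no neq = contradiction eq neq

      -- wall values at the sum of the vertices of G
      y : Face P → Vector Carrier N
      y G j = sum (λ i → χ G i * slack (walls j) i)

      terms-nonneg : ∀ G j i → 0# ≤ χ G i * slack (walls j) i
      terms-nonneg G j i = *-nonneg (χ-nonneg G i) (slack-nonneg (walls j) i)

      y≈0⇒⊑ : ∀ G j → y G j ≈ 0# → G ⊑ walls j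
      y≈0⇒⊑ G j eq i Gᵢ≈0 = x*y≈0⇒y≈0 (χ-on G i Gᵢ≈0) (∑-nonneg-zero {t = λ i → χ G i * slack (walls j) i} (terms-nonneg G j) eq i)

      ⊑⇒y≈0 : ∀ G j → G ⊑ walls j → y G j ≈ 0#
      ⊑⇒y≈0 G j G⊑ = ∑-zero vanish
        where
        vanish : ∀ i → χ G i * slack (walls j) i ≈ 0#
        vanish i with slack G i ≟ 0#
        ... | yes eq = y≈0⇒x*y≈0 (G⊑ i eq)
        ... | no  _  = zeroˡ _

      y-relation : ∀ G → sum (λ j → μ j * y G j) ≈ 0#
      y-relation G = begin
        sum (λ j → μ j * sum (λ i → χ G i * slack (walls j) i))  ≈⟨ sum-cong-≋ (λ j → *-distribˡ-sum (μ j) (λ i → χ G i * slack (walls j) i)) ⟩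
        sum (λ j → sum (λ i → μ j * (χ G i * slack (walls j) i)))  ≈⟨ ∑-comm (λ j i → μ j * (χ G i * slack (walls j) i)) ⟩
        sum (λ i → sum (λ j → μ j * (χ G i * slack (walls j) i)))  ≈⟨ ∑-zero (λ i → trans (sum-cong-≋ (λ j → solve 3 (λ a b s → a :* (b :* s) := b :* (a :* s)) refl (μ j) (χ G i) (slack (walls j) i))) (trans (sym (*-distribˡ-sum (χ G i) (λ j → μ j * slack (walls j) i))) (y≈0⇒x*y≈0 (relation i)))) ⟩
        0# ∎

    wall-sum : Vector Carrier N → Point (suc e)
    wall-sum t = combination t (functional ∘ walls)

    wall-sum-value : ∀ t i → wall-sum t ⟨ points P i ⟩ ≈ sum (λ j → t j * slack (walls j) i)
    wall-sum-value t i = combination-· t (functional ∘ walls) (hat (points P i))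

    private
      -- For a Gale set `A` the face is cut out by the sum of the walls outside `A`. What needs
      -- proof is that no wall in `A` contains it. Otherwise a large multiple of its inequality
      -- minus that wall would again be valid, and expanding it by `generates` would produce a
      -- relation of forbidden signs.
      module Onto (A : Subset N) (gA : Gale (side ∘ μ) A) where
        a : Vector Carrier N
        a j with j ∈? A
        ... | yes _ = 0#
        ... | no  _ = 1#
        a-nonneg : ∀ j → 0# ≤ a j
        a-nonneg j with j ∈? A
        ... | yes _ = ≤-refl
        ... | no  _ = inj₁ 0<1
        a-in : ∀ {j} → j ∈ A → a j ≈ 0#
        a-in {j} j∈A with j ∈? A
        ... | yes _  = refl
        ... | no j∉A = contradiction j∈A j∉A
        a-out : ∀ {j} → j ∉ A → ¬ a j ≈ 0#
        a-out {j} j∉A with j ∈? A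
        ... | yes j∈A = contradiction j∈A j∉A
        ... | no _    = 0≉1 ∘ sym
        positive : ∀ i → 0# ≤ wall-sum a ⟨ points P i ⟩
        positive i = ≤-respʳ (sym (wall-sum-value a i)) (∑-nonneg λ j → *-nonneg (a-nonneg j) (slack-nonneg (walls j) i))
        G : Face P
        G = face (wall-sum a) positive
        G-slack : ∀ i → slack G i ≈ sum (λ j → a j * slack (walls j) i)
        G-slack i = trans (face-value (wall-sum a) positive _) (wall-sum-value a i)
        out : ∀ {j} → j ∉ A → G ⊑ walls j
        out {j} j∉A i eq = x*y≈0⇒y≈0 (a-out j∉A)
          (∑-nonneg-zero {t = λ j → a j * slack (walls j) i} (λ j → *-nonneg (a-nonneg j) (slack-nonneg (walls j) i)) (trans (sym (G-slack i)) eq) j)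

        module _ {j} (j∈A : j ∈ A) (G⊑ : G ⊑ walls j) where
          big : ∃[ b ] 0# < b × (∀ i → 0# < slack G i → 0# < b * slack G i + - slack (walls j) i)
          big = dominate (slack G) (λ i → - slack (walls j) i)
          b = proj₁ big
          φ : Point (suc e)
          φ = b ∙ functional G ⊕ (- 1#) ∙ functional (walls j)
          φ-value : ∀ i → φ ⟨ points P i ⟩ ≈ b * slack G i + - slack (walls j) i
          φ-value i = trans (⊕-· b (functional G) (- 1#) (functional (walls j)) (hat (points P i)))
            (+-congˡ (solve 1 (λ x → (:- 1′) :* x := :- x) refl (slack (walls j) i)))
          φ-nonneg : ∀ i → 0# ≤ φ ⟨ points P i ⟩
          φ-nonneg i with slack G i ≟ 0#
          ... | yes eq = inj₂ (sym (trans (φ-value i) (+-zero (y≈0⇒x*y≈0 eq) (neg-zero (G⊑ i eq)))))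
          ... | no neq = inj₁ (<-respʳ-≈ (sym (φ-value i)) (proj₂ (proj₂ big) i (nonneg-split (slack-nonneg G i) neq)))
          t : Vector Carrier N
          t = proj₁ (generates (face φ φ-nonneg))
          0≤t : ∀ k → 0# ≤ t k
          0≤t = proj₁ (proj₂ (generates (face φ φ-nonneg)))
          -- Two expansions of the same functional `φ`, subtracted. On `A` the weights `a` vanish,
          -- so `ν` is nonpositive there and negative at `j`.
          ν : Vector Carrier N
          ν k = b * a k - (δ j k + t k)
          ν-relation : ∀ i → sum (λ k → ν k * slack (walls k) i) ≈ 0#
          ν-relation i = begin
            sum (λ k → (b * a k - (δ j k + t k)) * s k)  ≈⟨ sum-cong-≋ (λ k → solve 5 (λ b a d t s → (b :* a :- (d :+ t)) :* s := b :* (a :* s) :+ (:- (d :* s :+ t :* s))) refl b (a k) (δ j k) (t k) (s k)) ⟩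
            sum (λ k → b * (a k * s k) + - (δ j k * s k + t k * s k))  ≈⟨ ∑-distrib-+ (λ k → b * (a k * s k)) (λ k → - (δ j k * s k + t k * s k)) ⟩
            sum (λ k → b * (a k * s k)) + sum (λ k → - (δ j k * s k + t k * s k))  ≈⟨ +-cong (sym (*-distribˡ-sum b (λ k → a k * s k))) (trans (∑-neg (λ k → δ j k * s k + t k * s k)) (-‿cong (∑-distrib-+ (λ k → δ j k * s k) (λ k → t k * s k)))) ⟩
            b * sum (λ k → a k * s k) - (sum (λ k → δ j k * s k) + sum (λ k → t k * s k))  ≈⟨ +-cong (*-congˡ (sym (G-slack i))) (-‿cong (+-cong (∑-δ j s) (trans (sym (proj₂ (proj₂ (generates (face φ φ-nonneg))) i)) (trans (face-value φ φ-nonneg _) (φ-value i))))) ⟩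
            b * slack G i - (s j + (b * slack G i + - s j))  ≈⟨ solve 2 (λ x y → x :- (y :+ (x :+ (:- y))) := 0′) refl (b * slack G i) (s j) ⟩
            0# ∎
            where
            s : Fin N → Carrier
            s k = slack (walls k) i
          κ = proj₁ (unique ν ν-relation)
          ν≈κμ : ∀ k → ν k ≈ κ * μ k
          ν≈κμ = proj₂ (unique ν ν-relation)
          ν-in : ∀ {k} → k ∈ A → ν k ≈ - (δ j k + t k)
          ν-in k∈A = trans (+-congʳ (y≈0⇒x*y≈0 (a-in k∈A))) (+-identityˡ _)
          0≤-ν : ∀ {k} → k ∈ A → 0# ≤ - ν k
          0≤-ν {k} k∈A = ≤-respʳ (sym (trans (-‿cong (ν-in k∈A)) (-‿involutive _))) (+-nonneg (δ-nonneg j k) (0≤t k))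
          0<-νⱼ : 0# < - ν j
          0<-νⱼ = <-respʳ-≈ (sym (trans (-‿cong (ν-in j∈A)) (-‿involutive _)))
                    (+-pos-nonneg (<-respʳ-≈ (sym (δ-refl j)) 0<1) (0≤t j))
          cross : ∀ k → - ν j * μ k ≈ - ν k * μ j
          cross k = begin
            - ν j * μ k  ≈⟨ *-congʳ (-‿cong (ν≈κμ j)) ⟩
            - (κ * μ j) * μ k  ≈⟨ solve 3 (λ a b c → (:- (a :* b)) :* c := (:- (a :* c)) :* b) refl κ (μ j) (μ k) ⟩
            - (κ * μ k) * μ j  ≈⟨ *-congʳ (-‿cong (ν≈κμ k)) ⟨
            - ν k * μ j ∎
          -- As A meets both sides or neither, a relation that is nonpositive on A cannot be negative at j.
          absurd : ∀ {x} {X : Set x} → X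
          absurd with compare (μ j) 0#
          ... | tri≈ _ eq _ = contradiction (trans (-‿cong (trans (ν≈κμ j) (y≈0⇒x*y≈0 eq))) -0≈0) (<⇒≉ 0<-νⱼ ∘ sym)
          ... | tri> _ _ 0<μⱼ with meets⁻ _ A (≡.trans (≡.sym gA) (meets⁺ j∈A (pos⁺ 0<μⱼ)))
          ...   | k , k∈A , μₖ = contradiction (*-nonneg (0≤-ν k∈A) (inj₁ 0<μⱼ))
                    (<⇒≱ (<-respˡ-≈ (cross k) (pos*neg-neg 0<-νⱼ (neg⁻ μₖ))))
          absurd | tri< μⱼ<0 _ _ with meets⁻ _ A (≡.trans gA (meets⁺ j∈A (neg⁺ μⱼ<0)))
          ...   | k , k∈A , μₖ = contradiction
                    (≤-respʳ (sym (-‿distribʳ-* _ _)) (*-nonneg (0≤-ν k∈A) (inj₁ (neg-pos μⱼ<0))))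
                    (<⇒≱ (pos-neg (<-respʳ-≈ (cross k) (*-pos 0<-νⱼ (pos⁻ μₖ)))))

        supp≡ : support (y G) ≡ A
        supp≡ = ⊆-antisym
          (λ {j} j∈ → decidable-stable (j ∈? A) λ j∉A → ∈-support⁻ (y G) j∈ (⊑⇒y≈0 G j (out j∉A)))
          (λ {j} j∈A → ∈-support⁺ (y G) λ eq → absurd j∈A (y≈0⇒⊑ G j eq))

    frame⇒code : Code P (side ∘ μ)
    frame⇒code = record
      { supp        = λ G → support (y G)
      ; supp-gale   = λ G → support-gale μ (y G) (λ j → ∑-nonneg (terms-nonneg G j)) (y-relation G)
      ; supp-mono   = λ {G} {H} G⊑H {j} j∈ → ∈-support⁺ (y H) λ eq →
                        ∈-support⁻ (y G) j∈ (⊑⇒y≈0 G j (⊑-trans {G = G} {H} {walls j} G⊑H (y≈0⇒⊑ H j eq)))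
      ; supp-cancel = λ {G} {H} → cancel {G} {H}
      ; supp-onto   = λ A gA → Onto.G A gA , Onto.supp≡ A gA
      }
      where
      -- By `generates`, `H` is cut out by the walls with nonzero coefficient, and each of these
      -- contains `H`. The hypothesis says that they contain `G` as well.
      cancel : ∀ {G H} → support (y G) ⊆ support (y H) → G ⊑ H
      cancel {G} {H} G⊆H i Gᵢ≈0 with generates H
      ... | t , 0≤t , eq = trans (eq i) (∑-zero vanish)
        where
        vanish : ∀ j → t j * slack (walls j) i ≈ 0#
        vanish j with t j ≟ 0#
        ... | yes tⱼ≈0 = x≈0⇒x*y≈0 tⱼ≈0
        ... | no  tⱼ≉0 = y≈0⇒x*y≈0 (y≈0⇒⊑ G j (∉-support⁻ (y G) (j∉H ∘ G⊆H)) i Gᵢ≈0)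
          where
          H⊑wall : H ⊑ walls j
          H⊑wall k Hₖ≈0 = x*y≈0⇒y≈0 tⱼ≉0
            (∑-nonneg-zero {t = λ l → t l * slack (walls l) k} (λ l → *-nonneg (0≤t l) (slack-nonneg (walls l) k)) (trans (sym (eq k)) Hₖ≈0) j)
          j∉H : j ∉ support (y H)
          j∉H j∈ = ∈-support⁻ (y H) j∈ (⊑⇒y≈0 H j H⊑wall)

-- Polytopes with two more facets than their dimension

module FacetFrames {c ℓ₁ ℓ₂ : Level} (F : OrderedField c ℓ₁ ℓ₂) where

  open OrderedField F hiding (zero)
  open OrderedFieldProperties F
  open Geometry F
  open LinearAlgebra F
  open FaceStructure F
  open Frames F
  open SetoidReasoning setoid

  module _ {e} {P : Polytope e} where

    body⊆⊤ : ∀ x → Body P x → Locus (⊤-face {P = P}) x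
    body⊆⊤ x x∈P = ≈0⇒locus {P = P} ⊤-face x∈P (⊤-face-value {P = P} x)

    body-in-span : ∀ {x} → Body P x → Span (hat ∘ points P) (hat x)
    body-in-span (t , _ , ∑t≈1 , eq) = aff⇒span {V = points P} (t , ∑t≈1 , eq)

    ⊏⊤⊎⊤⊑ : ∀ (G : Face P) → G ⊏ ⊤-face ⊎ (∀ i → slack G i ≈ 0#)
    ⊏⊤⊎⊤⊑ G with ⊑⇒⊏⊎⊒ {G = G} {⊤-face} (λ i _ → ⊤-face-value {P = P} (points P i))
    ... | inj₁ G⊏⊤ = inj₁ G⊏⊤
    ... | inj₂ ⊤⊑G = inj₂ λ i → ⊤⊑G i (⊤-face-value {P = P} (points P i))

  module _ {e} {P : Polytope e} {d} (dim : P is suc d -dimensional) {n} (facets : f[ d ] P ≡ n) where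

    private
      rank-⊤ : Rank (Locus (⊤-face {P = P})) (suc (suc d))
      rank-⊤ = rank-resp body⊆⊤ (λ _ → proj₁) dim

    -- The last cover below the whole polytope starts at a face of rank one less, which is a facet.
    facet-above : ∀ {G : Face P} → G ⊏ ⊤-face → ∃[ H ] G ⊑ H × Dim (Locus H) d
    facet-above {G} G⊏⊤ with cover-below {G = G} {⊤-face} G⊏⊤ (proj₂ (has-rank G))
    ... | H , l , G⊑H , _ , rH , r⊤ = H , G⊑H , ≡.subst (Rank (Locus H)) (ℕ.suc-injective (rank-unique r⊤ rank-⊤)) rH

    facet : Fin n → Face P
    facet j = proj₁ (Inverse.from facets j)

    facet-index : ∀ {G} → Dim (Locus G) d → ∃[ j ] G ⊑ facet j
    facet-index {G} dG = j , locus-⊆⇒⊑ {G = G} {facet j} (λ x → proj₂ G≐ {x})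
      where
      j = Inverse.to facets (G , dG)
      G≐ = Inverse.inverseʳ facets {G , dG} {j} ≡.refl

    facet-proper : ∀ j → ∃[ i ] 0# < slack (facet j) i
    facet-proper j with ⊏⊤⊎⊤⊑ (facet j)
    ... | inj₁ (_ , i , _ , neq) = i , nonneg-split (slack-nonneg (facet j) i) neq
    ... | inj₂ all = contradiction
      (rank-unique (rank-resp {S′ = Locus (⊤-face {P = P})} (⊑⇒locus-⊆ {G = facet j} {⊤-face} (λ i _ → ⊤-face-value {P = P} (points P i)))
                              (⊑⇒locus-⊆ {G = ⊤-face} {facet j} (λ i _ → all i)) (proj₂ (Inverse.from facets j))) rank-⊤)
      (ℕ.<⇒≢ (ℕ.n<1+n _))

    Generated : Face P → Set (c ⊔ ℓ₁ ⊔ ℓ₂)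
    Generated G = Σ[ t ∈ Vector Carrier n ] (∀ j → 0# ≤ t j) × (∀ i → slack G i ≈ sum (λ j → t j * slack (facet j) i))

    -- Subtract from G the largest multiple of the facet that leaves a valid inequality.
    peel : ∀ G j → G ⊑ facet j →
           ∃[ G′ ] G ⊏ G′ × (Generated G′ → Generated G)
    peel G j G⊑w = G′ , G⊏G′ , λ (t′ , 0≤t′ , t′-spec) → regenerate t′ 0≤t′ t′-spec
      where
      w : Fin (size P) → Carrier
      w = slack (facet j)
      test = ratio-test U? (slack G) w (slack-nonneg G) (proj₁ (facet-proper j) , _ , proj₂ (facet-proper j))
      i₂ = proj₁ test
      0<w = proj₁ (proj₂ (proj₂ test))
      φ : Point (suc e)
      φ = w i₂ ∙ functional G ⊕ (- slack G i₂) ∙ functional (facet j)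
      φ-value : ∀ i → φ ⟨ points P i ⟩ ≈ w i₂ * slack G i - slack G i₂ * w i
      φ-value i = trans (⊕-· (w i₂) (functional G) (- slack G i₂) (functional (facet j)) (hat (points P i)))
        (+-congˡ (sym (-‿distribˡ-* _ _)))
      φ-nonneg : ∀ i → 0# ≤ φ ⟨ points P i ⟩
      φ-nonneg i = ≤-respʳ (sym (φ-value i)) (proj₂ (proj₂ (proj₂ test)) i _)
      G′ : Face P
      G′ = face φ φ-nonneg
      G′-value : ∀ i → slack G′ i ≈ w i₂ * slack G i - slack G i₂ * w i
      G′-value i = trans (face-value φ φ-nonneg _) (φ-value i)
      G⊏G′ : G ⊏ G′
      G⊏G′ = (λ i eq → trans (G′-value i) (+-zero (y≈0⇒x*y≈0 eq) (neg-zero (y≈0⇒x*y≈0 (G⊑w i eq)))))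
           , i₂ , trans (G′-value i₂) (trans (+-congˡ (-‿cong (*-comm _ _))) (-‿inverseʳ _))
           , λ eq → <⇒≉ 0<w (sym (G⊑w i₂ eq))
      regenerate : ∀ t′ → (∀ k → 0# ≤ t′ k) → (∀ i → slack G′ i ≈ sum (λ k → t′ k * slack (facet k) i)) → Generated G
      regenerate t′ 0≤t′ t′-spec = t , t-nonneg , λ i → trans (G≈ i) (trans (*-congˡ (+-congʳ (t′-spec i))) (t-spec i))
        where
        t : Vector Carrier n
        t k = inv (w i₂) * (t′ k + slack G i₂ * δ j k)
        t-nonneg : ∀ k → 0# ≤ t k
        t-nonneg k = *-nonneg (inj₁ (inv-pos 0<w)) (+-nonneg (0≤t′ k) (*-nonneg (slack-nonneg G i₂) (δ-nonneg j k)))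
        G≈ : ∀ i → slack G i ≈ inv (w i₂) * (slack G′ i + slack G i₂ * w i)
        G≈ i = begin
          slack G i  ≈⟨ *-identityˡ _ ⟨
          1# * slack G i  ≈⟨ *-congʳ (inv-inverse (<⇒≉ 0<w ∘ sym)) ⟨
          w i₂ * inv (w i₂) * slack G i  ≈⟨ solve 5 (λ w v g a b → w :* v :* g := v :* ((w :* g :- a :* b) :+ a :* b)) refl (w i₂) (inv (w i₂)) (slack G i) (slack G i₂) (w i) ⟩
          inv (w i₂) * ((w i₂ * slack G i - slack G i₂ * w i) + slack G i₂ * w i)  ≈⟨ *-congˡ (+-congʳ (G′-value i)) ⟨
          inv (w i₂) * (slack G′ i + slack G i₂ * w i) ∎
        t-spec : ∀ i → inv (w i₂) * (sum (λ k → t′ k * slack (facet k) i) + slack G i₂ * w i) ≈ sum (λ k → t k * slack (facet k) i)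
        t-spec i = begin
          v * (sum (λ k → t′ k * s k) + a * s j)  ≈⟨ *-congˡ (+-congˡ (*-congˡ (∑-δ j s))) ⟨
          v * (sum (λ k → t′ k * s k) + a * sum (λ k → δ j k * s k))  ≈⟨ *-congˡ (+-congˡ (*-distribˡ-sum a (λ k → δ j k * s k))) ⟩
          v * (sum (λ k → t′ k * s k) + sum (λ k → a * (δ j k * s k)))  ≈⟨ *-congˡ (∑-distrib-+ (λ k → t′ k * s k) (λ k → a * (δ j k * s k))) ⟨
          v * sum (λ k → t′ k * s k + a * (δ j k * s k))  ≈⟨ *-distribˡ-sum v (λ k → t′ k * s k + a * (δ j k * s k)) ⟩
          sum (λ k → v * (t′ k * s k + a * (δ j k * s k)))  ≈⟨ sum-cong-≋ (λ k → solve 5 (λ v t s a d → v :* (t :* s :+ a :* (d :* s)) := v :* (t :+ a :* d) :* s) refl v (t′ k) (s k) a (δ j k)) ⟩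
          sum (λ k → t k * s k) ∎
          where
          v = inv (w i₂)
          a = slack G i₂
          s : Fin n → Carrier
          s k = slack (facet k) i

    -- A proper face lies in a facet, and peeling that facet off puts a further presenting point on
    -- the face. The process stops at an inequality that is tight at every presenting point, where
    -- all coefficients are zero.
    facets-generate : ∀ G → Generated G
    facets-generate G₀ = go G₀ (<-wellFounded _)
      where
      peel-above : ∀ G → ∃[ H ] G ⊑ H × Dim (Locus H) d → ∃[ G′ ] G ⊏ G′ × (Generated G′ → Generated G)
      peel-above G (H , G⊑H , dH) with facet-index {H} dH
      ... | j , H⊑w = peel G j (⊑-trans {G = G} {H} {facet j} G⊑H H⊑w)
      go : ∀ G → Acc ℕ._<_ (size P ∸ ∣ zeros G ∣) → Generated G
      go G (acc rs) = [ by-peeling , trivial ]′ (⊏⊤⊎⊤⊑ G)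
        where
        trivial : (∀ i → slack G i ≈ 0#) → Generated G
        trivial all = (λ _ → 0#) , (λ _ → ≤-refl) , λ i → trans (all i) (sym (∑-zero (λ j → zeroˡ (slack (facet j) i))))
        by-peeling : G ⊏ ⊤-face → Generated G
        by-peeling G⊏⊤ = let (G′ , G⊏G′ , recover) = peel-above G (facet-above {G} G⊏⊤) in
          recover (go G′ (rs (ℕ.∸-monoʳ-< (⊏⇒∣zeros∣< {G = G} {G′} G⊏G′) (∣p∣≤n (zeros G′)))))

    private
      basis : Vector (Point e) (suc (suc d))
      basis = proj₁ dim

      facet-sum : Vector Carrier n → Point (suc e)
      facet-sum t = combination t (functional ∘ facet)

      facet-sum-· : ∀ t x → facet-sum t · x ≈ sum (λ j → t j * (functional (facet j) · x))
      facet-sum-· t = combination-· t (functional ∘ facet)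

    -- Every affine functional is a difference of two valid inequalities, hence a combination of the
    -- facet functionals; where these all vanish, so do the coordinates.
    facets-separate : ∀ x → (∀ j → functional (facet j) · combination x (hat ∘ basis) ≈ 0#) → ∀ l → x l ≈ 0#
    facets-separate x vanish = affInd⇒ind {V = basis} (proj₁ (proj₂ (proj₂ dim))) x λ k →
      trans (sym (∑-δ k u)) (functional-vanishes (δ k))
      where
      u : Point (suc e)
      u = combination x (hat ∘ basis)
      u∈span : Span (hat ∘ points P) u
      u∈span = combination-∈-span {u = hat ∘ points P} x (hat ∘ basis) (λ i → inj₂ (body-in-span (proj₁ (proj₂ dim) i)))
      face-vanishes : ∀ G → functional G · u ≈ 0#
      face-vanishes G = let (t , _ , eq) = facets-generate G in x-y≈0⇒x≈y (begin
        functional G · u - 0#  ≈⟨ +-congˡ (-‿cong (∑-zero λ j → y≈0⇒x*y≈0 {x = t j} (vanish j))) ⟨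
        functional G · u - sum (λ j → t j * (functional (facet j) · u))  ≈⟨ +-congˡ (-‿cong (facet-sum-· t u)) ⟨
        functional G · u - facet-sum t · u  ≈⟨ solve 2 (λ a b → a :- b := 1′ :* a :+ (:- 1′) :* b) refl (functional G · u) (facet-sum t · u) ⟩
        1# * (functional G · u) + - 1# * (facet-sum t · u)  ≈⟨ ⊕-· 1# (functional G) (- 1#) (facet-sum t) u ⟨
        (1# ∙ functional G ⊕ (- 1#) ∙ facet-sum t) · u  ≈⟨ vanishes-on-span {φ = 1# ∙ functional G ⊕ (- 1#) ∙ facet-sum t} {u = hat ∘ points P} (λ i → begin
          (1# ∙ functional G ⊕ (- 1#) ∙ facet-sum t) · hat (points P i)  ≈⟨ ⊕-· 1# (functional G) (- 1#) (facet-sum t) (hat (points P i)) ⟩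
          1# * slack G i + - 1# * (facet-sum t · hat (points P i))  ≈⟨ +-congˡ (*-congˡ (trans (facet-sum-· t (hat (points P i))) (sym (eq i)))) ⟩
          1# * slack G i + - 1# * slack G i  ≈⟨ solve 1 (λ a → 1′ :* a :+ (:- 1′) :* a := 0′) refl (slack G i) ⟩
          0# ∎) u∈span ⟩
        0# ∎)
      functional-vanishes : ∀ φ → φ · u ≈ 0#
      functional-vanishes φ = begin
        φ · u  ≈⟨ solve 3 (λ a b z → a := (1′ :* a :+ b :* z) :- b :* z) refl (φ · u) b (δ zero · u) ⟩
        (1# * (φ · u) + b * (δ zero · u)) - b * (δ zero · u)  ≈⟨ +-cong (trans (sym (⊕-· 1# φ b (δ zero) u)) ψ·u≈0) (neg-zero (y≈0⇒x*y≈0 1·u≈0)) ⟩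
        0# + 0#  ≈⟨ +-identityˡ 0# ⟩
        0# ∎
        where
        upper = strict-upper-bound (λ i → - (φ ⟨ points P i ⟩))
        b = proj₁ upper
        ψ = 1# ∙ φ ⊕ b ∙ δ zero
        ψ-nonneg : ∀ i → 0# ≤ ψ ⟨ points P i ⟩
        ψ-nonneg i = inj₁ (<-respʳ-≈ (begin
          b - - (φ ⟨ points P i ⟩)  ≈⟨ solve 2 (λ b f → b :- (:- f) := 1′ :* f :+ b :* 1′) refl b (φ ⟨ points P i ⟩) ⟩
          1# * (φ ⟨ points P i ⟩) + b * 1#  ≈⟨ +-congˡ (*-congˡ (∑-δ zero (hat (points P i)))) ⟨
          1# * (φ ⟨ points P i ⟩) + b * (δ zero ⟨ points P i ⟩)  ≈⟨ ⊕-· 1# φ b (δ zero) (hat (points P i)) ⟨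
          ψ ⟨ points P i ⟩ ∎) (x<y⇒0<y-x (proj₂ (proj₂ upper) i)))
        same : ∀ (χ : Point (suc e)) (χ-nonneg : ∀ i → 0# ≤ χ ⟨ points P i ⟩) → functional (face χ χ-nonneg) · u ≈ χ · u
        same χ χ-nonneg = ·-cong {φ = functional (face χ χ-nonneg)} {ψ = χ} {x = u} {y = u}
          (λ { zero → refl ; (suc j) → -‿involutive (χ (suc j)) }) (λ _ → refl)
        ψ·u≈0 : ψ · u ≈ 0#
        ψ·u≈0 = trans (sym (same ψ ψ-nonneg)) (face-vanishes (face ψ ψ-nonneg))
        1·u≈0 : δ zero · u ≈ 0#
        1·u≈0 = trans (sym (·-cong {φ = functional (∅-face {P = P})} {ψ = δ zero} {x = u} {y = u}
          (λ { zero → refl ; (suc j) → -‿involutive (δ zero (suc j)) }) (λ _ → refl))) (face-vanishes (∅-face {P = P}))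

    -- The relation is given only at the presenting points; being linear, it passes to their span,
    -- where it can be used at vectors that come from no point of `P`.
    relation-extends : ∀ ν → (∀ i → sum (λ j → ν j * slack (facet j) i) ≈ 0#) →
                       ∀ x → sum (λ j → ν j * (functional (facet j) · combination x (hat ∘ basis))) ≈ 0#
    relation-extends ν rel x = trans (sym (facet-sum-· ν u)) (vanishes-on-span {φ = facet-sum ν} {u = hat ∘ points P}
        (λ i → trans (facet-sum-· ν (hat (points P i))) (rel i))
        (combination-∈-span {u = hat ∘ points P} x (hat ∘ basis) (λ i → inj₂ (body-in-span (proj₁ (proj₂ dim) i)))))
      where
      u : Point (suc e)
      u = combination x (hat ∘ basis)

  module _ {e} {P : Polytope e} {d} (dim : P is suc d -dimensional) (facets : f[ d ] P ≡ (3 ℕ.+ d)) where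

    private
      wall : Fin (3 ℕ.+ d) → Face P
      wall = facet dim facets

      basis : Vector (Point e) (2 ℕ.+ d)
      basis = proj₁ dim

      -- There are d + 2 basis points and d + 3 facets, so the facet functionals satisfy a
      -- nontrivial relation.
      ker = kernel (ℕ.n<1+n (2 ℕ.+ d)) (λ i j → functional (wall j) ⟨ basis i ⟩)

      μ : Vector Carrier (3 ℕ.+ d)
      μ = proj₁ ker

      relation : ∀ i → sum (λ j → μ j * slack (wall j) i) ≈ 0#
      relation i = trans (sym (combination-· μ (functional ∘ wall) (hat (points P i))))
        (vanishes-on-span {φ = combination μ (functional ∘ wall)} {u = hat ∘ basis}
          (λ k → trans (combination-· μ (functional ∘ wall) (hat (basis k)))
                       (trans (sum-cong-≋ (λ j → *-comm (μ j) (functional (wall j) ⟨ basis k ⟩))) (proj₂ (proj₂ ker) k)))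
          (aff⇒span {V = basis} (proj₂ (proj₂ (proj₂ dim)) _ (vertex∈body {P = P} i))))

      -- Two independent relations would leave d + 1 facet functionals for d + 2 basis points.
      module _ (ν : Vector Carrier (3 ℕ.+ d)) (rel : ∀ i → sum (λ j → ν j * slack (wall j) i) ≈ 0#)
               {p q} (μₚ≉0 : ¬ μ p ≈ 0#) (νₚ≈0 : ν p ≈ 0#) (νq≉0 : ¬ ν q ≈ 0#) where

        p≢q : ¬ p ≡ q
        p≢q ≡.refl = νq≉0 νₚ≈0

        remaining : Fin (suc d) → Fin (3 ℕ.+ d)
        remaining r = punchIn p (punchIn (punchOut p≢q) r)

        ker′ = kernel (ℕ.n<1+n (suc d)) (λ r l → functional (wall (remaining r)) ⟨ basis l ⟩)
        x = proj₁ ker′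

        val : Fin (3 ℕ.+ d) → Carrier
        val j = functional (wall j) · combination x (hat ∘ basis)

        cases : ∀ j → p ≡ j ⊎ q ≡ j ⊎ ∃[ r ] remaining r ≡ j
        cases j with p Fin.≟ j
        ... | yes p≡j = inj₁ p≡j
        ... | no  p≢j with punchOut p≢q Fin.≟ punchOut p≢j
        ...   | yes eq = inj₂ (inj₁ (Fin.punchOut-injective p≢q p≢j eq))
        ...   | no neq = inj₂ (inj₂ (punchOut neq , ≡.trans (≡.cong (punchIn p) (Fin.punchIn-punchOut neq)) (Fin.punchIn-punchOut p≢j)))

        val-remaining : ∀ r → val (remaining r) ≈ 0#
        val-remaining r = trans (·-combination (functional (wall (remaining r))) x (hat ∘ basis))
          (trans (sum-cong-≋ (λ l → *-comm (x l) (functional (wall (remaining r)) ⟨ basis l ⟩))) (proj₂ (proj₂ ker′) r))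

        -- The coefficient of `ν` at `p` is zero and all walls but `p` and `q` vanish, so `ν`
        -- isolates the value at `q`. After that `μ` isolates the one at `p`.
        val-q : val q ≈ 0#
        val-q = x*y≈0⇒y≈0 νq≉0 (trans (sym (∑-single (λ j → ν j * val j) q others)) (relation-extends dim facets ν rel x))
          where
          others : ∀ j → ¬ j ≡ q → ν j * val j ≈ 0#
          others j j≢q with cases j
          ... | inj₁ ≡.refl              = x≈0⇒x*y≈0 νₚ≈0
          ... | inj₂ (inj₁ ≡.refl)       = contradiction ≡.refl j≢q
          ... | inj₂ (inj₂ (r , ≡.refl)) = y≈0⇒x*y≈0 (val-remaining r)

        val-p : val p ≈ 0#
        val-p = x*y≈0⇒y≈0 μₚ≉0 (trans (sym (∑-single (λ j → μ j * val j) p others)) (relation-extends dim facets μ relation x))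
          where
          others : ∀ j → ¬ j ≡ p → μ j * val j ≈ 0#
          others j j≢p with cases j
          ... | inj₁ ≡.refl              = contradiction ≡.refl j≢p
          ... | inj₂ (inj₁ ≡.refl)       = y≈0⇒x*y≈0 val-q
          ... | inj₂ (inj₂ (r , ≡.refl)) = y≈0⇒x*y≈0 (val-remaining r)

        val-zero : ∀ j → val j ≈ 0#
        val-zero j with cases j
        ... | inj₁ ≡.refl              = val-p
        ... | inj₂ (inj₁ ≡.refl)       = val-q
        ... | inj₂ (inj₂ (r , ≡.refl)) = val-remaining r

        absurd : ∀ {a} {X : Set a} → X
        absurd = contradiction (facets-separate dim facets x val-zero _) (proj₂ (proj₁ (proj₂ ker′)))

    facet-frame : Frame P (3 ℕ.+ d)
    facet-frame = record
      { walls     = wall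
      ; μ         = μ
      ; relation  = relation
      ; unique    = unique
      ; generates = facets-generate dim facets
      }
      where
      p    = proj₁ (proj₁ (proj₂ ker))
      μₚ≉0 = proj₂ (proj₁ (proj₂ ker))
      unique : ∀ ν → (∀ i → sum (λ j → ν j * slack (wall j) i) ≈ 0#) → ∃[ κ ] (∀ j → ν j ≈ κ * μ j)
      unique ν rel = κ , λ j → x-y≈0⇒x≈y (decidable-stable (ν′ j ≟ 0#) λ ν′ⱼ≉0 → absurd ν′ rel′ μₚ≉0 ν′ₚ≈0 ν′ⱼ≉0)
        where
        -- This multiple of `μ` cancels `ν` at an index where `μ` is nonzero; a nonzero difference
        -- would be a second, independent relation.
        κ = ν p * inv (μ p)
        ν′ : Vector Carrier (3 ℕ.+ d)
        ν′ j = ν j - κ * μ j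
        ν′ₚ≈0 : ν′ p ≈ 0#
        ν′ₚ≈0 = begin
          ν p - ν p * inv (μ p) * μ p  ≈⟨ solve 3 (λ n v m → n :- n :* v :* m := n :- n :* (m :* v)) refl (ν p) (inv (μ p)) (μ p) ⟩
          ν p - ν p * (μ p * inv (μ p))  ≈⟨ +-congˡ (-‿cong (trans (*-congˡ (inv-inverse μₚ≉0)) (*-identityʳ _))) ⟩
          ν p - ν p  ≈⟨ -‿inverseʳ _ ⟩
          0# ∎
        rel′ : ∀ i → sum (λ j → ν′ j * slack (wall j) i) ≈ 0#
        rel′ i = begin
          sum (λ j → ν′ j * s j)  ≈⟨ sum-cong-≋ (λ j → solve 4 (λ n k m s → (n :- k :* m) :* s := n :* s :+ (:- k) :* (m :* s)) refl (ν j) κ (μ j) (s j)) ⟩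
          sum (λ j → ν j * s j + - κ * (μ j * s j))  ≈⟨ ∑-distrib-+ (λ j → ν j * s j) (λ j → - κ * (μ j * s j)) ⟩
          sum (λ j → ν j * s j) + sum (λ j → - κ * (μ j * s j))  ≈⟨ +-zero (rel i) (trans (sym (*-distribˡ-sum (- κ) (λ j → μ j * s j))) (y≈0⇒x*y≈0 (relation i))) ⟩
          0# ∎
          where
          s : Fin (3 ℕ.+ d) → Carrier
          s j = slack (wall j) i

-- Gale duality for polytopes with one affine dependency

module GaleDuality {c ℓ₁ ℓ₂ : Level} (F : OrderedField c ℓ₁ ℓ₂) where

  open OrderedField F hiding (zero)
  open OrderedFieldProperties F
  open Geometry F
  open LinearAlgebra F
  open FaceStructure F
  open Codes F
  open Frames F
  open GaleSets
  open SetoidReasoning setoid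

  side-zero : side 0# ≡ nul
  side-zero with compare 0# 0#
  ... | tri< 0<0 _ _ = contradiction 0<0 (irrefl refl)
  ... | tri≈ _ _ _   = ≡.refl
  ... | tri> _ _ 0<0 = contradiction 0<0 (irrefl refl)

  side-pos : ∀ {x} → 0# < x → side x ≡ pos
  side-pos {x} 0<x with side x | pos⁺ 0<x
  ... | pos | _ = ≡.refl

  side-neg : ∀ {x} → x < 0# → side x ≡ neg
  side-neg {x} x<0 with side x | neg⁺ x<0
  ... | neg | _ = ≡.refl

  trichotomy : ∀ x → x < 0# ⊎ x ≈ 0# ⊎ 0# < x
  trichotomy x with compare x 0#
  ... | tri< x<0 _ _ = inj₁ x<0
  ... | tri≈ _ x≈0 _ = inj₂ (inj₁ x≈0)
  ... | tri> _ _ 0<x = inj₂ (inj₂ 0<x)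

  -- ω spans the affine dependencies of the points of T.
  record GaleDual {e} (T : Polytope e) (ω : Vector Carrier (size T)) : Set (c ⊔ ℓ₁) where
    field
      dependency : combination ω (hat ∘ points T) ≋ (λ _ → 0#)
      realise    : (s : Vector Carrier (size T)) → sum (λ i → ω i * s i) ≈ 0# → ∃[ φ ] (∀ i → φ ⟨ points T i ⟩ ≈ s i)

    orthogonal : ∀ φ → sum (λ i → ω i * φ ⟨ points T i ⟩) ≈ 0#
    orthogonal φ = trans (sym (·-combination φ ω (hat ∘ points T))) (·-zero {φ = φ} dependency)

  -- A nonnegative vector orthogonal to `ω` with support exactly `A`. Positive entries get weight
  -- `b`, the absolute negative total of `ω` over `A`, and negative ones get `a`, the positive
  -- total, so the contributions b a and -a b cancel; null entries get weight 1. The Gale condition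
  -- makes `a` and `b` positive whenever they are used.
  module Weights {N} (ω : Vector Carrier N) (A : Subset N) (gA : Gale (side ∘ ω) A) where

    part : (Side → Bool) → Fin N → Carrier
    part κ j with j ∈? A | κ (side (ω j))
    ... | yes _ | true  = 1#
    ... | yes _ | false = 0#
    ... | no  _ | _     = 0#

    part-nonneg : ∀ κ j → 0# ≤ part κ j
    part-nonneg κ j with j ∈? A | κ (side (ω j))
    ... | yes _ | true  = inj₁ 0<1
    ... | yes _ | false = ≤-refl
    ... | no  _ | _     = ≤-refl

    part-in : ∀ κ {j} → j ∈ A → κ (side (ω j)) ≡ true → part κ j ≈ 1#
    part-in κ {j} j∈A eq with j ∈? A | κ (side (ω j))
    ... | yes _  | true = refl
    ... | no j∉A | _    = contradiction j∈A j∉A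

    part-out : ∀ κ {j} → j ∉ A → part κ j ≈ 0#
    part-out κ {j} j∉A with j ∈? A | κ (side (ω j))
    ... | yes j∈A | _ = contradiction j∈A j∉A
    ... | no _    | _ = refl

    part-other : ∀ κ {j} → κ (side (ω j)) ≡ false → part κ j ≈ 0#
    part-other κ {j} eq with j ∈? A | κ (side (ω j))
    ... | yes _ | false = refl
    ... | no _  | _     = refl

    a b : Carrier
    a = sum (λ j → part pos? j * ω j)
    b = sum (λ j → part neg? j * - ω j)

    a-terms : ∀ j → 0# ≤ part pos? j * ω j
    a-terms j = [ (λ eq → *-nonneg (part-nonneg pos? j) (inj₁ (pos⁻ eq)))
                , (λ eq → inj₂ (sym (x≈0⇒x*y≈0 (part-other pos? eq)))) ]′ (true⊎false (pos? (side (ω j))))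

    b-terms : ∀ j → 0# ≤ part neg? j * - ω j
    b-terms j = [ (λ eq → *-nonneg (part-nonneg neg? j) (inj₁ (neg-pos (neg⁻ eq))))
                , (λ eq → inj₂ (sym (x≈0⇒x*y≈0 (part-other neg? eq)))) ]′ (true⊎false (neg? (side (ω j))))

    0<a : meets⁰ (side ∘ ω) A ≡ true → 0# < a
    0<a m = let (j , j∈A , eq) = meets⁻ (pos? ∘ side ∘ ω) A m in
      ∑-pos a-terms j (*-pos (<-respʳ-≈ (sym (part-in pos? j∈A eq)) 0<1) (pos⁻ eq))

    0<b : meets¹ (side ∘ ω) A ≡ true → 0# < b
    0<b m = let (j , j∈A , eq) = meets⁻ (neg? ∘ side ∘ ω) A m in
      ∑-pos b-terms j (*-pos (<-respʳ-≈ (sym (part-in neg? j∈A eq)) 0<1) (neg-pos (neg⁻ eq)))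

    nul? : Side → Bool
    nul? = not ∘ nonnul?

    weight : Vector Carrier N
    weight j = b * part pos? j + a * part neg? j + part nul? j

    weight-orthogonal : sum (λ j → ω j * weight j) ≈ 0#
    weight-orthogonal = begin
      sum (λ j → ω j * weight j)  ≈⟨ sum-cong-≋ (λ j → solve 6 (λ w a b p q z → w :* (b :* p :+ a :* q :+ z) := (b :* (p :* w) :+ (:- a) :* (q :* (:- w))) :+ z :* w) refl (ω j) a b (part pos? j) (part neg? j) (part nul? j)) ⟩
      sum (λ j → (b * (part pos? j * ω j) + - a * (part neg? j * - ω j)) + part nul? j * ω j)  ≈⟨ sum-cong-≋ (λ j → trans (+-congˡ (nul-vanish j)) (+-identityʳ _)) ⟩
      sum (λ j → b * (part pos? j * ω j) + - a * (part neg? j * - ω j))  ≈⟨ ∑-distrib-+ (λ j → b * (part pos? j * ω j)) (λ j → - a * (part neg? j * - ω j)) ⟩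
      sum (λ j → b * (part pos? j * ω j)) + sum (λ j → - a * (part neg? j * - ω j))  ≈⟨ +-cong (*-distribˡ-sum b (λ j → part pos? j * ω j)) (*-distribˡ-sum (- a) (λ j → part neg? j * - ω j)) ⟨
      b * a + - a * b  ≈⟨ solve 2 (λ a b → b :* a :+ (:- a) :* b := 0′) refl a b ⟩
      0# ∎
      where
      nul-vanish : ∀ j → part nul? j * ω j ≈ 0#
      nul-vanish j = [ (λ ωⱼ<0 → x≈0⇒x*y≈0 (part-other nul? (≡.cong nul? (side-neg ωⱼ<0))))
                     , [ y≈0⇒x*y≈0 , (λ 0<ωⱼ → x≈0⇒x*y≈0 (part-other nul? (≡.cong nul? (side-pos 0<ωⱼ)))) ]′ ]′ (trichotomy (ω j))

    weight-nonneg : ∀ j → 0# ≤ weight j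
    weight-nonneg j = +-nonneg (+-nonneg (*-nonneg (∑-nonneg b-terms) (part-nonneg pos? j)) (*-nonneg (∑-nonneg a-terms) (part-nonneg neg? j)))
                        (part-nonneg nul? j)

    weight-out : ∀ {j} → j ∉ A → weight j ≈ 0#
    weight-out j∉A = +-zero (+-zero (y≈0⇒x*y≈0 (part-out pos? j∉A)) (y≈0⇒x*y≈0 (part-out neg? j∉A))) (part-out nul? j∉A)

    weight-in : ∀ {j} → j ∈ A → 0# < weight j
    weight-in {j} j∈A = by-side (side (ω j)) ≡.refl
      where
      0≤b = *-nonneg (∑-nonneg b-terms) (part-nonneg pos? j)
      0≤a = *-nonneg (∑-nonneg a-terms) (part-nonneg neg? j)
      by-side : ∀ s → side (ω j) ≡ s → 0# < weight j
      by-side pos eq = +-pos-nonneg (+-pos-nonneg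
        (*-pos (0<b (≡.trans (≡.sym gA) (meets⁺ j∈A (≡.cong pos? eq)))) (<-respʳ-≈ (sym (part-in pos? j∈A (≡.cong pos? eq))) 0<1)) 0≤a) (part-nonneg nul? j)
      by-side neg eq = +-pos-nonneg (+-nonneg-pos 0≤b
        (*-pos (0<a (≡.trans gA (meets⁺ j∈A (≡.cong neg? eq)))) (<-respʳ-≈ (sym (part-in neg? j∈A (≡.cong neg? eq))) 0<1))) (part-nonneg nul? j)
      by-side nul eq = +-nonneg-pos (+-nonneg 0≤b 0≤a) (<-respʳ-≈ (sym (part-in nul? j∈A (≡.cong nul? eq))) 0<1)

  module _ {e} {T : Polytope e} {ω} (gale : GaleDual T ω) where

    open GaleDual gale

    -- The presenting points off the face. Passing to complements reverses inclusion, which is what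
    -- a dual polytope calls for.
    cosupport : Face T → Subset (size T)
    cosupport G = support (slack G)

    cosupport-gale : ∀ G → Gale (side ∘ ω) (cosupport G)
    cosupport-gale G = support-gale ω (slack G) (slack-nonneg G) (orthogonal (functional G))

    cosupport-mono : ∀ {G H : Face T} → H ⊑ G → cosupport G ⊆ cosupport H
    cosupport-mono {G} {H} H⊑G {j} j∈ = ∈-support⁺ (slack H) λ Hⱼ≈0 → ∈-support⁻ (slack G) j∈ (H⊑G j Hⱼ≈0)

    cosupport-cancel : ∀ {G H : Face T} → cosupport G ⊆ cosupport H → H ⊑ G
    cosupport-cancel {G} {H} G⊆H j Hⱼ≈0 = ∉-support⁻ (slack G) λ j∈ → ∈-support⁻ (slack H) (G⊆H j∈) Hⱼ≈0

    cosupport-onto : ∀ A → Gale (side ∘ ω) A → ∃[ G ] cosupport G ≡ A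
    cosupport-onto A gA = G , ⊆-antisym
        (λ {j} j∈ → decidable-stable (j ∈? A) λ j∉A → ∈-support⁻ (slack G) j∈ (trans (G≈ j) (weight-out j∉A)))
        (λ {j} j∈A → ∈-support⁺ (slack G) λ eq → <⇒≉ (weight-in j∈A) (sym (trans (sym (G≈ j)) eq)))
      where
      open Weights ω A gA
      φ = proj₁ (realise weight weight-orthogonal)
      φ≈ = proj₂ (realise weight weight-orthogonal)
      φ-nonneg : ∀ i → 0# ≤ φ ⟨ points T i ⟩
      φ-nonneg i = ≤-respʳ (sym (φ≈ i)) (weight-nonneg i)
      G : Face T
      G = face φ φ-nonneg
      G≈ : ∀ i → slack G i ≈ weight i
      G≈ i = trans (face-value φ φ-nonneg (points T i)) (φ≈ i)

    -- The anti-isomorphism and the cosupport each reverse the order, so together they preserve it.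
    -- The duality is only combinatorial, yet the resulting code also fixes the dimensions of the
    -- faces of `P`.
    dual-code : ∀ {e′} {P : Polytope e′} → IsDual P T → Code P (side ∘ ω)
    dual-code {P = P} (f , iso) = record
      { supp        = cosupport ∘ f
      ; supp-gale   = cosupport-gale ∘ f
      ; supp-mono   = λ {G} {H} G⊑H → cosupport-mono {f G} {f H}
                        (locus-⊆⇒⊑ {G = f H} {f G} (reverse G H (⊑⇒locus-⊆ {G = G} {H} G⊑H)))
      ; supp-cancel = λ {G} {H} G⊆H → locus-⊆⇒⊑ {G = G} {H}
                        (reflect G H (⊑⇒locus-⊆ {G = f H} {f G} (cosupport-cancel {f G} {f H} G⊆H)))
      ; supp-onto   = onto
      }
      where
      module Iso = IsOrderIsomorphism iso
      reverse : ∀ G H → (∀ x → Locus G x → Locus H x) → ∀ x → Locus (f H) x → Locus (f G) x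
      reverse G H G⊆H x = Iso.mono {G} {H} (λ {y} → G⊆H y) {x}
      reflect : ∀ G H → (∀ x → Locus (f H) x → Locus (f G) x) → ∀ x → Locus G x → Locus H x
      reflect G H fH⊆fG x = Iso.cancel {G} {H} (λ {y} → fH⊆fG y) {x}
      hit : ∀ H → ∃[ G ] (∀ x → Locus (f G) x → Locus H x) × (∀ x → Locus H x → Locus (f G) x)
      hit H = let (G , fG≈) = Iso.surjective H ; (fG⊇H , H⊇fG) = fG≈ {G} ((λ {x} x∈ → x∈) , (λ {x} x∈ → x∈)) in
        G , (λ x → fG⊇H {x}) , (λ x → H⊇fG {x})
      onto : ∀ A → Gale (side ∘ ω) A → ∃[ G ] cosupport (f G) ≡ A
      onto A gA = let (H , H≡A) = cosupport-onto A gA ; (G , fG⊆H , H⊆fG) = hit H in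
        G , ≡.trans (⊆-antisym (cosupport-mono {f G} {H} (locus-⊆⇒⊑ {G = H} {f G} H⊆fG))
                               (cosupport-mono {H} {f G} (locus-⊆⇒⊑ {G = f G} {H} fG⊆H))) H≡A

  -- An apex outside the affine hull takes part in no affine dependency; its coefficient is 0, so
  -- each pyramid step adds one null entry and changes nothing else.
  pyramid-gale : ∀ {e r} {B Q : Polytope e} → IteratedPyramid B r Q → ∀ {ω} → GaleDual B ω →
                 ∃[ ω′ ] GaleDual Q ω′ × size Q ≡ r ℕ.+ size B × #₊ (side ∘ ω′) ≡ #₊ (side ∘ ω) × #₋ (side ∘ ω′) ≡ #₋ (side ∘ ω) ×
                         #₀ (side ∘ ω′) ≡ r ℕ.+ #₀ (side ∘ ω)
  pyramid-gale base {ω} g = ω , g , ≡.refl , ≡.refl , ≡.refl , ≡.refl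
  pyramid-gale {e} (cone {Q = Q} pyr apex apex∉) g with pyramid-gale pyr g
  ... | ω , gQ , size≡ , eq₊ , eq₋ , eq₀ =
    0# ∷ ω , record { dependency = dependency′ ; realise = realise′ }
    , ≡.cong suc size≡
    , ≡.trans (≡.cong (λ s → b2n (pos? s) ℕ.+ #₊ (side ∘ ω)) side-zero) eq₊
    , ≡.trans (≡.cong (λ s → b2n (neg? s) ℕ.+ #₋ (side ∘ ω)) side-zero) eq₋
    , ≡.trans (≡.cong (λ s → b2n (not (nonnul? s)) ℕ.+ #₀ (side ∘ ω)) side-zero) (≡.cong suc eq₀)
    where
    open GaleDual gQ
    dependency′ : combination (0# ∷ ω) (hat ∘ (apex ∷ points Q)) ≋ (λ _ → 0#)
    dependency′ j = +-zero (zeroˡ _) (dependency j)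
    realise′ : (s : Vector Carrier (suc (size Q))) → sum (λ i → (0# ∷ ω) i * s i) ≈ 0# →
               ∃[ φ ] (∀ i → φ ⟨ (apex ∷ points Q) i ⟩ ≈ s i)
    realise′ s eq with realise (s ∘ suc) (trans (sym (trans (+-congʳ (zeroˡ _)) (+-identityˡ _))) eq)
                     | fredholm (hat ∘ points Q) (hat apex)
    ... | _      | inj₁ sp = contradiction (span⇒aff {V = points Q} sp) apex∉
    ... | φ , φ≈ | inj₂ (χ , χQ≈0 , χa≈1) = 1# ∙ φ ⊕ t ∙ χ , value
      where
      -- The functional `χ` vanishes on the base and is 1 at the apex, so this multiple corrects the
      -- value at the apex alone.
      t = s zero - φ ⟨ apex ⟩
      value : ∀ i → (1# ∙ φ ⊕ t ∙ χ) ⟨ (apex ∷ points Q) i ⟩ ≈ s i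
      value zero = begin
        (1# ∙ φ ⊕ t ∙ χ) ⟨ apex ⟩  ≈⟨ ⊕-· 1# φ t χ (hat apex) ⟩
        1# * φ ⟨ apex ⟩ + (s zero - φ ⟨ apex ⟩) * χ ⟨ apex ⟩  ≈⟨ +-congˡ (*-congˡ χa≈1) ⟩
        1# * φ ⟨ apex ⟩ + (s zero - φ ⟨ apex ⟩) * 1#  ≈⟨ solve 2 (λ p s → 1′ :* p :+ (s :- p) :* 1′ := s) refl (φ ⟨ apex ⟩) (s zero) ⟩
        s zero ∎
      value (suc i) = begin
        (1# ∙ φ ⊕ t ∙ χ) ⟨ points Q i ⟩  ≈⟨ ⊕-· 1# φ t χ (hat (points Q i)) ⟩
        1# * φ ⟨ points Q i ⟩ + t * χ ⟨ points Q i ⟩  ≈⟨ +-cong (*-identityˡ _) (y≈0⇒x*y≈0 (χQ≈0 i)) ⟩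
        φ ⟨ points Q i ⟩ + 0#  ≈⟨ +-identityʳ _ ⟩
        φ ⟨ points Q i ⟩  ≈⟨ φ≈ i ⟩
        s (suc i) ∎

-- Simplices with one additional point

module Simplices {c ℓ₁ ℓ₂ : Level} (F : OrderedField c ℓ₁ ℓ₂) where

  open OrderedField F hiding (zero)
  open OrderedFieldProperties F
  open Geometry F
  open LinearAlgebra F
  open FaceStructure F
  open Codes F
  open Frames F
  open GaleDuality F
  open SetoidReasoning setoid

  #-≥ : ∀ {a ℓ m n} (S : Setoid a ℓ) → # S ≡ m → # S ≥ n → n ℕ.≤ m
  #-≥ S count inj = Fin.injective⇒≤ {f = Inverse.to count ∘ Injection.to inj} λ {k} {l} eq →
    Injection.injective inj (S.trans (S.sym (Inverse.inverseʳ count ≡.refl)) (Inverse.inverseʳ count eq))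
    where module S = Setoid S

  #-injection : ∀ {a ℓ m n} (S : Setoid a ℓ) → # S ≡ m → n ℕ.≤ m → # S ≥ n
  #-injection S count n≤m = record
    { to        = λ k → Inverse.from count (inject≤ k n≤m)
    ; cong      = λ { ≡.refl → S.refl }
    ; injective = λ {k} {l} eq → Fin.inject≤-injective n≤m n≤m k l
        (≡.trans (≡.sym (Inverse.inverseˡ count S.refl)) (Inverse.inverseˡ count eq))
    }
    where module S = Setoid S

  #-unique : ∀ {a ℓ m n} (S : Setoid a ℓ) → # S ≡ m → # S ≡ n → m ≡ n
  #-unique S count count′ = ℕ.≤-antisym (#-≥ S count′ (#-injection S count ℕ.≤-refl)) (#-≥ S count (#-injection S count′ ℕ.≤-refl))

  independent-punchIn : ∀ {e n} {u : Vector (Point e) (suc n)} → Independent u → ∀ j → Independent (u ∘ punchIn j)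
  independent-punchIn {u = u} ind j t eq k with interpolate {u = u} ind (δ (punchIn j k))
  ... | φ , φu = begin
    t k  ≈⟨ *-identityʳ (t k) ⟨
    t k * 1#  ≈⟨ *-congˡ (trans (φu (punchIn j k)) (δ-refl (punchIn j k))) ⟨
    t k * (φ · u (punchIn j k))  ≈⟨ ∑-single (λ l → t l * (φ · u (punchIn j l))) k (λ l l≢k → y≈0⇒x*y≈0 (trans (φu (punchIn j l)) (δ-≢ (λ p → l≢k (≡.sym (Fin.punchIn-injective j k l p)))))) ⟨
    sum (λ l → t l * (φ · u (punchIn j l)))  ≈⟨ ·-combination φ t (u ∘ punchIn j) ⟨
    φ · combination t (u ∘ punchIn j)  ≈⟨ ·-zero {φ = φ} eq ⟩
    0# ∎

  member-in-span : ∀ {e n} (u : Vector (Point e) n) k → Span u (u k)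
  member-in-span u k = δ k , λ j → ∑-δ k (λ i → u i j)

  module Simplex {e i} (V : Vector (Point e) (suc (suc i))) (ind : AffinelyIndependent V) where

    Δ : Polytope e
    Δ = polytope V

    hat-ind : Independent (hat ∘ V)
    hat-ind = affInd⇒ind {V = V} ind

    private
      φ : Fin (suc (suc i)) → Point (suc e)
      φ j = proj₁ (interpolate {u = hat ∘ V} hat-ind (δ j))
      φ≈ : ∀ j k → φ j ⟨ V k ⟩ ≈ δ j k
      φ≈ j = proj₂ (interpolate {u = hat ∘ V} hat-ind (δ j))
      φ-nonneg : ∀ j k → 0# ≤ φ j ⟨ V k ⟩
      φ-nonneg j k = ≤-respʳ (sym (φ≈ j k)) (δ-nonneg j k)

    -- Its functional is the `j`-th barycentric coordinate.
    opposite : Fin (suc (suc i)) → Face Δ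
    opposite j = face (φ j) (φ-nonneg j)

    opposite-slack : ∀ j k → slack (opposite j) k ≈ δ j k
    opposite-slack j k = trans (face-value {P = Δ} (φ j) (φ-nonneg j) (V k)) (φ≈ j k)

    span-avoiding : ∀ j k → ¬ j ≡ k → Span (hat ∘ V ∘ punchIn j) (hat (V k))
    span-avoiding j k j≢k = ≡.subst (λ l → Span (hat ∘ V ∘ punchIn j) (hat (V l))) (Fin.punchIn-punchOut j≢k)
      (member-in-span (hat ∘ V ∘ punchIn j) (punchOut j≢k))

    opposite-dim : ∀ j → Dim (Locus (opposite j)) i
    opposite-dim j = V ∘ punchIn j
      , (λ k → vertex∈locus (opposite j) (punchIn j k) (trans (opposite-slack j (punchIn j k)) (δ-≢ (Fin.punchInᵢ≢i j k ∘ ≡.sym))))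
      , ind⇒affInd {V = V ∘ punchIn j} (independent-punchIn {u = hat ∘ V} hat-ind j)
      , λ x x∈ → span⇒aff {V = V ∘ punchIn j} (locus-in-span {u = hat ∘ V ∘ punchIn j} (opposite j) spanned x x∈)
      where
      spanned : ∀ k → slack (opposite j) k ≈ 0# → Span (hat ∘ V ∘ punchIn j) (hat (V k))
      spanned k eq = span-avoiding j k λ { ≡.refl → 0≉1 (trans (sym eq) (trans (opposite-slack j j) (δ-refl j))) }

    MissesOne : Face Δ → Set (ℓ₁ ⊔ ℓ₂)
    MissesOne G = ∃[ j ] 0# < slack G j × (∀ k → ¬ k ≡ j → slack G k ≈ 0#)

    -- A facet containing all i + 2 vertices would have the dimension of the simplex; one missing
    -- two would lie in the span of only i of them, too few for dimension i.
    facet-opposite : ∀ G → Dim (Locus G) i → MissesOne G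
    facet-opposite G (B , B∈G , indB , spansB) = [ none , some ]′ (search (λ j → toSum (slack G j ≟ 0#)))
      where
      none : (∀ j → slack G j ≈ 0#) → MissesOne G
      none all = contradiction
        (independent-≤ {u = hat ∘ V} {v = hat ∘ B} hat-ind (λ k → aff⇒span {V = B} (spansB (V k) (vertex∈locus G k (all k)))))
        (ℕ.<⇒≱ (ℕ.n<1+n (suc i)))
      some : ∃[ j ] ¬ slack G j ≈ 0# → MissesOne G
      some (j , Gⱼ≉0) = j , nonneg-split (slack-nonneg G j) Gⱼ≉0 , λ k k≢j → decidable-stable (slack G k ≟ 0#) (two k k≢j)
        where
        two : ∀ k → ¬ k ≡ j → ¬ ¬ slack G k ≈ 0#
        two k k≢j Gₖ≉0 = ℕ.<⇒≱ (ℕ.n<1+n i)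
          (independent-≤ {u = hat ∘ B} {v = w} (affInd⇒ind {V = B} indB) (λ l → locus-in-span {u = w} G spanned (B l) (B∈G l)))
          where
          j≢k : ¬ j ≡ k
          j≢k = k≢j ∘ ≡.sym
          w : Vector (Point (suc e)) i
          w = hat ∘ V ∘ punchIn j ∘ punchIn (punchOut j≢k)
          spanned : ∀ l → slack G l ≈ 0# → Span w (hat (V l))
          spanned l eq = ≡.subst (λ m → Span w (hat (V m)))
              (≡.trans (≡.cong (punchIn j) (Fin.punchIn-punchOut neq)) (Fin.punchIn-punchOut j≢l))
              (member-in-span w (punchOut neq))
            where
            j≢l : ¬ j ≡ l
            j≢l ≡.refl = Gⱼ≉0 eq
            neq : ¬ punchOut j≢k ≡ punchOut j≢l
            neq p with Fin.punchOut-injective j≢k j≢l p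
            ... | ≡.refl = Gₖ≉0 eq

    module _ {x} (t : Vector Carrier (suc (suc i))) (∑t≈1 : sum t ≈ 1#) (comb : combination t V ≋ x) where

      value-at : ∀ (G : Face Δ) → functional G ⟨ x ⟩ ≈ sum (λ k → t k * slack G k)
      value-at G = aff-value (functional G) t V ∑t≈1 comb

      opposite-value : ∀ j → functional (opposite j) ⟨ x ⟩ ≈ t j
      opposite-value j = begin
        functional (opposite j) ⟨ x ⟩  ≈⟨ value-at (opposite j) ⟩
        sum (λ k → t k * slack (opposite j) k)  ≈⟨ sum-cong-≋ (λ k → trans (*-congˡ (opposite-slack j k)) (*-comm (t k) (δ j k))) ⟩
        sum (λ k → δ j k * t k)  ≈⟨ ∑-δ j t ⟩
        t j ∎

      beyond⇒neg : ∀ {G : Face Δ} → Beyond x G → functional G ⟨ x ⟩ < 0#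
      beyond⇒neg {G} o<n = <-respˡ-≈ (sym (functional-value G x))
        (<-respˡ-≈ (solve 2 (λ o n → :- (n :- o) := o :- n) refl (offset G) (normal G · x)) (pos-neg (x<y⇒0<y-x o<n)))

      neg⇒beyond : ∀ {G : Face Δ} → functional G ⟨ x ⟩ < 0# → Beyond x G
      neg⇒beyond {G} lt = 0<y-x⇒x<y (<-respʳ-≈ (solve 2 (λ o n → :- (o :- n) := n :- o) refl (offset G) (normal G · x))
        (neg-pos (<-respˡ-≈ (functional-value G x) lt)))

      pos⇒beneath : ∀ {G : Face Δ} → 0# < functional G ⟨ x ⟩ → Beneath x G
      pos⇒beneath {G} lt = 0<y-x⇒x<y (<-respʳ-≈ (functional-value G x) lt)

      beneath⇒pos : ∀ {G : Face Δ} → Beneath x G → 0# < functional G ⟨ x ⟩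
      beneath⇒pos {G} n<o = <-respʳ-≈ (sym (functional-value G x)) (x<y⇒0<y-x n<o)

      generic⇒sides : (∀ G → Dim (Locus G) i → Beyond x G ⊎ Beneath x G) → ∀ j → t j < 0# ⊎ 0# < t j
      generic⇒sides generic j = [ (λ b → inj₁ (<-respˡ-≈ (opposite-value j) (beyond⇒neg {opposite j} b)))
                                , (λ b → inj₂ (<-respʳ-≈ (opposite-value j) (beneath⇒pos {opposite j} b))) ]′
                                (generic (opposite j) (opposite-dim j))

      module _ (sides : ∀ j → t j < 0# ⊎ 0# < t j) where

        -- The test asks whether `- t j` is positive because these are the entries of the dependency
        -- in `simplex-gale`; the count is then a summand of `#₊` as it stands.
        negative? : Fin (suc (suc i)) → Bool
        negative? j = pos? (side (- t j))

        negative⁻ : ∀ {j} → negative? j ≡ true → t j < 0#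
        negative⁻ {j} eq = <-respˡ-≈ (-‿involutive (t j)) (pos-neg (pos⁻ eq))

        FacetBeyond : Set _
        FacetBeyond = Σ[ G ∈ Face Δ ] Dim (Locus G) i × Beyond x G

        missed : (G : FacetBeyond) → MissesOne (proj₁ G)
        missed (G , dG , _) = facet-opposite G dG

        misses-value : ∀ {G} ((j , _) : MissesOne G) → functional G ⟨ x ⟩ ≈ t j * slack G j
        misses-value {G} (j , _ , others) =
          trans (value-at G) (∑-single (λ k → t k * slack G k) j (λ k k≢j → y≈0⇒x*y≈0 (others k k≢j)))

        misses-generic : ∀ {G} → MissesOne G → Beyond x G ⊎ Beneath x G
        misses-generic {G} m@(j , 0<Gⱼ , _) =
          [ (λ tⱼ<0 → inj₁ (neg⇒beyond {G} (<-respˡ-≈ (trans (*-comm _ _) (sym (misses-value {G} m))) (pos*neg-neg 0<Gⱼ tⱼ<0))))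
          , (λ 0<tⱼ → inj₂ (pos⇒beneath {G} (<-respʳ-≈ (sym (misses-value {G} m)) (*-pos 0<tⱼ 0<Gⱼ)))) ]′ (sides j)

        misses-negative : ∀ {G} → Beyond x G → ((j , _) : MissesOne G) → negative? j ≡ true
        misses-negative {G} beyond m@(j , 0<Gⱼ , _) = pos⁺ (neg-pos tⱼ<0)
          where
          tⱼ<0 : t j < 0#
          tⱼ<0 = [ id , (λ 0<tⱼ → contradiction (<-trans (*-pos 0<tⱼ 0<Gⱼ) (<-respˡ-≈ (misses-value {G} m) (beyond⇒neg {G} beyond))) (irrefl refl)) ]′ (sides j)

        missed-negative : (G : FacetBeyond) → negative? (proj₁ (missed G)) ≡ true
        missed-negative G = misses-negative {proj₁ G} (proj₂ (proj₂ G)) (missed G)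

        same-vertex : ∀ {G H : Face Δ} (mG : MissesOne G) (mH : MissesOne H) → proj₁ mG ≡ proj₁ mH → G ⊑ H
        same-vertex (j , 0<Gⱼ , _) (_ , _ , others) ≡.refl k Gₖ≈0 = others k λ { ≡.refl → <⇒≉ 0<Gⱼ (sym Gₖ≈0) }

        vertex-unique : ∀ {G H : Face Δ} (mG : MissesOne G) (mH : MissesOne H) → H ⊑ G → proj₁ mG ≡ proj₁ mH
        vertex-unique (j , 0<Gⱼ , _) (k , _ , others) H⊑G =
          decidable-stable (j Fin.≟ k) λ j≢k → <⇒≉ 0<Gⱼ (sym (H⊑G j (others j j≢k)))

        opposite-misses : ∀ j → MissesOne (opposite j)
        opposite-misses j = j , <-respʳ-≈ (sym (trans (opposite-slack j j) (δ-refl j))) 0<1 ,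
          λ k k≢j → trans (opposite-slack j k) (δ-≢ (k≢j ∘ ≡.sym))

        slot : FacetBeyond → Fin (tally negative?)
        slot G = position negative? (proj₁ (missed G)) (missed-negative G)

        facet-at : Fin (tally negative?) → FacetBeyond
        facet-at k = let (j , κj) = nth negative? k in
          opposite j , opposite-dim j , neg⇒beyond {opposite j} (<-respˡ-≈ (sym (opposite-value j)) (negative⁻ κj))

        slot-cong : ∀ (G H : FacetBeyond) → proj₁ H ⊑ proj₁ G → slot G ≡ slot H
        slot-cong G H H⊑G = position-cong negative? (missed-negative G) (missed-negative H)
          (vertex-unique {proj₁ G} {proj₁ H} (missed G) (missed H) H⊑G)

        slot-facet-at : ∀ k → slot (facet-at k) ≡ k
        slot-facet-at k = ≡.trans (position-cong negative? (missed-negative (facet-at k)) (proj₂ (nth negative? k))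
          (vertex-unique {opposite j} {opposite j} (missed (facet-at k)) (opposite-misses j) (λ _ eq → eq))) (position-nth negative? k)
          where j = proj₁ (nth negative? k)

        facet-at-slot : ∀ G → (proj₁ (facet-at (slot G)) ⊑ proj₁ G) × (proj₁ G ⊑ proj₁ (facet-at (slot G)))
        facet-at-slot G = same-vertex {opposite j} {proj₁ G} (opposite-misses j) (missed G) j≡
                        , same-vertex {proj₁ G} {opposite j} (missed G) (opposite-misses j) (≡.sym j≡)
          where
          j = proj₁ (nth negative? (slot G))
          j≡ : j ≡ proj₁ (missed G)
          j≡ = nth-position negative? (proj₁ (missed G)) (missed-negative G)

        -- The functional opposite the `j`-th vertex takes the value tⱼ at `x`, so `x` is beyond
        -- that facet exactly when tⱼ is negative, and every facet is opposite some vertex.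
        facets-beyond : # Faces Δ (λ G → Dim (Locus G) i × Beyond x G) ≡ tally negative?
        facets-beyond = record
          { to        = slot
          ; from      = facet-at
          ; to-cong   = λ {G} {H} G≈H → slot-cong G H (⊇ G H G≈H)
          ; from-cong = λ { ≡.refl → id , id }
          ; inverse   = (λ {k} {G} G≈ → ≡.trans (slot-cong G (facet-at k) (⊇ G (facet-at k) G≈)) (slot-facet-at k))
                      , (λ { {G} ≡.refl → (λ {y} → ⊑⇒locus-⊆ {G = proj₁ (facet-at (slot G))} {proj₁ G} (proj₁ (facet-at-slot G)) y)
                                        , (λ {y} → ⊑⇒locus-⊆ {G = proj₁ G} {proj₁ (facet-at (slot G))} (proj₂ (facet-at-slot G)) y) })
          }
          where
          open Setoid (Faces Δ (λ G → Dim (Locus G) i × Beyond x G)) using () renaming (_≈_ to _≈ᶠ_)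
          ⊇ : ∀ G H → G ≈ᶠ H → proj₁ H ⊑ proj₁ G
          ⊇ G H G≈H = locus-⊆⇒⊑ {G = proj₁ H} {proj₁ G} (λ y → proj₂ G≈H {y})

      -- Writing `x` in barycentric coordinates is itself the dependency. It is the only one up to
      -- scaling: on the independent vertices a functional can be prescribed freely, and
      -- orthogonality is what its value at `x` requires.
      simplex-gale : GaleDual (adjoin x Δ) (1# ∷ λ j → - t j)
      simplex-gale = record { dependency = dependency ; realise = realise }
        where
        dependency : combination (1# ∷ λ j → - t j) (hat ∘ (x ∷ V)) ≋ (λ _ → 0#)
        dependency j = begin
          1# * hat x j + sum (λ k → - t k * hat (V k) j)  ≈⟨ +-cong (*-identityˡ _) (trans (sum-cong-≋ (λ k → sym (-‿distribˡ-* (t k) (hat (V k) j)))) (∑-neg (λ k → t k * hat (V k) j))) ⟩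
          hat x j - combination t (hat ∘ V) j  ≈⟨ +-congˡ (-‿cong (proj₂ (aff⇒span {V = V} (t , ∑t≈1 , comb)) j)) ⟩
          hat x j - hat x j  ≈⟨ -‿inverseʳ _ ⟩
          0# ∎
        realise : (s : Vector Carrier (suc (suc (suc i)))) → sum (λ k → (1# ∷ λ j → - t j) k * s k) ≈ 0# →
                  ∃[ φ ] (∀ k → φ ⟨ (x ∷ V) k ⟩ ≈ s k)
        realise s eq = ψ , λ { zero → at-x ; (suc k) → ψV k }
          where
          ψ : Point (suc e)
          ψ = proj₁ (interpolate {u = hat ∘ V} hat-ind (s ∘ suc))
          ψV : ∀ k → ψ ⟨ V k ⟩ ≈ s (suc k)
          ψV = proj₂ (interpolate {u = hat ∘ V} hat-ind (s ∘ suc))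
          at-x : ψ ⟨ x ⟩ ≈ s zero
          at-x = begin
            ψ ⟨ x ⟩  ≈⟨ aff-value ψ t V ∑t≈1 comb ⟩
            sum (λ k → t k * ψ ⟨ V k ⟩)  ≈⟨ sum-cong-≋ (λ k → *-congˡ {t k} (ψV k)) ⟩
            sum (λ k → t k * s (suc k))  ≈⟨ solve 2 (λ a b → b := a :- (1′ :* a :+ (:- b))) refl (s zero) (sum (λ k → t k * s (suc k))) ⟩
            s zero - (1# * s zero - sum (λ k → t k * s (suc k)))  ≈⟨ +-congˡ (-‿cong (+-congˡ (trans (sym (∑-neg (λ k → t k * s (suc k)))) (sum-cong-≋ (λ k → -‿distribˡ-* (t k) (s (suc k))))))) ⟩
            s zero - (1# * s zero + sum (λ k → - t k * s (suc k)))  ≈⟨ +-congˡ (neg-zero eq) ⟩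
            s zero + 0#  ≈⟨ +-identityʳ _ ⟩
            s zero ∎

  -- The point `x` contributes one positive entry, the `m` facets it lies beyond contribute the
  -- others, and genericity excludes null entries.
  isT-gale : ∀ {e i m} {Q : Polytope e} → IsT (suc i) m Q →
             ∃[ ω ] GaleDual Q ω × size Q ≡ 3 ℕ.+ i × #₊ (side ∘ ω) ≡ suc m × #₀ (side ∘ ω) ≡ 0
  isT-gale (isT V x ind (t , ∑t≈1 , comb) count generic) = (1# ∷ λ j → - t j) , simplex-gale t ∑t≈1 comb , ≡.refl , eq₊ , eq₀
    where
    open Simplex V ind
    sides : ∀ j → t j < 0# ⊎ 0# < t j
    sides = generic⇒sides t ∑t≈1 comb generic
    eq₊ : b2n (pos? (side 1#)) ℕ.+ tally (λ j → pos? (side (- t j))) ≡ _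
    eq₊ = ≡.cong₂ ℕ._+_ (≡.cong (b2n ∘ pos?) (side-pos 0<1)) (#-unique _ (facets-beyond t ∑t≈1 comb sides) count)
    eq₀ : b2n (not (nonnul? (side 1#))) ℕ.+ tally (λ j → not (nonnul? (side (- t j)))) ≡ 0
    eq₀ = ≡.cong₂ ℕ._+_ (≡.cong (b2n ∘ not ∘ nonnul?) (side-pos 0<1))
      (tally-none (λ j → not (nonnul? (side (- t j)))) λ j →
        [ (λ tⱼ<0 → ≡.cong (not ∘ nonnul?) (side-pos (neg-pos tⱼ<0)))
        , (λ 0<tⱼ → ≡.cong (not ∘ nonnul?) (side-neg (pos-neg 0<tⱼ))) ]′ (sides j))

-- A polytope realising a given sign vector

module Existence {c ℓ₁ ℓ₂ : Level} (F : OrderedField c ℓ₁ ℓ₂) where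

  open OrderedField F hiding (zero)
  open OrderedFieldProperties F
  open Geometry F
  open LinearAlgebra F
  open FaceStructure F
  open Codes F
  open Frames F
  open GaleDuality F
  open GaleSets using (Gale)
  open SetoidReasoning setoid

  code-cong : ∀ {e N} {P : Polytope e} {σ τ : Fin N → Side} → (∀ j → σ j ≡ τ j) → Code P σ → Code P τ
  code-cong {σ = σ} {τ} σ≗τ code = record
    { supp        = supp
    ; supp-gale   = λ G → there (supp G) (supp-gale G)
    ; supp-mono   = λ {G} {H} → supp-mono {G} {H}
    ; supp-cancel = λ {G} {H} → supp-cancel {G} {H}
    ; supp-onto   = λ A gA → supp-onto A (back A gA)
    }
    where
    open Code code
    there : ∀ A → Gale σ A → Gale τ A
    there A gA = ≡.trans (≡.sym (meets-cong (≡.cong pos? ∘ σ≗τ) A)) (≡.trans gA (meets-cong (≡.cong neg? ∘ σ≗τ) A))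
    back : ∀ A → Gale τ A → Gale σ A
    back A gA = ≡.trans (meets-cong (≡.cong pos? ∘ σ≗τ) A) (≡.trans gA (≡.sym (meets-cong (≡.cong neg? ∘ σ≗τ) A)))

  -- The slice { y ≥ 0 , ∑ μ y = 0 , ∑ ρ y = 1 } of the orthant, with the coordinates p₀ and q₀ projected away.
  module Slice {d} (σ : Fin (2 ℕ.+ d) → Side) (p₀ q₀ : Fin (2 ℕ.+ d)) (σp₀ : σ p₀ ≡ pos) (σq₀ : σ q₀ ≡ neg) where

    N : ℕ
    N = 2 ℕ.+ d

    p₀≢q₀ : ¬ p₀ ≡ q₀
    p₀≢q₀ eq = case ≡.trans (≡.sym σp₀) (≡.trans (≡.cong σ eq) σq₀) of λ ()

    ι : Fin d → Fin N
    ι k = punchIn p₀ (punchIn (punchOut p₀≢q₀) k)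

    sum-split : (f : Vector Carrier N) → sum f ≈ f p₀ + (f q₀ + sum (f ∘ ι))
    sum-split f = trans (sum-remove {i = p₀} f) (+-congˡ (trans (sum-remove {i = punchOut p₀≢q₀} (f ∘ punchIn p₀))
      (+-congʳ (reflexive (≡.cong f (Fin.punchIn-punchOut p₀≢q₀))))))

    data Position : Fin N → Set where
      at-p₀ : Position p₀
      at-q₀ : Position q₀
      other : ∀ k → Position (ι k)

    position? : ∀ j → Position j
    position? j with p₀ Fin.≟ j
    ... | yes ≡.refl = at-p₀
    ... | no  p₀≢j with punchOut p₀≢q₀ Fin.≟ punchOut p₀≢j
    ...   | yes eq = ≡.subst Position (Fin.punchOut-injective p₀≢q₀ p₀≢j eq) at-q₀
    ...   | no neq = ≡.subst Position (≡.trans (≡.cong (punchIn p₀) (Fin.punchIn-punchOut neq)) (Fin.punchIn-punchOut p₀≢j)) (other (punchOut neq))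

    -- Since ρ - ρ′ = μ, both sums equal one on the slice. As ρ vanishes at `q₀` and ρ′ at `p₀`,
    -- they recover the projected coordinates `p₀` and `q₀` respectively.
    μ-of ρ-of ρ′-of : Side → Carrier
    μ-of pos = 1#
    μ-of neg = - 1#
    μ-of nul = 0#
    ρ-of pos = 1#
    ρ-of neg = 0#
    ρ-of nul = 1#
    ρ′-of pos = 0#
    ρ′-of neg = 1#
    ρ′-of nul = 1#

    μ ρ ρ′ : Vector Carrier N
    μ = μ-of ∘ σ
    ρ = ρ-of ∘ σ
    ρ′ = ρ′-of ∘ σ

    side-μ : ∀ j → side (μ j) ≡ σ j
    side-μ j with σ j
    ... | pos = side-pos 0<1
    ... | neg = side-neg (pos-neg 0<1)
    ... | nul = side-zero

    -- The minimal nonempty Gale sets: a positive with a negative element, or a null element alone.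
    -- This is the origin of the count p q + r.
    data Vertex : Set where
      edge : ∀ p q → σ p ≡ pos → σ q ≡ neg → Vertex
      apex : ∀ z → σ z ≡ nul → Vertex

    y : Vertex → Vector Carrier N
    y (edge p q _ _) j = δ p j + δ q j
    y (apex z _)     j = δ z j

    y-nonneg : ∀ a j → 0# ≤ y a j
    y-nonneg (edge p q _ _) j = +-nonneg (δ-nonneg p j) (δ-nonneg q j)
    y-nonneg (apex z _)     j = δ-nonneg z j

    edge-sum : ∀ (f : Vector Carrier N) p q {eqp eqq} → sum (λ j → f j * y (edge p q eqp eqq) j) ≈ f p + f q
    edge-sum f p q = begin
      sum (λ j → f j * (δ p j + δ q j))  ≈⟨ sum-cong-≋ (λ j → solve 3 (λ f a b → f :* (a :+ b) := a :* f :+ b :* f) refl (f j) (δ p j) (δ q j)) ⟩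
      sum (λ j → δ p j * f j + δ q j * f j)  ≈⟨ ∑-distrib-+ (λ j → δ p j * f j) (λ j → δ q j * f j) ⟩
      sum (λ j → δ p j * f j) + sum (λ j → δ q j * f j)  ≈⟨ +-cong (∑-δ p f) (∑-δ q f) ⟩
      f p + f q ∎

    apex-sum : ∀ (f : Vector Carrier N) z {eq} → sum (λ j → f j * y (apex z eq) j) ≈ f z
    apex-sum f z = trans (sum-cong-≋ (λ j → *-comm (f j) (δ z j))) (∑-δ z f)

    μ-sum : ∀ a → sum (λ j → μ j * y a j) ≈ 0#
    μ-sum (edge p q eqp eqq) = trans (edge-sum μ p q {eqp} {eqq})
      (trans (+-cong (reflexive (≡.cong μ-of eqp)) (reflexive (≡.cong μ-of eqq))) (-‿inverseʳ 1#))
    μ-sum (apex z eq) = trans (apex-sum μ z {eq}) (reflexive (≡.cong μ-of eq))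

    ρ-sum : ∀ a → sum (λ j → ρ j * y a j) ≈ 1#
    ρ-sum (edge p q eqp eqq) = trans (edge-sum ρ p q {eqp} {eqq})
      (trans (+-cong (reflexive (≡.cong ρ-of eqp)) (reflexive (≡.cong ρ-of eqq))) (+-identityʳ 1#))
    ρ-sum (apex z eq) = trans (apex-sum ρ z {eq}) (reflexive (≡.cong ρ-of eq))

    ρ′-sum : ∀ a → sum (λ j → ρ′ j * y a j) ≈ 1#
    ρ′-sum (edge p q eqp eqq) = trans (edge-sum ρ′ p q {eqp} {eqq})
      (trans (+-cong (reflexive (≡.cong ρ′-of eqp)) (reflexive (≡.cong ρ′-of eqq))) (+-identityˡ 1#))
    ρ′-sum (apex z eq) = trans (apex-sum ρ′ z {eq}) (reflexive (≡.cong ρ′-of eq))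

    -- Index pairs without a vertex of their own repeat the vertex of p₀ and q₀.
    edgeAt : ∀ i j s s′ → σ i ≡ s → σ j ≡ s′ → Vertex
    edgeAt i j pos neg eqᵢ eqⱼ = edge i j eqᵢ eqⱼ
    edgeAt i j _   _   _   _   = edge p₀ q₀ σp₀ σq₀

    apexAt : ∀ i s → σ i ≡ s → Vertex
    apexAt i nul eq = apex i eq
    apexAt i _   _  = edge p₀ q₀ σp₀ σq₀

    vertexAt : Fin N → Fin (suc N) → Vertex
    vertexAt i zero    = apexAt i (σ i) ≡.refl
    vertexAt i (suc j) = edgeAt i j (σ i) (σ j) ≡.refl ≡.refl

    vertex : Fin (N ℕ.* suc N) → Vertex
    vertex a = uncurry vertexAt (remQuot (suc N) a)

    edge-index : ∀ p q → σ p ≡ pos → σ q ≡ neg → ∃[ a ] ∀ (f : Vector Carrier N) → sum (λ j → f j * y (vertex a) j) ≈ f p + f q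
    edge-index p q eqp eqq = combine p (suc q) , λ f →
        ≡.subst (λ v → sum (λ j → f j * y v j) ≈ f p + f q) (≡.sym (≡.cong (uncurry vertexAt) (Fin.remQuot-combine p (suc q)))) (at f)
      where
      at : ∀ f → sum (λ j → f j * y (vertexAt p (suc q)) j) ≈ f p + f q
      at f = go (σ p) (σ q) ≡.refl ≡.refl eqp eqq
        where
        go : ∀ s s′ (e : σ p ≡ s) (e′ : σ q ≡ s′) → s ≡ pos → s′ ≡ neg → sum (λ j → f j * y (edgeAt p q s s′ e e′) j) ≈ f p + f q
        go pos neg e e′ _ _ = edge-sum f p q {e} {e′}

    apex-index : ∀ z → σ z ≡ nul → ∃[ a ] ∀ (f : Vector Carrier N) → sum (λ j → f j * y (vertex a) j) ≈ f z
    apex-index z eqz = combine z (zero {N}) , λ f →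
        ≡.subst (λ v → sum (λ j → f j * y v j) ≈ f z) (≡.sym (≡.cong (uncurry vertexAt) (Fin.remQuot-combine {n = N} z (zero {N})))) (at f)
      where
      at : ∀ f → sum (λ j → f j * y (vertexAt z zero) j) ≈ f z
      at f = go (σ z) ≡.refl eqz
        where
        go : ∀ s (e : σ z ≡ s) → s ≡ nul → sum (λ j → f j * y (apexAt z s e) j) ≈ f z
        go nul e _ = apex-sum f z {e}

    P : Polytope d
    P = polytope λ a → y (vertex a) ∘ ι

    wall-at : ∀ {j} → Position j → Point (suc d)
    wall-at at-p₀     = 1# ∷ λ k → - ρ (ι k)
    wall-at at-q₀     = 1# ∷ λ k → - ρ′ (ι k)
    wall-at (other k) = δ (suc k)

    complement : ∀ (f w : Vector Carrier N) → sum (λ j → f j * w j) ≈ 1# →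
                 (1# ∷ λ k → - f (ι k)) ⟨ w ∘ ι ⟩ ≈ f p₀ * w p₀ + f q₀ * w q₀
    complement f w eq = begin
      1# * 1# + sum (λ k → - f (ι k) * w (ι k))  ≈⟨ +-cong (trans (*-identityˡ 1#) (sym eq)) (trans (sum-cong-≋ (λ k → sym (-‿distribˡ-* (f (ι k)) (w (ι k))))) (∑-neg (λ k → f (ι k) * w (ι k)))) ⟩
      sum (λ j → f j * w j) - sum (λ k → f (ι k) * w (ι k))  ≈⟨ +-congʳ (sum-split (λ j → f j * w j)) ⟩
      (f p₀ * w p₀ + (f q₀ * w q₀ + S)) - S  ≈⟨ solve 3 (λ a b s → (a :+ (b :+ s)) :- s := a :+ b) refl (f p₀ * w p₀) (f q₀ * w q₀) S ⟩
      f p₀ * w p₀ + f q₀ * w q₀ ∎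
      where S = sum (λ k → f (ι k) * w (ι k))

    wall-value : ∀ {j} (pj : Position j) a → wall-at pj ⟨ points P a ⟩ ≈ y (vertex a) j
    wall-value at-p₀ a = begin
      _  ≈⟨ complement ρ w (ρ-sum (vertex a)) ⟩
      ρ p₀ * w p₀ + ρ q₀ * w q₀  ≈⟨ +-cong (*-congʳ (reflexive (≡.cong ρ-of σp₀))) (*-congʳ (reflexive (≡.cong ρ-of σq₀))) ⟩
      1# * w p₀ + 0# * w q₀  ≈⟨ solve 2 (λ a b → 1′ :* a :+ 0′ :* b := a) refl (w p₀) (w q₀) ⟩
      w p₀ ∎
      where w = y (vertex a)
    wall-value at-q₀ a = begin
      _  ≈⟨ complement ρ′ w (ρ′-sum (vertex a)) ⟩
      ρ′ p₀ * w p₀ + ρ′ q₀ * w q₀  ≈⟨ +-cong (*-congʳ (reflexive (≡.cong ρ′-of σp₀))) (*-congʳ (reflexive (≡.cong ρ′-of σq₀))) ⟩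
      0# * w p₀ + 1# * w q₀  ≈⟨ solve 2 (λ a b → 0′ :* a :+ 1′ :* b := b) refl (w p₀) (w q₀) ⟩
      w q₀ ∎
      where w = y (vertex a)
    wall-value (other k) a = ∑-δ (suc k) (hat (points P a))

    wall-functional : Fin N → Point (suc d)
    wall-functional j = wall-at (position? j)

    wall-nonneg : ∀ j a → 0# ≤ wall-functional j ⟨ points P a ⟩
    wall-nonneg j a = ≤-respʳ (sym (wall-value (position? j) a)) (y-nonneg (vertex a) j)

    wall : Fin N → Face P
    wall j = face (wall-functional j) (wall-nonneg j)

    wall-slack : ∀ j a → slack (wall j) a ≈ y (vertex a) j
    wall-slack j a = trans (face-value {P = P} (wall-functional j) (wall-nonneg j) (points P a)) (wall-value (position? j) a)

    wall-sums : ∀ (f : Vector Carrier N) a → sum (λ j → f j * slack (wall j) a) ≈ sum (λ j → f j * y (vertex a) j)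
    wall-sums f a = sum-cong-≋ λ j → *-congˡ {f j} (wall-slack j a)

    by-side : ∀ {ℓ} {X : Fin N → Set ℓ} → (∀ p → σ p ≡ pos → X p) → (∀ q → σ q ≡ neg → X q) → (∀ z → σ z ≡ nul → X z) → ∀ j → X j
    by-side f g h j with σ j in eq
    ... | pos = f j eq
    ... | neg = g j eq
    ... | nul = h j eq

    -- Evaluation at the vertices gives ν p + ν q = 0 on every mixed pair and ν z = 0 at every null
    -- element; the pairs with `p₀` or `q₀` then fix all values in terms of `ν p₀`.
    unique : ∀ (ν : Vector Carrier N) → (∀ a → sum (λ j → ν j * slack (wall j) a) ≈ 0#) → ∃[ κ ] (∀ j → ν j ≈ κ * μ j)
    unique ν rel = ν p₀ , by-side at-pos at-neg at-nul
      where
      on-edge : ∀ p q → σ p ≡ pos → σ q ≡ neg → ν p + ν q ≈ 0#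
      on-edge p q eqp eqq = let (a , sums) = edge-index p q eqp eqq in
        trans (sym (sums ν)) (trans (sym (wall-sums ν a)) (rel a))
      at-neg : ∀ q → σ q ≡ neg → ν q ≈ ν p₀ * μ q
      at-neg q eqq = begin
        ν q  ≈⟨ solve 2 (λ a b → b := (a :+ b) :+ a :* (:- 1′)) refl (ν p₀) (ν q) ⟩
        (ν p₀ + ν q) + ν p₀ * - 1#  ≈⟨ +-cong (on-edge p₀ q σp₀ eqq) (*-congˡ (reflexive (≡.cong μ-of (≡.sym eqq)))) ⟩
        0# + ν p₀ * μ q  ≈⟨ +-identityˡ _ ⟩
        ν p₀ * μ q ∎
      at-pos : ∀ p → σ p ≡ pos → ν p ≈ ν p₀ * μ p
      at-pos p eqp = begin
        ν p  ≈⟨ solve 3 (λ a b c → b := (b :+ c) :- (a :+ c) :+ a :* 1′) refl (ν p₀) (ν p) (ν q₀) ⟩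
        (ν p + ν q₀) - (ν p₀ + ν q₀) + ν p₀ * 1#  ≈⟨ +-cong (+-zero (on-edge p q₀ eqp σq₀) (neg-zero (on-edge p₀ q₀ σp₀ σq₀))) (*-congˡ (reflexive (≡.cong μ-of (≡.sym eqp)))) ⟩
        0# + ν p₀ * μ p  ≈⟨ +-identityˡ _ ⟩
        ν p₀ * μ p ∎
      at-nul : ∀ z → σ z ≡ nul → ν z ≈ ν p₀ * μ z
      at-nul z eqz = let (a , sums) = apex-index z eqz in
        trans (trans (sym (sums ν)) (trans (sym (wall-sums ν a)) (rel a))) (sym (y≈0⇒x*y≈0 (reflexive (≡.cong μ-of eqz))))

    -- γ expresses a functional through the wall values; adding its minimum over the negative
    -- side times μ makes all coefficients nonnegative without changing the functional.
    generates : ∀ (G : Face P) → Σ[ t ∈ Vector Carrier N ] (∀ j → 0# ≤ t j) × (∀ a → slack G a ≈ sum (λ j → t j * slack (wall j) a))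
    generates G = t , by-side t-pos t-neg t-nul , λ a → trans (slack-γ a) (trans (shift a) (sym (wall-sums t a)))
      where
      g = functional G
      γ : Vector Carrier N
      γ j = g zero * ρ j + sum (λ k → g (suc k) * δ (ι k) j)
      slack-γ : ∀ a → slack G a ≈ sum (λ j → γ j * y (vertex a) j)
      slack-γ a = sym (begin
        sum (λ j → γ j * w j)  ≈⟨ sum-cong-≋ (λ j → trans (distribʳ (w j) _ _) (+-cong (*-assoc (g zero) (ρ j) (w j)) (*-distribʳ-sum (w j) (λ k → g (suc k) * δ (ι k) j)))) ⟩
        sum (λ j → g zero * (ρ j * w j) + sum (λ k → g (suc k) * δ (ι k) j * w j))  ≈⟨ ∑-distrib-+ (λ j → g zero * (ρ j * w j)) (λ j → sum (λ k → g (suc k) * δ (ι k) j * w j)) ⟩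
        sum (λ j → g zero * (ρ j * w j)) + sum (λ j → sum (λ k → g (suc k) * δ (ι k) j * w j))  ≈⟨ +-cong (trans (sym (*-distribˡ-sum (g zero) (λ j → ρ j * w j))) (*-congˡ (ρ-sum (vertex a)))) (∑-comm (λ j k → g (suc k) * δ (ι k) j * w j)) ⟩
        g zero * 1# + sum (λ k → sum (λ j → g (suc k) * δ (ι k) j * w j))  ≈⟨ +-congˡ (sum-cong-≋ (λ k → trans (sum-cong-≋ (λ j → *-assoc (g (suc k)) (δ (ι k) j) (w j))) (trans (sym (*-distribˡ-sum (g (suc k)) (λ j → δ (ι k) j * w j))) (*-congˡ (∑-δ (ι k) w))))) ⟩
        g zero * 1# + sum (λ k → g (suc k) * w (ι k)) ∎)
        where w = y (vertex a)
      is-neg? : ∀ j → Dec (σ j ≡ neg)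
      is-neg? j with σ j
      ... | pos = no λ ()
      ... | neg = yes ≡.refl
      ... | nul = no λ ()
      least = argmin is-neg? γ (q₀ , σq₀)
      q* = proj₁ least
      σq* = proj₁ (proj₂ least)
      t : Vector Carrier N
      t j = γ j + γ q* * μ j
      shift : ∀ a → sum (λ j → γ j * y (vertex a) j) ≈ sum (λ j → t j * y (vertex a) j)
      shift a = sym (begin
        sum (λ j → t j * w j)  ≈⟨ sum-cong-≋ (λ j → solve 4 (λ g m u w → (g :+ m :* u) :* w := g :* w :+ m :* (u :* w)) refl (γ j) (γ q*) (μ j) (w j)) ⟩
        sum (λ j → γ j * w j + γ q* * (μ j * w j))  ≈⟨ ∑-distrib-+ (λ j → γ j * w j) (λ j → γ q* * (μ j * w j)) ⟩
        sum (λ j → γ j * w j) + sum (λ j → γ q* * (μ j * w j))  ≈⟨ +-congˡ (trans (sym (*-distribˡ-sum (γ q*) (λ j → μ j * w j))) (y≈0⇒x*y≈0 (μ-sum (vertex a)))) ⟩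
        sum (λ j → γ j * w j) + 0#  ≈⟨ +-identityʳ _ ⟩
        sum (λ j → γ j * w j) ∎)
        where w = y (vertex a)
      -- At a positive index the coefficient is γ p + γ q*, the slack of `G` at the vertex of p and
      -- q*; at a null index it is again the slack at a vertex. Only the negative side relies on the
      -- choice of the minimum.
      t-pos : ∀ p → σ p ≡ pos → 0# ≤ t p
      t-pos p eqp = let (a , sums) = edge-index p q* eqp σq* in
        ≤-respʳ (trans (trans (slack-γ a) (sums γ)) (+-congˡ (trans (sym (*-identityʳ _)) (*-congˡ (reflexive (≡.cong μ-of (≡.sym eqp))))))) (slack-nonneg G a)
      t-neg : ∀ q → σ q ≡ neg → 0# ≤ t q
      t-neg q eqq = ≤-respʳ (+-congˡ (trans (solve 1 (λ m → :- m := m :* (:- 1′)) refl (γ q*)) (*-congˡ (reflexive (≡.cong μ-of (≡.sym eqq))))))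
        (x≤y⇒0≤y-x (proj₂ (proj₂ least) q eqq))
      t-nul : ∀ z → σ z ≡ nul → 0# ≤ t z
      t-nul z eqz = let (a , sums) = apex-index z eqz in
        ≤-respʳ (trans (trans (slack-γ a) (sums γ)) (trans (sym (+-identityʳ _)) (+-congˡ (sym (y≈0⇒x*y≈0 (reflexive (≡.cong μ-of eqz))))))) (slack-nonneg G a)

    code : Code P σ
    code = code-cong side-μ (frame⇒code record
      { walls     = wall
      ; μ         = μ
      ; relation  = λ a → trans (wall-sums μ a) (μ-sum (vertex a))
      ; unique    = unique
      ; generates = generates
      })

  -- The supports of the faces of `P` and the cosupports of the faces of `T` run through the same
  -- Gale sets; matching equal sets reverses inclusion.
  code⇒dual : ∀ {e e′} {T : Polytope e} {P : Polytope e′} {ω} → GaleDual T ω → Code P (side ∘ ω) → IsDual P T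
  code⇒dual {T = T} {P} {ω} gale code = f , record
    { isOrderMonomorphism = record
      { isOrderHomomorphism = record
        { cong = λ {G} {H} (G⊆H , H⊆G) → (λ {x} → mono H G (λ y → H⊆G {y}) x) , (λ {x} → mono G H (λ y → G⊆H {y}) x)
        ; mono = λ {G} {H} G⊆H {x} → mono G H (λ y → G⊆H {y}) x
        }
      ; injective = λ {G} {H} (fG⊇ , ⊇fG) → (λ {x} → cancel G H (λ y → ⊇fG {y}) x) , (λ {x} → cancel H G (λ y → fG⊇ {y}) x)
      ; cancel    = λ {G} {H} fH⊆fG {x} → cancel G H (λ y → fH⊆fG {y}) x
      }
    ; surjective = λ H → let (G , eq) = hit H in G , λ {K} (K⊆G , G⊆K) →
        let (⊆H , H⊆) = same H K (≡.trans (supp-cong {K} {G} (locus-⊆⇒⊑ {G = K} {G} (λ x → K⊆G {x})) (locus-⊆⇒⊑ {G = G} {K} (λ x → G⊆K {x}))) eq)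
        in (λ {x} → ⊆H x) , (λ {x} → H⊆ x)
    }
    where
    open Code code
    preimage : ∀ G → ∃[ H ] cosupport gale H ≡ supp G
    preimage G = cosupport-onto gale (supp G) (supp-gale G)
    f : Face P → Face T
    f G = proj₁ (preimage G)
    f-supp : ∀ G → cosupport gale (f G) ≡ supp G
    f-supp G = proj₂ (preimage G)
    mono : ∀ G H → (∀ x → Locus G x → Locus H x) → ∀ x → Locus (f H) x → Locus (f G) x
    mono G H G⊆H = ⊑⇒locus-⊆ {G = f H} {f G} (cosupport-cancel gale {f G} {f H}
      (≡.subst₂ _⊆_ (≡.sym (f-supp G)) (≡.sym (f-supp H)) (supp-mono {G} {H} (locus-⊆⇒⊑ {G = G} {H} G⊆H))))
    cancel : ∀ G H → (∀ x → Locus (f H) x → Locus (f G) x) → ∀ x → Locus G x → Locus H x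
    cancel G H fH⊆fG = ⊑⇒locus-⊆ {G = G} {H} (supp-cancel {G} {H}
      (≡.subst₂ _⊆_ (f-supp G) (f-supp H) (cosupport-mono gale {f G} {f H} (locus-⊆⇒⊑ {G = f H} {f G} fH⊆fG))))
    hit : ∀ H → ∃[ G ] supp G ≡ cosupport gale H
    hit H = supp-onto (cosupport gale H) (cosupport-gale gale H)
    same : ∀ H K → supp K ≡ cosupport gale H → (∀ x → Locus (f K) x → Locus H x) × (∀ x → Locus H x → Locus (f K) x)
    same H K eq =
      ⊑⇒locus-⊆ {G = f K} {H} (cosupport-cancel gale {H} {f K} (λ x∈ → ≡.subst (_ ∈_) (≡.sym (≡.trans (f-supp K) eq)) x∈)) ,
      ⊑⇒locus-⊆ {G = H} {f K} (cosupport-cancel gale {f K} {H} (λ x∈ → ≡.subst (_ ∈_) (≡.trans (f-supp K) eq) x∈))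

-- A concrete pyramid over T^i_2

module Realisation {c ℓ₁ ℓ₂ : Level} (F : OrderedField c ℓ₁ ℓ₂) where

  open OrderedField F hiding (zero)
  open OrderedFieldProperties F
  open Geometry F
  open LinearAlgebra F
  open FaceStructure F
  open Frames F
  open GaleDuality F
  open Simplices F
  open SetoidReasoning setoid

  module _ (w r : ℕ) where

    private
      i d : ℕ
      i = 3 ℕ.+ w
      d = r ℕ.+ i

      -- The last `i` coordinates carry the simplex; the first `r` stay free for the apexes.
      V : Vector (Point d) (suc i)
      V = (λ _ → 0#) ∷ λ l → δ (r ↑ʳ l)

      V-ind : AffinelyIndependent V
      V-ind t ∑t≈0 eq = λ { zero → t₀≈0 ; (suc l) → tₗ≈0 l }
        where
        tₗ≈0 : ∀ l → t (suc l) ≈ 0#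
        tₗ≈0 l = begin
          t (suc l)  ≈⟨ *-identityʳ _ ⟨
          t (suc l) * 1#  ≈⟨ *-congˡ (δ-refl (r ↑ʳ l)) ⟨
          t (suc l) * δ (r ↑ʳ l) (r ↑ʳ l)  ≈⟨ ∑-single (λ k → t (suc k) * δ (r ↑ʳ k) (r ↑ʳ l)) l (λ k k≢l → y≈0⇒x*y≈0 (δ-≢ (k≢l ∘ Fin.↑ʳ-injective r k l))) ⟨
          sum (λ k → t (suc k) * δ (r ↑ʳ k) (r ↑ʳ l))  ≈⟨ +-identityˡ _ ⟨
          0# + sum (λ k → t (suc k) * δ (r ↑ʳ k) (r ↑ʳ l))  ≈⟨ +-congʳ (zeroʳ (t zero)) ⟨
          combination t V (r ↑ʳ l)  ≈⟨ eq (r ↑ʳ l) ⟩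
          0# ∎
        t₀≈0 : t zero ≈ 0#
        t₀≈0 = trans (sym (trans (+-congˡ (∑-zero tₗ≈0)) (+-identityʳ _))) ∑t≈0

      S : Carrier
      S = sum {suc w} (λ _ → 1#)

      0<S : 0# < S
      0<S = ∑-pos {suc w} (λ _ → inj₁ 0<1) zero 0<1

      -- The w + 1 final ones add up to `S`, so with two entries -S the first must be 1 + S to give
      -- total 1. Exactly two barycentric coordinates are negative, as T^i_2 requires.
      t : Vector Carrier (suc i)
      t = (1# + S) ∷ (- S ∷ (- S ∷ λ _ → 1#))

      ∑t≈1 : sum t ≈ 1#
      ∑t≈1 = solve 2 (λ o s → (o :+ s) :+ ((:- s) :+ ((:- s) :+ s)) := o) refl 1# S

      t-sides : ∀ j → t j < 0# ⊎ 0# < t j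
      t-sides zero                = inj₂ (+-pos-nonneg 0<1 (inj₁ 0<S))
      t-sides (suc zero)          = inj₁ (pos-neg 0<S)
      t-sides (suc (suc zero))    = inj₁ (pos-neg 0<S)
      t-sides (suc (suc (suc j))) = inj₂ 0<1

      x : Point d
      x = combination t V

      open Simplex V V-ind

      two-negative : tally (negative? {x} t ∑t≈1 (λ _ → refl) t-sides) ≡ 2
      two-negative = ≡.cong₂ ℕ._+_ (≡.cong (b2n ∘ pos?) (side-neg (pos-neg (+-pos-nonneg 0<1 (inj₁ 0<S)))))
                    (≡.cong₂ ℕ._+_ (≡.cong (b2n ∘ pos?) (side-pos (neg-pos (pos-neg 0<S))))
                    (≡.cong₂ ℕ._+_ (≡.cong (b2n ∘ pos?) (side-pos (neg-pos (pos-neg 0<S))))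
                    (tally-none (λ (_ : Fin (suc w)) → pos? (side (- 1#))) (λ _ → ≡.cong pos? (side-neg (pos-neg 0<1))))))

      base-polytope : Polytope d
      base-polytope = adjoin x Δ

      base-isT : IsT i 2 base-polytope
      base-isT = isT V x V-ind (t , ∑t≈1 , λ _ → refl)
        (≡.subst (# Faces Δ (λ G → Dim (Locus G) (i ∸ 1) × Beyond x G) ≡_) two-negative (facets-beyond t ∑t≈1 (λ _ → refl) t-sides))
        (λ G dG → misses-generic t ∑t≈1 (λ _ → refl) t-sides {G} (facet-opposite G dG))

      -- The coordinates reserved for later apexes vanish on the presenting points, hence on their
      -- affine hull, so the next unit vector lies outside it.
      Fresh : ℕ → Polytope d → Set _
      Fresh n Q = ∀ (k : Fin r) → n ℕ.≤ toℕ k → ∀ a → points Q a (k ↑ˡ i) ≈ 0#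

      base-fresh : Fresh 0 base-polytope
      base-fresh k _ zero          = ∑-zero λ j → y≈0⇒x*y≈0 {x = t j} (V-fresh j)
        where
        V-fresh : ∀ j → V j (k ↑ˡ i) ≈ 0#
        V-fresh zero    = refl
        V-fresh (suc l) = δ-≢ λ eq → case ≡.trans (≡.sym (Fin.splitAt-↑ʳ r i l)) (≡.trans (≡.cong (splitAt r) eq) (Fin.splitAt-↑ˡ r k i)) of λ ()
      base-fresh k _ (suc zero)    = refl
      base-fresh k _ (suc (suc l)) = δ-≢ λ eq → case ≡.trans (≡.sym (Fin.splitAt-↑ʳ r i l)) (≡.trans (≡.cong (splitAt r) eq) (Fin.splitAt-↑ˡ r k i)) of λ ()

      pyramid : ∀ n → n ℕ.≤ r → Σ[ Q ∈ Polytope d ] IteratedPyramid base-polytope n Q × Fresh n Q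
      pyramid zero    _   = base-polytope , base , base-fresh
      pyramid (suc n) n<r = let (Q , pyr , fresh) = pyramid n (ℕ.<⇒≤ n<r) in
        adjoin apex Q , cone pyr apex (apex∉ Q fresh) , λ { k n<k zero → new k n<k ; k n<k (suc a) → fresh k (ℕ.<⇒≤ n<k) a }
        where
        k₀ : Fin r
        k₀ = fromℕ< n<r
        apex : Point d
        apex = δ (k₀ ↑ˡ i)
        apex∉ : ∀ Q → Fresh n Q → ¬ Aff (points Q) apex
        apex∉ Q fresh (s , _ , eq) = 0≉1 (begin
          0#  ≈⟨ ∑-zero (λ a → y≈0⇒x*y≈0 {x = s a} (fresh k₀ (ℕ.≤-reflexive (≡.sym (Fin.toℕ-fromℕ< n<r))) a)) ⟨
          combination s (points Q) (k₀ ↑ˡ i)  ≈⟨ eq (k₀ ↑ˡ i) ⟩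
          apex (k₀ ↑ˡ i)  ≈⟨ δ-refl (k₀ ↑ˡ i) ⟩
          1# ∎)
        new : ∀ k → n ℕ.< toℕ k → apex (k ↑ˡ i) ≈ 0#
        new k n<k = δ-≢ λ eq → ℕ.<-irrefl (≡.trans (≡.sym (Fin.toℕ-fromℕ< n<r)) (≡.cong toℕ (Fin.↑ˡ-injective i k₀ k eq))) n<k

    pyramid-exists : Σ[ Q ∈ Polytope (r ℕ.+ (3 ℕ.+ w)) ] IsPyramidT (r ℕ.+ (3 ℕ.+ w)) r 2 Q
    pyramid-exists = let (Q , pyr , _) = pyramid r ℕ.≤-refl in
      Q , base-polytope , ≡.subst (λ n → IsT n 2 base-polytope) (≡.sym (ℕ.m+n∸m≡n r i)) base-isT , pyr

-- The bound and its sharpness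

open import Data.Nat.Base using (_+_; _*_; _≤_; z≤n; s≤s; ⌊_/2⌋)
open import Data.Nat.Combinatorics using (_C_)
open import Relation.Binary.PropositionalEquality using (refl; sym; trans; cong; cong₂; subst)

pos?⁻ : ∀ {s} → pos? s ≡ true → s ≡ pos
pos?⁻ {pos} _ = refl

neg?⁻ : ∀ {s} → neg? s ≡ true → s ≡ neg
neg?⁻ {neg} _ = refl

tally-witness : ∀ {N n} (κ : Fin N → Bool) → tally κ ≡ suc n → ∃[ j ] κ j ≡ true
tally-witness κ eq = nth κ (subst Fin (sym eq) zero)

even-form : ∀ {d} → 4 ≤ d → 2 ∣ d → ∃[ u ] d ≡ 4 + u + u × ⌊ d /2⌋ ∸ 2 ≡ u
even-form 4≤d (divides zero refl)          = contradiction 4≤d λ ()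
even-form 4≤d (divides (suc zero) refl)    = contradiction 4≤d λ { (s≤s (s≤s ())) }
even-form 4≤d (divides (suc (suc u)) refl) = u , cong (λ n → suc (suc (suc (suc n)))) u*2≡ ,
    trans (cong ⌊_/2⌋ u*2≡) (sym (ℕ.n≡⌊n+n/2⌋ u))
  where
  u*2≡ : u * 2 ≡ u + u
  u*2≡ = trans (ℕ.*-comm u 2) (cong (u +_) (ℕ.+-identityʳ u))

module Conclusion {c ℓ₁ ℓ₂ : Level} (F : OrderedField c ℓ₁ ℓ₂) where

  open Geometry F
  open LinearAlgebra F
  open FaceStructure F
  open Codes F
  open Frames F
  open FacetFrames F
  open GaleDuality F
  open Simplices F
  open Existence F
  open Realisation F

  module _ {e N} {P : Polytope e} {σ : Fin N → Side} (code : Code P σ) where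

    open Code code
    open GaleSets σ

    f-number : ℕ → ℕ
    f-number m = #ₛ (ofRank (suc m))

    f-equation : ∀ m → f-number m + ((#₋ σ + #₀ σ) C (2 + m) + (#₊ σ + #₀ σ) C (2 + m))
                       ≡ N C (2 + m) + (#₀ σ C (2 + m) + #₀ σ C (1 + m))
    f-equation m = subst (λ a → f-number m + (a C (2 + m) + (#₊ σ + #₀ σ) C (2 + m)) ≡ rhs) (#-not-pos σ)
      (subst (λ b → f-number m + (tally (not ∘ pos? ∘ σ) C (2 + m) + b C (2 + m)) ≡ rhs) (#-not-neg σ) (#-ofRank σ m))
      where rhs = N C (2 + m) + (#₀ σ C (2 + m) + #₀ σ C (1 + m))

    -- As both sides occur, the full set of indices is a Gale set and codes the whole polytope; its
    -- rank is N - 1.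
    code-dim : ∀ {p q d} → #₊ σ ≡ suc p → #₋ σ ≡ suc q → N ≡ 2 + d → P is d -dimensional
    code-dim {d = d} eq₊ eq₋ N≡ = rank-resp (λ _ → proj₁) body⊆⊤ (subst (Rank (Locus ⊤-face)) full-rank (face-rank ⊤-face))
      where
      meets-⊤ : ∀ {n} (κ : Fin N → Bool) → tally κ ≡ suc n → meets κ ⊤ ≡ true
      meets-⊤ κ eq = meets⁺ {κ = κ} {⊤} ∈⊤ (proj₂ (tally-witness κ eq))
      full : ∃[ G ] supp G ≡ ⊤
      full = supp-onto ⊤ (trans (meets-⊤ (pos? ∘ σ) eq₊) (sym (meets-⊤ (neg? ∘ σ) eq₋)))
      supp-⊤ : supp ⊤-face ≡ ⊤
      supp-⊤ = ⊆-antisym ⊆⊤ (subst (_⊆ supp ⊤-face) (proj₂ full)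
        (supp-mono {proj₁ full} {⊤-face} (λ i _ → ⊤-face-value {P = P} (points P i))))
      full-rank : rank (supp ⊤-face) ≡ suc d
      full-rank = trans (cong rank supp-⊤) (cong₂ (λ n b → n ∸ b2n b) (trans (∣⊤∣≡n N) N≡) (meets-⊤ (pos? ∘ σ) eq₊))

  lower-bound : ∀ {e} (d : ℕ) (P : Polytope e) → P is d -dimensional →
                f[ 0 ] P ≥ (2 * d + 1) → f[ d ∸ 1 ] P ≡ (d + 2) →
                ∀ m → 1 ≤ m → m ≤ d ∸ 1 → f[ m ] P ≥ bound d m
  lower-bound zero          P dim vertices facets m 1≤m m≤ = contradiction (ℕ.≤-trans 1≤m m≤) λ ()
  lower-bound (suc zero)    P dim vertices facets m 1≤m m≤ = contradiction (ℕ.≤-trans 1≤m m≤) λ ()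
  lower-bound (suc (suc d)) P dim vertices facets m 1≤m m≤ =
    #-injection (FacesOfDim P m) (face-count m)
      (bound-≤ (#₊ σ) (#₋ σ) (#₀ σ) m 1≤m (#-sides σ) (s≤s (s≤s z≤n)) (f-equation code 0)
        (#-≥ (FacesOfDim P 0) (face-count 0) vertices) (f-equation code m))
    where
    frame : Frame P (4 + d)
    frame = facet-frame dim (subst (f[ suc d ] P ≡_) (ℕ.+-comm (2 + d) 2) facets)
    σ : Fin (4 + d) → Side
    σ = side ∘ Frame.μ frame
    code : Code P σ
    code = frame⇒code frame
    open Code code using (face-count)

  -- T^{d,r}_2 for d = 4 + 2u and r = u.
  module _ (u : ℕ) where

    open Sharp u using (sharp-bound; sharp-vertices; sharp-facets)

    private
      d : ℕ
      d = 4 + u + u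

      d∸u : d ∸ u ≡ 4 + u
      d∸u = ℕ.m+n∸n≡m (4 + u) u

    gale-of : ∀ {e} {T : Polytope e} → IsPyramidT d u 2 T →
              ∃[ ω ] GaleDual T ω × size T ≡ 2 + d × #₊ (side ∘ ω) ≡ 3 × #₋ (side ∘ ω) ≡ 3 + u × #₀ (side ∘ ω) ≡ u
    gale-of {T = T} (B , isB , pyr) with isT-gale (subst (λ i → IsT i 2 B) d∸u isB)
    ... | _ , galeB , sizeB , B₊ , B₀ with pyramid-gale pyr galeB
    ...   | ω , galeT , sizeT , T₊ , T₋ , T₀ = ω , galeT , size≡ , eq₊ , eq₋ , eq₀
      where
      size≡ : size T ≡ 2 + d
      size≡ = trans sizeT (trans (cong (u +_) sizeB) (ℕ.+-comm u (6 + u)))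
      eq₊ : #₊ (side ∘ ω) ≡ 3
      eq₊ = trans T₊ B₊
      eq₀ : #₀ (side ∘ ω) ≡ u
      eq₀ = trans T₀ (trans (cong (u +_) B₀) (ℕ.+-identityʳ u))
      -- The negative entries are what remains of the 2 + d points after 3 positive and `u` null
      -- ones.
      eq₋ : #₋ (side ∘ ω) ≡ 3 + u
      eq₋ = ℕ.+-cancelˡ-≡ 3 _ _ (ℕ.+-cancelʳ-≡ u _ _
        (trans (cong₂ (λ a b → a + #₋ (side ∘ ω) + b) (sym eq₊) (sym eq₀)) (trans (#-sides (side ∘ ω)) size≡)))

    -- Only the numbers of positive, negative and null entries matter, so every realisation of the
    -- pyramid and every dual of it have the same face numbers.
    face-numbers : ∀ {e e′} (T : Polytope e) (P : Polytope e′) → IsPyramidT d u 2 T → IsDual P T →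
                   P is d -dimensional × f[ 0 ] P ≡ (2 * d + 1) × f[ d ∸ 1 ] P ≡ (d + 2) ×
                   (∀ m → 1 ≤ m → f[ m ] P ≡ bound d m)
    face-numbers T P pyramid dual =
      let (_ , gale , size≡ , eq₊ , eq₋ , eq₀) = gale-of pyramid in from-code (dual-code gale dual) size≡ eq₊ eq₋ eq₀
      where
      from-code : ∀ {N} {σ : Fin N → Side} → Code P σ → N ≡ 2 + d → #₊ σ ≡ 3 → #₋ σ ≡ 3 + u → #₀ σ ≡ u →
                  P is d -dimensional × f[ 0 ] P ≡ (2 * d + 1) × f[ d ∸ 1 ] P ≡ (d + 2) ×
                  (∀ m → 1 ≤ m → f[ m ] P ≡ bound d m)
      from-code code size≡ eq₊ eq₋ eq₀ =
        code-dim code eq₊ eq₋ size≡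
        , subst (f[ 0 ] P ≡_) (sharp-vertices (equation 0)) (face-count 0)
        , subst (f[ d ∸ 1 ] P ≡_) (sharp-facets (equation (d ∸ 1))) (face-count (d ∸ 1))
        , λ m 1≤m → subst (f[ m ] P ≡_) (sharp-bound m 1≤m (equation m)) (face-count m)
        where
        open Code code using (face-count)
        substitute : ∀ m {n p q r f} → n ≡ 6 + u + u → p ≡ 3 → q ≡ 3 + u → r ≡ u →
                     f + ((q + r) C (2 + m) + (p + r) C (2 + m)) ≡ n C (2 + m) + (r C (2 + m) + r C (1 + m)) →
                     Sharp.FaceEquation u m f
        substitute m refl refl refl refl eq = eq
        equation : ∀ m → Sharp.FaceEquation u m (f-number code m)
        equation m = substitute m {f = f-number code m} size≡ eq₊ eq₋ eq₀ (f-equation code m)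

    -- The polytope `P` is the slice for the signs of the dependency of `T`. Its existence ensures
    -- that the description of all such dual pairs is not vacuous.
    dual-pair : Σ[ T ∈ Polytope d ] Σ[ P ∈ Polytope d ] IsPyramidT d u 2 T × IsDual P T
    dual-pair = pair (subst (λ n → Σ[ T ∈ Polytope n ] IsPyramidT n u 2 T) (ℕ.+-comm u (4 + u)) (pyramid-exists (1 + u) u))
      where
      coded : ∀ {N} (σ : Fin N → Side) → N ≡ 2 + d → #₊ σ ≡ 3 → #₋ σ ≡ 3 + u → Σ[ P ∈ Polytope d ] Code P σ
      coded σ refl eq₊ eq₋ =
        let (p₀ , σp₀) = tally-witness (pos? ∘ σ) eq₊ ; (q₀ , σq₀) = tally-witness (neg? ∘ σ) eq₋ in
        Slice.P σ p₀ q₀ (pos?⁻ σp₀) (neg?⁻ σq₀) , Slice.code σ p₀ q₀ (pos?⁻ σp₀) (neg?⁻ σq₀)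
      pair : Σ[ T ∈ Polytope d ] IsPyramidT d u 2 T → Σ[ T ∈ Polytope d ] Σ[ P ∈ Polytope d ] IsPyramidT d u 2 T × IsDual P T
      pair (T , pyramid) =
        let (ω , gale , size≡ , eq₊ , eq₋ , _) = gale-of pyramid
            (P , code) = coded (side ∘ ω) size≡ eq₊ eq₋
        in T , P , pyramid , code⇒dual gale code

lemma4p3 : ∀ {c ℓ₁ ℓ₂} (F : OrderedField c ℓ₁ ℓ₂) → let open Geometry F in
    (∀ {e} (d : ℕ) (P : Polytope e) → P is d -dimensional →
    f[ 0 ] P ≥ (2 * d + 1) → f[ d ∸ 1 ] P ≡ (d + 2) →
    ∀ m → 1 ≤ m → m ≤ d ∸ 1 → f[ m ] P ≥ bound d m)
    ×
    (∀ (d : ℕ) → 4 ≤ d → 2 ∣ d →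
    (Σ[ T ∈ Polytope d ] Σ[ P ∈ Polytope d ]
    IsPyramidT d (⌊ d /2⌋ ∸ 2) 2 T × IsDual P T)
    ×
    (∀ {e e′} (T : Polytope e) (P : Polytope e′) →
    IsPyramidT d (⌊ d /2⌋ ∸ 2) 2 T → IsDual P T →
    P is d -dimensional ×
    f[ 0 ] P ≡ (2 * d + 1) × f[ d ∸ 1 ] P ≡ (d + 2) ×
    (∀ m → 1 ≤ m → f[ m ] P ≡ bound d m)))
lemma4p3 F = lower-bound , λ d 4≤d 2∣d → sharpness (even-form 4≤d 2∣d)
  where
  open Geometry F
  open Conclusion F
  sharpness : ∀ {d r} → ∃[ u ] d ≡ 4 + u + u × r ≡ u →
              (Σ[ T ∈ Polytope d ] Σ[ P ∈ Polytope d ] IsPyramidT d r 2 T × IsDual P T)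
              ×
              (∀ {e e′} (T : Polytope e) (P : Polytope e′) → IsPyramidT d r 2 T → IsDual P T →
               P is d -dimensional × f[ 0 ] P ≡ (2 * d + 1) × f[ d ∸ 1 ] P ≡ (d + 2) ×
               (∀ m → 1 ≤ m → f[ m ] P ≡ bound d m))
  sharpness (u , refl , refl) = dual-pair u , face-numbers u
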